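{- Let $r\leqslant 1$ be an integer coprime with $3$. Let $p$ be a prime such that $p\equiv -r\pmod{3}$ and $p\geqslant 3-r$. Then $$\sum_{k=0}^{p-1} (6k+r) \frac{\left(\frac{r}{3}\right)_k^6}{k!^6} \equiv \frac{(-1)^{r+1}\,80rp^4}{81}\cdot \frac{\Gamma_p\!\left(1+\frac{r}{3}\right)^2} {\Gamma_p\!\left(1+\frac{2r}{3}\right)^3 \Gamma_p\!\left(1-\frac{r}{3}\right)^4} \sum_{k=0}^{1-r}\frac{(r-1)_k\left(\frac{r}{3}\right)_k^3} {(1)_k\left(\frac{2r}{3}\right)_k^3} \pmod{p^5}.$$
   Context: For a number $a$ and a non-negative integer $k$, $(a)_k=a(a+1)\cdots(a+k-1)$ denotes the Pochhammer symbol, with $(a)_0=1$. $\Gamma_p$ denotes Morita's $p$-adic Gamma function: for positive integers $n$, $\Gamma_p(n)=(-1)^n\prod_{0<j<n,\ p\nmid j} j$, and $\Gamma_p$ is extended to $\mathbb{Z}_p$ by continuity (note $\frac{r}{3},\frac{2r}{3}\in\mathbb{Z}_p$ since $p\neq 3$). Congruences modulo $p^5$ are understood in $\mathbb{Z}_p$: two $p$-adic integers are congruent modulo $p^5$ if their difference lies in $p^5\mathbb{Z}_p$. -}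

module Defs where

open import Algebra.Bundles using (CommutativeRing)
import Algebra.Properties.Semiring.Exp as Exp
import Algebra.Properties.Semiring.Sum as Sum
open import Data.Fin.Base using (toℕ)
open import Data.Integer as ℤ using (ℤ; +_; 0ℤ; 1ℤ; -1ℤ)
open import Data.Integer.DivMod using (n%ℕd<d; a≡a%ℕn+[a/ℕn]*n)
open import Data.Integer.Divisibility.Signed using (_∣_; divides; _∣?_; ∣ᵤ⇒∣; ∣⇒∣ᵤ)
import Data.Integer.Divisibility.Signed as ∣
import Data.Integer.Properties as ℤ
open import Data.Integer.Tactic.RingSolver using (solve-∀)
open import Data.List.Base using (List; []; _∷_; _++_; [_]; _∷ʳ_; filter; upTo; applyUpTo; length)
import Data.List.Properties as List
open import Data.List.Membership.Propositional using (_∈_; _∉_)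
open import Data.List.Membership.Propositional.Properties using (∈-∃++; ∈-applyUpTo⁺; ∈-applyUpTo⁻)
open import Data.List.Relation.Binary.Permutation.Propositional using (_↭_; ↭-sym; ↭⇒↭ₛ)
open import Data.List.Relation.Binary.Permutation.Propositional.Properties using (∈-resp-↭; ↭-length; shift)
import Data.List.Relation.Binary.Permutation.Setoid.Properties as Permutation
import Data.List.Relation.Unary.All.Properties as All
open import Data.List.Relation.Unary.AllPairs using (_∷_)
open import Data.List.Relation.Unary.Any using (here; there)
open import Data.List.Relation.Unary.Unique.Propositional using (Unique)
import Data.List.Relation.Unary.Unique.Propositional.Properties as Unique
open import Data.Nat.Base as ℕ using (ℕ; zero; suc; _<_; _≤_; z≤n; s≤s; NonZero)
open import Data.Nat.Coprimality using (prime⇒coprime; coprime-Bézout)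
import Data.Nat.Divisibility as ℕ
open import Data.Nat.GCD using (module Bézout)
open import Data.Nat.ListAction using (product)
open import Data.Nat.ListAction.Properties using (product-++; product-↭)
open import Data.Nat.Primality using (Prime; prime⇒nonZero; prime⇒nonTrivial; euclidsLemma; prime⇒irreducible)
import Data.Nat.Properties as ℕ
open import Data.Product using (∃; _×_; _,_; proj₁; proj₂)
open import Data.Sum using (_⊎_; inj₁; inj₂; [_,_]′)
open import Level using (0ℓ)
open import Relation.Binary.Bundles using (Setoid)
open import Relation.Binary.Definitions using (tri<; tri≈; tri>)
import Relation.Binary.Reasoning.Setoid as ≈-Reasoning
open import Relation.Binary.PropositionalEquality using (_≡_; refl; sym; trans; cong; cong₂; subst; setoid; module ≡-Reasoning)
open import Relation.Nullary using (¬_; yes; no; ¬?)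
open import Relation.Nullary.Negation using (contradiction)

infix 4 _≡_[mod_]

record _≡_[mod_] (a b m : ℤ) : Set where
  constructor mod
  field difference : m ∣ a ℤ.- b
open _≡_[mod_]

module Modular {m : ℤ} where

  mod-reflexive : ∀ {a b} → a ≡ b → a ≡ b [mod m ]
  mod-reflexive {a} refl = mod (divides 0ℤ (ℤ.+-inverseʳ a))

  mod-refl : ∀ {a} → a ≡ a [mod m ]
  mod-refl = mod-reflexive refl

  mod-sym : ∀ {a b} → a ≡ b [mod m ] → b ≡ a [mod m ]
  mod-sym {a} {b} (mod d) = mod (subst (m ∣_) (eq a b) (∣.∣m⇒∣-m d))
    where
    eq : ∀ a b → ℤ.- (a ℤ.- b) ≡ b ℤ.- a
    eq = solve-∀

  mod-trans : ∀ {a b c} → a ≡ b [mod m ] → b ≡ c [mod m ] → a ≡ c [mod m ]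
  mod-trans {a} {b} {c} (mod d) (mod e) = mod (subst (m ∣_) (eq a b c) (∣.∣m∣n⇒∣m+n d e))
    where
    eq : ∀ a b c → (a ℤ.- b) ℤ.+ (b ℤ.- c) ≡ a ℤ.- c
    eq = solve-∀

  mod-+ : ∀ {a b c d} → a ≡ b [mod m ] → c ≡ d [mod m ] → a ℤ.+ c ≡ b ℤ.+ d [mod m ]
  mod-+ {a} {b} {c} {d} (mod x) (mod y) =
    mod (subst (m ∣_) (eq a b c d) (∣.∣m∣n⇒∣m+n x y))
    where
    eq : ∀ a b c d → (a ℤ.- b) ℤ.+ (c ℤ.- d) ≡ (a ℤ.+ c) ℤ.- (b ℤ.+ d)
    eq = solve-∀

  mod-neg : ∀ {a b} → a ≡ b [mod m ] → ℤ.- a ≡ ℤ.- b [mod m ]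
  mod-neg {a} {b} (mod x) = mod (subst (m ∣_) (eq a b) (∣.∣m⇒∣-m x))
    where
    eq : ∀ a b → ℤ.- (a ℤ.- b) ≡ ℤ.- a ℤ.- ℤ.- b
    eq = solve-∀

  mod-* : ∀ {a b c d} → a ≡ b [mod m ] → c ≡ d [mod m ] → a ℤ.* c ≡ b ℤ.* d [mod m ]
  mod-* {a} {b} {c} {d} (mod x) (mod y) =
    mod (subst (m ∣_) (eq a b c d) (∣.∣m∣n⇒∣m+n (∣.∣m⇒∣m*n c x) (∣.∣n⇒∣m*n b y)))
    where
    eq : ∀ a b c d → (a ℤ.- b) ℤ.* c ℤ.+ b ℤ.* (c ℤ.- d) ≡ a ℤ.* c ℤ.- b ℤ.* d
    eq = solve-∀

  mod-^ : ∀ {a b} n → a ≡ b [mod m ] → a ℤ.^ n ≡ b ℤ.^ n [mod m ]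
  mod-^ zero    e = mod-refl
  mod-^ (suc n) e = mod-* e (mod-^ n e)

  m≡0 : ∀ {a} → m ∣ a → a ≡ 0ℤ [mod m ]
  m≡0 {a} d = mod (subst (m ∣_) (sym (ℤ.+-identityʳ a)) d)

  ≡0⇒∣ : ∀ {a} → a ≡ 0ℤ [mod m ] → m ∣ a
  ≡0⇒∣ {a} (mod d) = subst (m ∣_) (ℤ.+-identityʳ a) d

  ∣-resp : ∀ {a b} → a ≡ b [mod m ] → m ∣ a → m ∣ b
  ∣-resp e d = ≡0⇒∣ (mod-trans (mod-sym e) (m≡0 d))

  modSetoid : Setoid 0ℓ 0ℓ
  modSetoid = record
    { Carrier = ℤ
    ; _≈_ = _≡_[mod m ]
    ; isEquivalence = record { refl = mod-refl ; sym = mod-sym ; trans = mod-trans }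
    }

  inverse-unique : ∀ {a u v} → a ℤ.* u ≡ 1ℤ [mod m ] → a ℤ.* v ≡ 1ℤ [mod m ] → u ≡ v [mod m ]
  inverse-unique {a} {u} {v} p q =
    mod-trans (mod-reflexive (sym (ℤ.*-identityˡ u)))
      (mod-trans (mod-* (mod-sym q) (mod-refl {u}))
        (mod-trans (mod-reflexive (eq a u v))
          (mod-trans (mod-* p (mod-refl {v})) (mod-reflexive (ℤ.*-identityˡ v)))))
    where
    eq : ∀ a u v → (a ℤ.* v) ℤ.* u ≡ (a ℤ.* u) ℤ.* v
    eq = solve-∀

open Modular

weaken : ∀ {k m a b} → k ∣ m → a ≡ b [mod m ] → a ≡ b [mod k ]
weaken k∣m (mod d) = mod (∣.∣-trans k∣m d)

any-mod-1 : ∀ {a b} → a ≡ b [mod 1ℤ ]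
any-mod-1 {a} {b} = mod (divides (a ℤ.- b) (sym (ℤ.*-identityʳ _)))

geometric : ℤ → ℕ → ℤ
geometric t zero    = 0ℤ
geometric t (suc n) = 1ℤ ℤ.+ t ℤ.* geometric t n

geometric-sum : ∀ t n → (1ℤ ℤ.- t) ℤ.* geometric t n ≡ 1ℤ ℤ.- t ℤ.^ n
geometric-sum t zero    = ℤ.*-zeroʳ (1ℤ ℤ.- t)
geometric-sum t (suc n) = begin
  (1ℤ ℤ.- t) ℤ.* (1ℤ ℤ.+ t ℤ.* geometric t n)          ≡⟨ eq₁ t (geometric t n) ⟩
  (1ℤ ℤ.- t) ℤ.+ t ℤ.* ((1ℤ ℤ.- t) ℤ.* geometric t n)  ≡⟨ cong (λ z → (1ℤ ℤ.- t) ℤ.+ t ℤ.* z) (geometric-sum t n) ⟩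
  (1ℤ ℤ.- t) ℤ.+ t ℤ.* (1ℤ ℤ.- t ℤ.^ n)                ≡⟨ eq₂ t (t ℤ.^ n) ⟩
  1ℤ ℤ.- t ℤ.* t ℤ.^ n                                 ∎
  where
  open ≡-Reasoning
  eq₁ : ∀ t g → (1ℤ ℤ.- t) ℤ.* (1ℤ ℤ.+ t ℤ.* g) ≡ (1ℤ ℤ.- t) ℤ.+ t ℤ.* ((1ℤ ℤ.- t) ℤ.* g)
  eq₁ = solve-∀
  eq₂ : ∀ t x → (1ℤ ℤ.- t) ℤ.+ t ℤ.* (1ℤ ℤ.- x) ≡ 1ℤ ℤ.- t ℤ.* x
  eq₂ = solve-∀

geometric-≡1 : ∀ {m t} n → t ≡ 1ℤ [mod m ] → geometric t n ≡ + n [mod m ]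
geometric-≡1 zero e = mod-refl
geometric-≡1 {t = t} (suc n) e =
  mod-trans (mod-+ (mod-refl {a = 1ℤ}) (mod-* e (geometric-≡1 n e)))
    (mod-reflexive (cong (λ z → 1ℤ ℤ.+ z) (ℤ.*-identityˡ (+ n))))

∣-^ : ∀ {m t} n → m ∣ t → m ℤ.^ n ∣ t ℤ.^ n
∣-^ zero    d = ∣.∣-refl
∣-^ {m} {t} (suc n) d with d | ∣-^ n d
... | divides q refl | divides q′ eq =
  divides (q ℤ.* q′) (trans (cong (λ z → (q ℤ.* m) ℤ.* z) eq) (lemma q m q′ (m ℤ.^ n)))
  where
  lemma : ∀ q m q′ x → (q ℤ.* m) ℤ.* (q′ ℤ.* x) ≡ (q ℤ.* q′) ℤ.* (m ℤ.* x)
  lemma = solve-∀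

pos-^ : ∀ m n → + (m ℕ.^ n) ≡ (+ m) ℤ.^ n
pos-^ m zero    = refl
pos-^ m (suc n) = trans (ℤ.pos-* m (m ℕ.^ n)) (cong (λ z → (+ m) ℤ.* z) (pos-^ m n))

ℕ≡⇒∣ : ∀ {m a b : ℕ} → b ≤ a → + a ≡ + b [mod + m ] → ∃ λ k → a ≡ b ℕ.+ k ℕ.* m
ℕ≡⇒∣ {m} {a} {b} b≤a (mod d) with ∣⇒∣ᵤ d
... | ℕ.divides q eq = q , (begin
  a                        ≡⟨ ℕ.m+[n∸m]≡n b≤a ⟨
  b ℕ.+ (a ℕ.∸ b)          ≡⟨ cong (b ℕ.+_) (trans (sym (cong ℤ.∣_∣ (trans (ℤ.m-n≡m⊖n a b) (ℤ.⊖-≥ b≤a)))) eq) ⟩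
  b ℕ.+ q ℕ.* m            ∎)
  where open ≡-Reasoning

<-mod-unique : ∀ {m a b : ℕ} → a < m → b < m → + a ≡ + b [mod + m ] → a ≡ b
<-mod-unique {m} {a} {b} a<m b<m e = [ (λ b≤a → go a<m b≤a e) , (λ a≤b → sym (go b<m a≤b (mod-sym e))) ]′ (ℕ.≤-total b a)
  where
  go : ∀ {a b} → a < m → b ≤ a → + a ≡ + b [mod + m ] → a ≡ b
  go {a} {b} a<m b≤a e with ℕ≡⇒∣ b≤a e
  ... | zero  , eq = trans eq (ℕ.+-identityʳ b)
  ... | suc k , eq = contradiction a<m (ℕ.≤⇒≯ (subst (m ≤_) (sym eq)
          (ℕ.≤-trans (ℕ.m≤m+n m (k ℕ.* m)) (ℕ.m≤n+m _ b))))

-- (-1)ⁿ times the product of the j < n prime to p; j = 0 drops out since p ∣ 0.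
Γℕ : ℕ → ℕ → ℤ
Γℕ p n = -1ℤ ℤ.^ n ℤ.* + product (filter (λ j → ¬? (p ℕ.∣? j)) (upTo n))

%ℕ-≡ : ∀ x d .{{_ : NonZero d}} → x ≡ + (x ℤ.%ℕ d) [mod + d ]
%ℕ-≡ x d = mod (divides (x ℤ./ℕ d)
  (trans (cong (λ z → z ℤ.- + (x ℤ.%ℕ d)) (a≡a%ℕn+[a/ℕn]*n x d)) (eq (+ (x ℤ.%ℕ d)) (x ℤ./ℕ d ℤ.* + d))))
  where
  eq : ∀ r y → (r ℤ.+ y) ℤ.- r ≡ y
  eq = solve-∀

module PrimeModulus {p : ℕ} (p-prime : Prime p) where

  private instance
    p≢0 : NonZero p
    p≢0 = prime⇒nonZero p-prime

  2≤p : 2 ≤ p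
  2≤p = ℕ.nonTrivial⇒n>1 p {{prime⇒nonTrivial p-prime}}

  euclid : ∀ a b → + p ∣ a ℤ.* b → + p ∣ a ⊎ + p ∣ b
  euclid a b d with euclidsLemma ℤ.∣ a ∣ ℤ.∣ b ∣ p-prime (subst (p ℕ.∣_) (ℤ.abs-* a b) (∣⇒∣ᵤ d))
  ... | inj₁ e = inj₁ (∣ᵤ⇒∣ e)
  ... | inj₂ e = inj₂ (∣ᵤ⇒∣ e)

  p∤small : ∀ {n} → 0 < n → n < p → ¬ + p ∣ + n
  p∤small {n} 0<n n<p d = ℕ.<⇒≱ n<p (ℕ.∣⇒≤ {{ℕ.>-nonZero 0<n}} (∣⇒∣ᵤ d))

  p∤1 : ¬ + p ∣ 1ℤ
  p∤1 = p∤small (s≤s z≤n) 2≤p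

  inverse-mod : ∀ x → ¬ + p ∣ x → ∃ λ u → x ℤ.* u ≡ 1ℤ [mod + p ]
  inverse-mod x p∤x = u , mod-trans (mod-* (%ℕ-≡ x p) (mod-refl {a = u})) (proj₂ unit)
    where
    n = x ℤ.%ℕ p
    0<n : 0 < n
    0<n with x ℤ.%ℕ p in eq
    ... | zero  = contradiction
      (≡0⇒∣ (mod-trans (%ℕ-≡ x p) (mod-reflexive (cong +_ eq)))) p∤x
    ... | suc _ = s≤s z≤n
    instance
      n≢0 : NonZero n
      n≢0 = ℕ.>-nonZero 0<n
    unit : ∃ λ u → + n ℤ.* u ≡ 1ℤ [mod + p ]
    unit with coprime-Bézout (prime⇒coprime p-prime (n%ℕd<d x p))
    ... | Bézout.+- a b eq = ℤ.- + b , mod (divides (ℤ.- + a) (begin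
      + n ℤ.* ℤ.- + b ℤ.- 1ℤ       ≡⟨ lemma (+ n) (+ b) ⟩
      ℤ.- (1ℤ ℤ.+ + b ℤ.* + n)     ≡⟨ cong (λ z → ℤ.- (1ℤ ℤ.+ z)) (sym (ℤ.pos-* b n)) ⟩
      ℤ.- (+ (1 ℕ.+ b ℕ.* n))      ≡⟨ cong (λ z → ℤ.- (+ z)) eq ⟩
      ℤ.- (+ (a ℕ.* p))            ≡⟨ cong ℤ.-_ (ℤ.pos-* a p) ⟩
      ℤ.- (+ a ℤ.* + p)            ≡⟨ ℤ.neg-distribˡ-* (+ a) (+ p) ⟩
      ℤ.- + a ℤ.* + p              ∎))
      where
      open ≡-Reasoning
      lemma : ∀ n b → n ℤ.* ℤ.- b ℤ.- 1ℤ ≡ ℤ.- (1ℤ ℤ.+ b ℤ.* n)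
      lemma = solve-∀
    ... | Bézout.-+ a b eq = + b , mod (divides (+ a) (begin
      + n ℤ.* + b ℤ.- 1ℤ           ≡⟨ cong (ℤ._- 1ℤ) (trans (ℤ.*-comm (+ n) (+ b)) (sym (ℤ.pos-* b n))) ⟩
      + (b ℕ.* n) ℤ.- 1ℤ           ≡⟨ cong (λ z → + z ℤ.- 1ℤ) (sym eq) ⟩
      + (1 ℕ.+ a ℕ.* p) ℤ.- 1ℤ     ≡⟨ lemma (+ (a ℕ.* p)) ⟩
      + (a ℕ.* p)                  ≡⟨ ℤ.pos-* a p ⟩
      + a ℤ.* + p                  ∎))
      where
      open ≡-Reasoning
      lemma : ∀ y → (1ℤ ℤ.+ y) ℤ.- 1ℤ ≡ y
      lemma = solve-∀
    u = proj₁ unit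

  -- Every factor of the product cancels against its inverse modulo p.
  product-paired : ∀ n (L : List ℕ) → length L ≤ n → Unique L →
    (∀ {x} → x ∈ L → x < p) →
    (∀ {x} → x ∈ L → ∃ λ y → y ∈ L × ¬ (y ≡ x) × (+ x ℤ.* + y ≡ 1ℤ [mod + p ])) →
    + product L ≡ 1ℤ [mod + p ]
  product-paired n [] _ _ _ _ = mod-refl
  product-paired (suc n) (x ∷ xs) (s≤s len) (x∉ ∷ uniq) small partner
    with partner (here refl)
  ... | y , here y≡x , y≢x , _ = contradiction y≡x y≢x
  ... | y , there y∈xs , y≢x , xy≡1 with ∈-∃++ y∈xs
  ... | as , bs , refl = mod-trans (mod-reflexive split) (mod-trans (mod-* xy≡1 rest) mod-refl)
    where
    ys = as ++ bs
    perm : as ++ [ y ] ++ bs ↭ y ∷ ys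
    perm = shift y as bs
    uniq′ : Unique (y ∷ ys)
    uniq′ = Permutation.Unique-resp-↭ (setoid ℕ) (↭⇒↭ₛ perm) uniq
    y∉ys : y ∉ ys
    y∉ys = Unique.Unique[x∷xs]⇒x∉xs uniq′
    uniq-ys : Unique ys
    uniq-ys with uniq′
    ... | _ ∷ u = u
    x∉xs : x ∉ as ++ [ y ] ++ bs
    x∉xs = Unique.Unique[x∷xs]⇒x∉xs (x∉ ∷ uniq)
    from-ys : ∀ {z} → z ∈ ys → z ∈ as ++ [ y ] ++ bs
    from-ys z∈ = ∈-resp-↭ (↭-sym perm) (there z∈)
    to-ys : ∀ {z} → z ∈ as ++ [ y ] ++ bs → ¬ (z ≡ y) → z ∈ ys
    to-ys z∈ z≢y with ∈-resp-↭ perm z∈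
    ... | here z≡y = contradiction z≡y z≢y
    ... | there q = q
    same : ∀ {a b c} → b < p → c < p → + a ℤ.* + b ≡ 1ℤ [mod + p ] → + a ℤ.* + c ≡ 1ℤ [mod + p ] → b ≡ c
    same {a} b< c< e f = <-mod-unique b< c< (inverse-unique {a = + a} e f)
    swap : ∀ {a b} → + a ℤ.* + b ≡ 1ℤ [mod + p ] → + b ℤ.* + a ≡ 1ℤ [mod + p ]
    swap {a} {b} e = mod-trans (mod-reflexive (ℤ.*-comm (+ b) (+ a))) e
    partner-ys : ∀ {z} → z ∈ ys → ∃ λ w → w ∈ ys × ¬ (w ≡ z) × (+ z ℤ.* + w ≡ 1ℤ [mod + p ])
    partner-ys {z} z∈ with partner (there (from-ys z∈))
    ... | w , here refl , w≢z , zw≡1 =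
      contradiction (subst (_∈ ys) (same {w} (small (there (from-ys z∈))) (small (there y∈xs)) (swap {z} {w} zw≡1) xy≡1) z∈) y∉ys
    ... | w , there w∈xs , w≢z , zw≡1 = w , to-ys w∈xs w≢y , w≢z , zw≡1
      where
      w≢y : ¬ (w ≡ y)
      w≢y refl = x∉xs (subst (_∈ as ++ [ w ] ++ bs)
        (same {w} (small (there (from-ys z∈))) (small (here refl)) (swap {z} {w} zw≡1) (swap {x} {w} xy≡1)) (from-ys z∈))
    rest : + product ys ≡ 1ℤ [mod + p ]
    rest = product-paired n ys
      (ℕ.≤-trans (ℕ.n≤1+n _) (subst (_≤ n) (↭-length perm) len))
      uniq-ys (λ z∈ → small (there (from-ys z∈))) partner-ys
    split : + product (x ∷ as ++ [ y ] ++ bs) ≡ (+ x ℤ.* + y) ℤ.* + product ys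
    split = begin
      + (x ℕ.* product (as ++ [ y ] ++ bs))  ≡⟨ cong (λ z → + (x ℕ.* z)) (product-↭ perm) ⟩
      + (x ℕ.* (y ℕ.* product ys))           ≡⟨ cong +_ (ℕ.*-assoc x y (product ys)) ⟨
      + (x ℕ.* y ℕ.* product ys)             ≡⟨ ℤ.pos-* (x ℕ.* y) (product ys) ⟩
      + (x ℕ.* y) ℤ.* + product ys           ≡⟨ cong (ℤ._* + product ys) (ℤ.pos-* x y) ⟩
      (+ x ℤ.* + y) ℤ.* + product ys         ∎
      where open ≡-Reasoning

  private
    parity : ∀ n → 2 ℕ.∣ n ⊎ (-1ℤ ℤ.^ n ≡ -1ℤ)
    parity zero          = inj₁ (2 ℕ.∣0)
    parity (suc zero)    = inj₂ refl
    parity (suc (suc n)) with parity n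
    ... | inj₁ d = inj₁ (ℕ.∣m∣n⇒∣m+n ℕ.∣-refl d)
    ... | inj₂ e = inj₂ (cong (λ z → -1ℤ ℤ.* (-1ℤ ℤ.* z)) e)

    sign-odd : ∀ q → p ≡ 3 ℕ.+ q → -1ℤ ℤ.^ p ≡ -1ℤ
    sign-odd q eq with parity p
    ... | inj₂ e = e
    ... | inj₁ 2∣p with prime⇒irreducible p-prime 2∣p
    ... | inj₁ ()
    ... | inj₂ 2≡p with trans 2≡p eq
    ... | ()

    middle : ∀ q → p ≡ 3 ℕ.+ q → + product (applyUpTo (λ i → 2 ℕ.+ i) q) ≡ 1ℤ [mod + p ]
    middle q eq = product-paired (length L) L ℕ.≤-refl
      (Unique.applyUpTo⁺₁ _ q (λ i<j _ e → ℕ.<⇒≢ i<j (ℕ.+-cancelˡ-≡ 2 _ _ e)))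
      small partner
      where
      L = applyUpTo (λ i → 2 ℕ.+ i) q
      small′ : ∀ {i} → i < q → 3 ℕ.+ i < p
      small′ {i} i<q = subst (λ z → 3 ℕ.+ i < z) (sym eq) (s≤s (s≤s (s≤s i<q)))
      small : ∀ {x} → x ∈ L → x < p
      small x∈ with ∈-applyUpTo⁻ (λ i → 2 ℕ.+ i) x∈
      ... | i , i<q , refl = ℕ.<-trans (ℕ.n<1+n _) (small′ i<q)
      -1-mod : + (2 ℕ.+ q) ≡ -1ℤ [mod + p ]
      -1-mod = mod (divides 1ℤ (trans (cong +_ (trans (ℕ.+-comm (2 ℕ.+ q) 1) (sym eq))) (sym (ℤ.*-identityˡ (+ p)))))
      partner : ∀ {x} → x ∈ L → ∃ λ y → y ∈ L × ¬ (y ≡ x) × (+ x ℤ.* + y ≡ 1ℤ [mod + p ])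
      partner {x} x∈ with ∈-applyUpTo⁻ (λ i → 2 ℕ.+ i) x∈
      ... | i , i<q , refl = y , y∈ y refl , y≢x , xy≡1
        where
        u = inverse-mod (+ x) (p∤small (s≤s z≤n) (small x∈))
        y = proj₁ u ℤ.%ℕ p
        xy≡1 : + x ℤ.* + y ≡ 1ℤ [mod + p ]
        xy≡1 = mod-trans (mod-* (mod-refl {a = + x}) (mod-sym (%ℕ-≡ (proj₁ u) p))) (proj₂ u)
        at : ∀ {y′} → y ≡ y′ → + x ℤ.* + y′ ≡ 1ℤ [mod + p ]
        at refl = xy≡1
        y≢x : ¬ (y ≡ x)
        y≢x e with euclid (+ suc i) (+ (3 ℕ.+ i)) (subst (+ p ∣_) (factor (+ i)) (difference (at e)))
          where
          factor : ∀ i → (+ 2 ℤ.+ i) ℤ.* (+ 2 ℤ.+ i) ℤ.- 1ℤ ≡ (1ℤ ℤ.+ i) ℤ.* (+ 3 ℤ.+ i)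
          factor = solve-∀
        ... | inj₁ d = p∤small (s≤s z≤n) (ℕ.<-trans (ℕ.n<1+n _) (small x∈)) d
        ... | inj₂ d = p∤small (s≤s z≤n) (small′ i<q) d
        y∈ : ∀ y′ → y ≡ y′ → y′ ∈ L
        y∈ zero e = contradiction
          (≡0⇒∣ (mod-trans (mod-sym (at e)) (mod-reflexive (ℤ.*-zeroʳ (+ x))))) p∤1
        y∈ (suc zero) e with <-mod-unique (small x∈) 2≤p (mod-trans (mod-reflexive (sym (ℤ.*-identityʳ (+ x)))) (at e))
        ... | ()
        y∈ (suc (suc j)) e with ℕ.<-cmp j q
        ... | tri< j<q _ _ = ∈-applyUpTo⁺ (λ i → 2 ℕ.+ i) j<q
        ... | tri≈ _ refl _ = contradiction
          (subst (+ p ∣_) (negate (+ i)) (∣.∣m⇒∣-m (difference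
            (mod-trans (mod-* (mod-refl {a = + x}) (mod-sym -1-mod)) (at e)))))
          (p∤small (s≤s z≤n) (small′ i<q))
          where
          negate : ∀ i → ℤ.- ((+ 2 ℤ.+ i) ℤ.* (ℤ.- 1ℤ) ℤ.- 1ℤ) ≡ + 3 ℤ.+ i
          negate = solve-∀
        ... | tri> _ _ q<j = contradiction (subst (_< p) e (n%ℕd<d (proj₁ u) p)) (ℕ.≤⇒≯ (subst (_≤ 2 ℕ.+ j) (sym eq) (s≤s (s≤s q<j))))

    primes-below : ∀ k → p ≡ suc k → filter (λ j → ¬? (p ℕ.∣? j)) (upTo p) ≡ applyUpTo suc k
    primes-below k eq = trans (cong (λ z → filter P? (upTo z)) eq)
      (trans (List.filter-reject P? (λ ¬d → ¬d (p ℕ.∣0)))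
        (List.filter-all P? (All.applyUpTo⁺₁ suc k
          (λ i<k d → p∤small (s≤s z≤n) (subst (_ <_) (sym eq) (s≤s i<k)) (∣ᵤ⇒∣ d)))))
      where P? = λ j → ¬? (p ℕ.∣? j)

  -- Wilson's theorem, in the form Γₚ(p) ≡ 1 (mod p).
  wilson : Γℕ p p ≡ 1ℤ [mod + p ]
  wilson with ℕ.m≤n⇒m<n∨m≡n 2≤p
  ... | inj₂ 2≡p = subst (λ m → Γℕ m m ≡ 1ℤ [mod + m ]) 2≡p mod-refl
  ... | inj₁ 3≤p = mod-trans (mod-reflexive split) (mod-trans (mod-* (mod-refl {a = -1ℤ ℤ.* + (2 ℕ.+ q)}) (middle q eq))
      (mod (divides (ℤ.- 1ℤ) (trans (finish (+ q)) (cong (λ z → ℤ.- 1ℤ ℤ.* (+ z)) (sym eq))))))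
    where
    q = p ℕ.∸ 3
    eq : p ≡ 3 ℕ.+ q
    eq = sym (ℕ.m+[n∸m]≡n 3≤p)
    L = applyUpTo (λ i → 2 ℕ.+ i) q
    finish : ∀ q → (ℤ.- 1ℤ ℤ.* (+ 2 ℤ.+ q)) ℤ.* 1ℤ ℤ.- 1ℤ ≡ ℤ.- 1ℤ ℤ.* (+ 3 ℤ.+ q)
    finish = solve-∀
    factors : product (applyUpTo suc (2 ℕ.+ q)) ≡ (2 ℕ.+ q) ℕ.* product L
    factors = begin
      1 ℕ.* product (applyUpTo (λ i → 2 ℕ.+ i) (suc q))  ≡⟨ ℕ.*-identityˡ _ ⟩
      product (applyUpTo (λ i → 2 ℕ.+ i) (suc q))        ≡⟨ cong product (List.applyUpTo-∷ʳ (λ i → 2 ℕ.+ i) q) ⟨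
      product (L ∷ʳ (2 ℕ.+ q))                           ≡⟨ product-++ L [ 2 ℕ.+ q ] ⟩
      product L ℕ.* ((2 ℕ.+ q) ℕ.* 1)                    ≡⟨ cong (λ z → product L ℕ.* z) (ℕ.*-identityʳ (2 ℕ.+ q)) ⟩
      product L ℕ.* (2 ℕ.+ q)                            ≡⟨ ℕ.*-comm (product L) (2 ℕ.+ q) ⟩
      (2 ℕ.+ q) ℕ.* product L                            ∎
      where open ≡-Reasoning
    split : Γℕ p p ≡ (-1ℤ ℤ.* + (2 ℕ.+ q)) ℤ.* + product L
    split = begin
      Γℕ p p                                       ≡⟨ cong₂ (λ s l → s ℤ.* + product l) (sign-odd q eq) (primes-below (2 ℕ.+ q) eq) ⟩
      -1ℤ ℤ.* + product (applyUpTo suc (2 ℕ.+ q))  ≡⟨ cong (λ z → -1ℤ ℤ.* + z) factors ⟩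
      -1ℤ ℤ.* + ((2 ℕ.+ q) ℕ.* product L)          ≡⟨ cong (λ z → -1ℤ ℤ.* z) (ℤ.pos-* (2 ℕ.+ q) (product L)) ⟩
      -1ℤ ℤ.* (+ (2 ℕ.+ q) ℤ.* + product L)        ≡⟨ ℤ.*-assoc -1ℤ (+ (2 ℕ.+ q)) (+ product L) ⟨
      (-1ℤ ℤ.* + (2 ℕ.+ q)) ℤ.* + product L        ∎
      where open ≡-Reasoning

  Γℕ-step-∣ : ∀ n → p ℕ.∣ n → Γℕ p (suc n) ≡ -1ℤ ℤ.* Γℕ p n
  Γℕ-step-∣ n d = trans (cong (λ l → -1ℤ ℤ.^ suc n ℤ.* + product l) same) (ℤ.*-assoc -1ℤ (-1ℤ ℤ.^ n) _)
    where
    P? = λ j → ¬? (p ℕ.∣? j)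
    same : filter P? (upTo (suc n)) ≡ filter P? (upTo n)
    same = trans (cong (filter P?) (sym (List.upTo-∷ʳ n)))
      (trans (List.filter-++ P? (upTo n) [ n ])
        (trans (cong (filter P? (upTo n) ++_) (List.filter-reject P? (λ ¬d → ¬d d))) (List.++-identityʳ _)))

  Γℕ-step-∤ : ∀ n → ¬ p ℕ.∣ n → Γℕ p (suc n) ≡ ℤ.- + n ℤ.* Γℕ p n
  Γℕ-step-∤ n ¬d = begin
    (-1ℤ ℤ.* -1ℤ ℤ.^ n) ℤ.* + product (filter P? (upTo (suc n)))
      ≡⟨ cong (λ l → (-1ℤ ℤ.* -1ℤ ℤ.^ n) ℤ.* + product l) more ⟩
    (-1ℤ ℤ.* -1ℤ ℤ.^ n) ℤ.* + product (l ∷ʳ n)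
      ≡⟨ cong (λ z → (-1ℤ ℤ.* -1ℤ ℤ.^ n) ℤ.* z)
           (trans (cong +_ (trans (product-++ l [ n ]) (cong (λ z → product l ℕ.* z) (ℕ.*-identityʳ n)))) (ℤ.pos-* (product l) n)) ⟩
    (-1ℤ ℤ.* -1ℤ ℤ.^ n) ℤ.* (+ product l ℤ.* + n)
      ≡⟨ shuffle (-1ℤ ℤ.^ n) (+ product l) (+ n) ⟩
    ℤ.- + n ℤ.* (-1ℤ ℤ.^ n ℤ.* + product l)
      ∎
    where
    open ≡-Reasoning
    P? = λ j → ¬? (p ℕ.∣? j)
    l = filter P? (upTo n)
    shuffle : ∀ s l n → (ℤ.- 1ℤ ℤ.* s) ℤ.* (l ℤ.* n) ≡ ℤ.- n ℤ.* (s ℤ.* l)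
    shuffle = solve-∀
    more : filter P? (upTo (suc n)) ≡ l ∷ʳ n
    more = trans (cong (filter P?) (sym (List.upTo-∷ʳ n)))
      (trans (List.filter-++ P? (upTo n) [ n ])
        (cong (l ++_) (List.filter-accept P? ¬d)))

  -- Multiplicativity over whole blocks of length divisible by p.
  Γℕ-+ : ∀ {L} → p ℕ.∣ L → ∀ a → Γℕ p (a ℕ.+ L) ≡ Γℕ p a ℤ.* Γℕ p L [mod + L ]
  Γℕ-+ {L} p∣L zero = mod-reflexive (sym (ℤ.*-identityˡ (Γℕ p L)))
  Γℕ-+ {L} p∣L (suc a) with p ℕ.∣? a
  ... | yes d = begin
    Γℕ p (suc (a ℕ.+ L))              ≡⟨ Γℕ-step-∣ (a ℕ.+ L) (ℕ.∣m∣n⇒∣m+n d p∣L) ⟩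
    -1ℤ ℤ.* Γℕ p (a ℕ.+ L)            ≈⟨ mod-* (mod-refl {a = -1ℤ}) (Γℕ-+ p∣L a) ⟩
    -1ℤ ℤ.* (Γℕ p a ℤ.* Γℕ p L)       ≡⟨ ℤ.*-assoc -1ℤ (Γℕ p a) (Γℕ p L) ⟨
    (-1ℤ ℤ.* Γℕ p a) ℤ.* Γℕ p L       ≡⟨ cong (ℤ._* Γℕ p L) (Γℕ-step-∣ a d) ⟨
    Γℕ p (suc a) ℤ.* Γℕ p L           ∎
    where open ≈-Reasoning modSetoid
  ... | no ¬d = begin
    Γℕ p (suc (a ℕ.+ L))                ≡⟨ Γℕ-step-∤ (a ℕ.+ L) (λ d → ¬d (ℕ.∣m+n∣m⇒∣n (subst (p ℕ.∣_) (ℕ.+-comm a L) d) p∣L)) ⟩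
    ℤ.- + (a ℕ.+ L) ℤ.* Γℕ p (a ℕ.+ L)  ≈⟨ mod-* (mod-neg shift-L) (Γℕ-+ p∣L a) ⟩
    ℤ.- + a ℤ.* (Γℕ p a ℤ.* Γℕ p L)     ≡⟨ ℤ.*-assoc (ℤ.- + a) (Γℕ p a) (Γℕ p L) ⟨
    (ℤ.- + a ℤ.* Γℕ p a) ℤ.* Γℕ p L     ≡⟨ cong (ℤ._* Γℕ p L) (Γℕ-step-∤ a ¬d) ⟨
    Γℕ p (suc a) ℤ.* Γℕ p L             ∎
    where
    open ≈-Reasoning modSetoid
    shift-L : + (a ℕ.+ L) ≡ + a [mod + L ]
    shift-L = mod (divides 1ℤ (cancel (+ a) (+ L)))
      where
      cancel : ∀ a L → (a ℤ.+ L) ℤ.- a ≡ 1ℤ ℤ.* L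
      cancel = solve-∀

  Γℕ-blocks : ∀ {L} → p ℕ.∣ L → ∀ a k → Γℕ p (a ℕ.+ k ℕ.* L) ≡ Γℕ p a ℤ.* Γℕ p L ℤ.^ k [mod + L ]
  Γℕ-blocks {L} p∣L a zero = mod-reflexive
    (trans (cong (Γℕ p) (ℕ.+-identityʳ a)) (sym (ℤ.*-identityʳ (Γℕ p a))))
  Γℕ-blocks {L} p∣L a (suc k) = begin
    Γℕ p (a ℕ.+ (L ℕ.+ k ℕ.* L))                   ≡⟨ cong (Γℕ p) (trans (cong (λ z → a ℕ.+ z) (ℕ.+-comm L (k ℕ.* L))) (sym (ℕ.+-assoc a (k ℕ.* L) L))) ⟩
    Γℕ p (a ℕ.+ k ℕ.* L ℕ.+ L)                     ≈⟨ Γℕ-+ p∣L (a ℕ.+ k ℕ.* L) ⟩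
    Γℕ p (a ℕ.+ k ℕ.* L) ℤ.* Γℕ p L                ≈⟨ mod-* (Γℕ-blocks p∣L a k) (mod-refl {a = Γℕ p L}) ⟩
    (Γℕ p a ℤ.* Γℕ p L ℤ.^ k) ℤ.* Γℕ p L           ≡⟨ reorder (Γℕ p a) (Γℕ p L ℤ.^ k) (Γℕ p L) ⟩
    Γℕ p a ℤ.* (Γℕ p L ℤ.* Γℕ p L ℤ.^ k)           ∎
    where
    open ≈-Reasoning modSetoid
    reorder : ∀ a x l → (a ℤ.* x) ℤ.* l ≡ a ℤ.* (l ℤ.* x)
    reorder = solve-∀

  lift-≡1 : ∀ {n x} → x ≡ 1ℤ [mod + (p ℕ.^ suc n) ] → x ℤ.^ p ≡ 1ℤ [mod + (p ℕ.^ suc (suc n)) ]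
  lift-≡1 {n} {x} e@(mod (divides c eq)) = mod-sym (mod (divides (ℤ.- (g ℤ.* c)) (begin
    1ℤ ℤ.- x ℤ.^ p                             ≡⟨ geometric-sum x p ⟨
    (1ℤ ℤ.- x) ℤ.* geometric x p               ≡⟨ negate x (geometric x p) ⟩
    ℤ.- ((x ℤ.- 1ℤ) ℤ.* geometric x p)         ≡⟨ cong₂ (λ y z → ℤ.- (y ℤ.* z)) eq p∣geometric ⟩
    ℤ.- ((c ℤ.* P) ℤ.* (g ℤ.* + p))            ≡⟨ reorder c P g (+ p) ⟩
    ℤ.- (g ℤ.* c) ℤ.* (+ p ℤ.* P)              ≡⟨ cong (λ z → ℤ.- (g ℤ.* c) ℤ.* z) (ℤ.pos-* p (p ℕ.^ suc n)) ⟨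
    ℤ.- (g ℤ.* c) ℤ.* + (p ℕ.^ suc (suc n))    ∎)))
    where
    open ≡-Reasoning
    P = + (p ℕ.^ suc n)
    p∣p^ : + p ∣ P
    p∣p^ = ∣ᵤ⇒∣ (ℕ.m∣m*n (p ℕ.^ n))
    p∣g : + p ∣ geometric x p
    p∣g = ∣-resp (mod-sym (geometric-≡1 p (weaken p∣p^ e))) ∣.∣-refl
    g = ∣.quotient p∣g
    p∣geometric : geometric x p ≡ g ℤ.* + p
    p∣geometric with divides _ e′ ← p∣g = e′
    negate : ∀ x g → (1ℤ ℤ.- x) ℤ.* g ≡ ℤ.- ((x ℤ.- 1ℤ) ℤ.* g)
    negate = solve-∀
    reorder : ∀ c P g p → ℤ.- ((c ℤ.* P) ℤ.* (g ℤ.* p)) ≡ ℤ.- (g ℤ.* c) ℤ.* (p ℤ.* P)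
    reorder = solve-∀

  Γℕ-period : ∀ n → Γℕ p (p ℕ.^ suc n) ≡ 1ℤ [mod + (p ℕ.^ n) ]
  Γℕ-period zero          = any-mod-1
  Γℕ-period (suc n) = mod-trans power (unit n)
    where
    L = p ℕ.^ suc n
    p∣L : p ℕ.∣ L
    p∣L = ℕ.m∣m*n (p ℕ.^ n)
    power : Γℕ p (p ℕ.* L) ≡ Γℕ p L ℤ.^ p [mod + L ]
    power = mod-trans (Γℕ-blocks p∣L 0 p) (mod-reflexive (ℤ.*-identityˡ (Γℕ p L ℤ.^ p)))
    unit : ∀ n → Γℕ p (p ℕ.^ suc n) ℤ.^ p ≡ 1ℤ [mod + (p ℕ.^ suc n) ]
    unit zero = subst (λ z → Γℕ p z ℤ.^ p ≡ 1ℤ [mod + z ]) (sym (ℕ.^-identityʳ p))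
      (mod-trans (mod-^ p wilson) (mod-reflexive (ℤ.^-zeroˡ p)))
    unit (suc n) = lift-≡1 {n} (Γℕ-period (suc n))

  -- The factor p lost here is needed only for p = 2.
  Γℕ-cong : ∀ n a b → + a ≡ + b [mod + (p ℕ.^ suc n) ] → Γℕ p a ≡ Γℕ p b [mod + (p ℕ.^ n) ]
  Γℕ-cong n a b e = [ (λ b≤a → go b≤a e) , (λ a≤b → mod-sym (go a≤b (mod-sym e))) ]′ (ℕ.≤-total b a)
    where
    L = p ℕ.^ suc n
    go : ∀ {a b} → b ≤ a → + a ≡ + b [mod + L ] → Γℕ p a ≡ Γℕ p b [mod + (p ℕ.^ n) ]
    go {a} {b} b≤a e with ℕ≡⇒∣ b≤a e
    ... | k , refl = begin
      Γℕ p (b ℕ.+ k ℕ.* L)              ≈⟨ weaken (∣ᵤ⇒∣ (ℕ.n∣m*n p)) (Γℕ-blocks (ℕ.m∣m*n (p ℕ.^ n)) b k) ⟩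
      Γℕ p b ℤ.* Γℕ p L ℤ.^ k           ≈⟨ mod-* (mod-refl {a = Γℕ p b}) (mod-^ k (Γℕ-period n)) ⟩
      Γℕ p b ℤ.* 1ℤ ℤ.^ k               ≡⟨ cong (λ z → Γℕ p b ℤ.* z) (ℤ.^-zeroˡ k) ⟩
      Γℕ p b ℤ.* 1ℤ                     ≡⟨ ℤ.*-identityʳ (Γℕ p b) ⟩
      Γℕ p b                            ∎
      where open ≈-Reasoning modSetoid

module Padic (p : ℕ) (p-prime : Prime p) where

  open PrimeModulus p-prime

  private instance
    p≢0 : NonZero p
    p≢0 = prime⇒nonZero p-prime

  -- The inverse limit of the ℤ/pⁿ; only the class of residue n modulo pⁿ matters.
  record ℤₚ : Set where
    field
      residue  : ℕ → ℤ
      coherent : ∀ n → residue (suc n) ≡ residue n [mod + (p ℕ.^ n) ]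
  open ℤₚ public

  record _≈ₚ_ (x y : ℤₚ) : Set where
    constructor equal
    field residues : ∀ n → residue x n ≡ residue y n [mod + (p ℕ.^ n) ]
  open _≈ₚ_ public

  fromℤ : ℤ → ℤₚ
  fromℤ a .residue  _ = a
  fromℤ a .coherent _ = mod-refl

  fromℕ : ℕ → ℤₚ
  fromℕ n = fromℤ (+ n)

  private
    p^n∣p^1+n : ∀ n → + (p ℕ.^ n) ∣ + (p ℕ.^ suc n)
    p^n∣p^1+n n = ∣ᵤ⇒∣ (ℕ.n∣m*n p)

    add multiply : ℤₚ → ℤₚ → ℤₚ
    add x y .residue  n = residue x n ℤ.+ residue y n
    add x y .coherent n = mod-+ (coherent x n) (coherent y n)
    multiply x y .residue  n = residue x n ℤ.* residue y n
    multiply x y .coherent n = mod-* (coherent x n) (coherent y n)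

    negate : ℤₚ → ℤₚ
    negate x .residue  n = ℤ.- residue x n
    negate x .coherent n = mod-neg (coherent x n)

    pointwise : ∀ {x y} → (∀ n → residue x n ≡ residue y n) → x ≈ₚ y
    pointwise e = equal λ n → mod-reflexive (e n)

  ℤₚ-commutativeRing : CommutativeRing 0ℓ 0ℓ
  ℤₚ-commutativeRing = record
    { Carrier = ℤₚ
    ; _≈_ = _≈ₚ_
    ; _+_ = add
    ; _*_ = multiply
    ; -_ = negate
    ; 0# = fromℤ 0ℤ
    ; 1# = fromℤ 1ℤ
    ; isCommutativeRing = record
      { isRing = record
        { +-isAbelianGroup = record
          { isGroup = record
            { isMonoid = record
              { isSemigroup = record
                { isMagma = record
                  { isEquivalence = record
                    { refl = equal λ n → mod-refl
                    ; sym = λ e → equal λ n → mod-sym (residues e n)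
                    ; trans = λ e f → equal λ n → mod-trans (residues e n) (residues f n)
                    }
                  ; ∙-cong = λ e f → equal λ n → mod-+ (residues e n) (residues f n)
                  }
                ; assoc = λ x y z → pointwise λ n → ℤ.+-assoc (residue x n) (residue y n) (residue z n)
                }
              ; identity = (λ x → pointwise λ n → ℤ.+-identityˡ (residue x n))
                         , (λ x → pointwise λ n → ℤ.+-identityʳ (residue x n))
              }
            ; inverse = (λ x → pointwise λ n → ℤ.+-inverseˡ (residue x n))
                      , (λ x → pointwise λ n → ℤ.+-inverseʳ (residue x n))
            ; ⁻¹-cong = λ e → equal λ n → mod-neg (residues e n)
            }
          ; comm = λ x y → pointwise λ n → ℤ.+-comm (residue x n) (residue y n)
          }
        ; *-cong = λ e f → equal λ n → mod-* (residues e n) (residues f n)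
        ; *-assoc = λ x y z → pointwise λ n → ℤ.*-assoc (residue x n) (residue y n) (residue z n)
        ; *-identity = (λ x → pointwise λ n → ℤ.*-identityˡ (residue x n))
                     , (λ x → pointwise λ n → ℤ.*-identityʳ (residue x n))
        ; distrib = (λ x y z → pointwise λ n → ℤ.*-distribˡ-+ (residue x n) (residue y n) (residue z n))
                  , (λ x y z → pointwise λ n → ℤ.*-distribʳ-+ (residue x n) (residue y n) (residue z n))
        }
      ; *-comm = λ x y → pointwise λ n → ℤ.*-comm (residue x n) (residue y n)
      }
    }

  open CommutativeRing ℤₚ-commutativeRing public
    using (_≈_; _+_; _*_; -_; _-_; 0#; 1#)
  open Exp (CommutativeRing.semiring ℤₚ-commutativeRing) public using (_^_)
  open Sum (CommutativeRing.semiring ℤₚ-commutativeRing) public using (sum)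

  residue-mod-p : ∀ x n → residue x (suc n) ≡ residue x 1 [mod + p ]
  residue-mod-p x zero    = mod-refl
  residue-mod-p x (suc n) =
    mod-trans (weaken (∣ᵤ⇒∣ (ℕ.m∣m*n (p ℕ.^ n))) (coherent x (suc n))) (residue-mod-p x n)

  -- u inverts x modulo p, so x⁻¹ = u Σᵢ (1 - x u)ⁱ.
  module UnitInverse (x : ℤₚ) (u : ℤ) (xu≡1 : residue x 1 ℤ.* u ≡ 1ℤ [mod + p ]) where

    approximation : ℕ → ℤ
    approximation n = u ℤ.* geometric (1ℤ ℤ.- residue x n ℤ.* u) n

    approximation-inverse : ∀ n → residue x n ℤ.* approximation n ≡ 1ℤ [mod + (p ℕ.^ n) ]
    approximation-inverse zero = any-mod-1
    approximation-inverse n@(suc k) = mod-sym (mod (subst (+ (p ℕ.^ n) ∣_) remainder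
      (subst (_∣ t ℤ.^ n) (sym (pos-^ p n)) (∣-^ n p∣t))))
      where
      a = residue x n
      t = 1ℤ ℤ.- a ℤ.* u
      p∣t : + p ∣ t
      p∣t = difference (mod-sym (mod-trans (mod-* (residue-mod-p x k) (mod-refl {a = u})) xu≡1))
      expand : ∀ a u g → (1ℤ ℤ.- (1ℤ ℤ.- a ℤ.* u)) ℤ.* g ≡ a ℤ.* (u ℤ.* g)
      expand = solve-∀
      twice : ∀ y → y ≡ 1ℤ ℤ.- (1ℤ ℤ.- y)
      twice = solve-∀
      remainder : t ℤ.^ n ≡ 1ℤ ℤ.- a ℤ.* approximation n
      remainder = trans (twice (t ℤ.^ n)) (cong (λ z → 1ℤ ℤ.- z)
        (trans (sym (geometric-sum t n)) (expand a u (geometric t n))))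

    inverse : ℤₚ
    inverse .residue    = approximation
    inverse .coherent n = inverse-unique {a = residue x (suc n)}
      (weaken (p^n∣p^1+n n) (approximation-inverse (suc n)))
      (mod-trans (mod-* (coherent x n) (mod-refl {a = approximation n})) (approximation-inverse n))

  infix  8 _⁻¹
  infixl 7 _/_

  -- The inverse of a unit (see ⁻¹-inverse); non-units are sent to 0.
  _⁻¹ : ℤₚ → ℤₚ
  x ⁻¹ with + p ∣? residue x 1
  ... | yes _  = 0#
  ... | no p∤x = let u , xu≡1 = inverse-mod (residue x 1) p∤x in UnitInverse.inverse x u xu≡1

  ⁻¹-inverse : ∀ x → ¬ + p ∣ residue x 1 → x * x ⁻¹ ≈ 1#
  ⁻¹-inverse x p∤x with + p ∣? residue x 1
  ... | yes p∣x = contradiction p∣x p∤x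
  ... | no p∤x′ = let u , xu≡1 = inverse-mod (residue x 1) p∤x′ in
    equal (UnitInverse.approximation-inverse x u xu≡1)

  _/_ : ℤₚ → ℤₚ → ℤₚ
  x / y = x * y ⁻¹

  infix 4 _≡_[modp^_]

  _≡_[modp^_] : ℤₚ → ℤₚ → ℕ → Set
  x ≡ y [modp^ n ] = ∃ λ z → x - y ≈ fromℕ (p ℕ.^ n) * z

  ∑ : ℕ → (ℕ → ℤₚ) → ℤₚ
  ∑ n f = sum {n} (λ k → f (toℕ k))

  infix 5 ∑
  syntax ∑ n (λ k → t) = ∑[ k < n ] t

  pochhammer : ℤₚ → ℕ → ℤₚ
  pochhammer a zero    = 1#
  pochhammer a (suc k) = pochhammer a k * (a + fromℕ k)

  representative : ℤₚ → ℕ → ℕ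
  representative x n = ℤ._%ℕ_ (residue x n) (p ℕ.^ n) {{ℕ.m^n≢0 p n}}

  representative-≡ : ∀ x n → residue x n ≡ + representative x n [mod + (p ℕ.^ n) ]
  representative-≡ x n = %ℕ-≡ (residue x n) (p ℕ.^ n) {{ℕ.m^n≢0 p n}}

  -- The extension of Γℕ p by continuity: the limit of its values at natural
  -- numbers converging to x.
  Γₚ : ℤₚ → ℤₚ
  Γₚ x .residue  n = Γℕ p (representative x (suc n))
  Γₚ x .coherent n = Γℕ-cong n _ _
    (mod-trans (weaken (p^n∣p^1+n (suc n)) (mod-sym (representative-≡ x (suc (suc n)))))
      (mod-trans (coherent x (suc n)) (representative-≡ x (suc n))))

  Γₚ-fromℕ : ∀ n → Γₚ (fromℕ n) ≈ fromℤ (Γℕ p n)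
  Γₚ-fromℕ a = equal λ n → Γℕ-cong n _ _ (mod-sym (representative-≡ (fromℕ a) (suc n)))

  Γₚ-continuous : ∀ {x y} n → residue x (suc n) ≡ residue y (suc n) [mod + (p ℕ.^ suc n) ] →
    residue (Γₚ x) n ≡ residue (Γₚ y) n [mod + (p ℕ.^ n) ]
  Γₚ-continuous {x} {y} n e = Γℕ-cong n _ _
    (mod-trans (mod-sym (representative-≡ x (suc n)))
      (mod-trans e (representative-≡ y (suc n))))

{-# OPTIONS --safe #-}

-- Put a = r/3, x = 2p/3 and n = (2p - r)/3, so that a - x = -n, and let ζ be a
-- primitive fifth root of unity.  Since ∏ᵢ (y - ζⁱ x) = y⁵ - x⁵, replacing five of
-- the six parameters a by a - ζⁱ x (and the five matching 1 by 1 + ζⁱ x) does not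
-- change the sum modulo p⁵, but it makes it terminate at k = n.  The resulting
-- very-well-poised ₇F₆ equals (a)₂ₙ₊₁ times a balanced ₄F₃ that contains
-- (r - 1)ₖ and hence stops at k = 1 - r.  There (a)₂ₙ₊₁ contributes one factor
-- 2p/3, and three further rising factorials contribute factors
-- (p/3) (1 + 2ζ⁴ + 2ζⁱ), i = 1, 2, 3, whose product is -5 p³/27.  This accounts
-- for p⁴, so everything else only matters modulo p, where the parameters become
-- integers and the values of Γₚ become factorials by Wilson's theorem.

module Submission where

open import Defs
open import Algebra.Bundles using (CommutativeRing)
import Algebra.Properties.Semiring.Exp as Exp
import Algebra.Solver.Ring as RingSolver
open import Algebra.Solver.Ring.AlmostCommutativeRing using (_-Raw-AlmostCommutative⟶_; fromCommutativeRing)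
open import Data.Integer as ℤ using (ℤ; +_; 0ℤ; 1ℤ; -1ℤ)
open import Data.Integer.Coprimality using (Coprime)
open import Data.Integer.Divisibility using (_∣_)
open import Data.Integer.Divisibility.Signed as ∣ using (divides; ∣ᵤ⇒∣)
import Data.Integer.Properties as ℤ
import Data.Integer.Tactic.RingSolver as ℤ-Solver
open import Data.Maybe.Base using (Maybe; just; nothing)
open import Data.Nat as ℕ using (ℕ; zero; suc; _!; _∸_; _≤_; _<_; s≤s; z≤n; NonZero)
import Data.Nat.Divisibility as ℕ
open import Data.Nat.Primality using (Prime; prime?; prime⇒irreducible; prime⇒nonZero; ¬prime[1])
import Data.Nat.Properties as ℕ
import Data.Nat.Tactic.RingSolver as ℕ-Solver
open import Data.Product using (∃; _×_; _,_; proj₁; proj₂)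
open import Data.Sum using (_⊎_; inj₁; inj₂; [_,_]′)
open import Level using (0ℓ)
import Relation.Binary.Reasoning.Setoid as ≈-Reasoning
open import Relation.Binary.PropositionalEquality as ≡ using (_≡_)
open import Relation.Nullary using (¬_; yes; no; contradiction)
open import Relation.Nullary.Decidable using (from-yes)

-- Modulo `p⁵` a perturbation by `x = 2p/3` is invisible only if it first enters in degree five,
-- which is why fifth roots of unity are used. Two obstacles shape the proof. First, `ζ` need not
-- exist modulo `p⁵`, and the usual denominators of hypergeometric identities need not be units. So
-- the identities are proved without any division in an arbitrary commutative ring: terms are
-- multiplied through by their denominators, and binomial coefficients are generated by Pascal's
-- rule. They are then applied in `(ℤ/p⁵)[σ][ζ]`, built formally by two quadratic extensions. It is
-- free over `ℤ/p⁵`, and both ends of the chain of equalities are integers, so comparing coordinates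
-- brings the result back to `ℤ/p⁵`. Second, `p⁴` cannot be cancelled where `p⁵ = 0`. Its cofactor
-- is instead read in the quotient by the annihilator of `p⁴`, a ring in which `p = 0`, and all
-- `ζⁱ x` disappear there.

-- Rising factorials and binomial sums in an arbitrary commutative ring.

module Expressions {c} {A : Set c} (_+_ _*_ : A → A → A) (-_ : A → A) (0# 1# : A) (ι : ℤ → A) where

  ν : ℕ → A
  ν n = ι (+ n)

  poch : A → ℕ → A
  poch x zero    = 1#
  poch x (suc k) = poch x k * (x + ν k)

  sign : ℕ → A
  sign zero    = 1#
  sign (suc k) = - sign k

  -- Σ (n choose k) f k l over k + l = n, unfolded by Pascal's rule.
  binomialSum : ℕ → (ℕ → ℕ → A) → A
  binomialSum zero    f = f 0 0
  binomialSum (suc n) f = binomialSum n (λ k l → f k (suc l)) + binomialSum n (λ k l → f (suc k) l)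

  antidiagonalSum : ℕ → (ℕ → ℕ → A) → A
  antidiagonalSum zero    f = f 0 0
  antidiagonalSum (suc n) f = f 0 (suc n) + antidiagonalSum n (λ k l → f (suc k) l)

  rangeSum : ℕ → (ℕ → A) → A
  rangeSum zero    f = 0#
  rangeSum (suc n) f = f 0 + rangeSum n (λ k → f (suc k))

-- Unreduced integers: the same expression can then be read modulo `p`, modulo `p⁵` and in the
-- cyclotomic extension.
module Z = Expressions ℤ._+_ ℤ._*_ ℤ.-_ ℤ.0ℤ ℤ.1ℤ (λ i → i)

module ℤ-Algebra {c ℓ} (R : CommutativeRing c ℓ)
  (hom : ℤ.+-*-rawRing -Raw-AlmostCommutative⟶ fromCommutativeRing R) where

  open CommutativeRing R public
  open _-Raw-AlmostCommutative⟶_ hom public renaming (⟦_⟧ to ι)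
  open Expressions _+_ _*_ -_ 0# 1# ι public
  open ≈-Reasoning setoid public

  private
    decide : ∀ x y → Maybe (ι x ≈ ι y)
    decide x y with x ℤ.≟ y
    ... | yes ≡.refl = just refl
    ... | no _       = nothing

  open RingSolver ℤ.+-*-rawRing (fromCommutativeRing R) hom decide public
    using (solve; _:+_; _:*_; _:-_; :-_; _:^_; _:=_; con)

  ν-suc : ∀ k → ν (suc k) ≈ 1# + ν k
  ν-suc k = trans (+-homo (+ 1) (+ k)) (+-congʳ 1-homo)

  ν-+ : ∀ k l → ν (k ℕ.+ l) ≈ ν k + ν l
  ν-+ k l = +-homo (+ k) (+ l)

  poch-cong : ∀ {x y} k → x ≈ y → poch x k ≈ poch y k
  poch-cong zero    e = refl
  poch-cong (suc k) e = *-cong (poch-cong k e) (+-congʳ e)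

  poch-≡ : ∀ {x y k l} → x ≈ y → k ≡ l → poch x k ≈ poch y l
  poch-≡ {k = k} e ≡.refl = poch-cong k e

  poch-+ : ∀ {x y} m n → y ≈ x + ν m → poch x (m ℕ.+ n) ≈ poch x m * poch y n
  poch-+ {x} {y} m zero e = trans (reflexive (≡.cong (poch x) (ℕ.+-identityʳ m))) (sym (*-identityʳ _))
  poch-+ {x} {y} m (suc n) e = begin
    poch x (m ℕ.+ suc n)                      ≈⟨ reflexive (≡.cong (poch x) (ℕ.+-suc m n)) ⟩
    poch x (m ℕ.+ n) * (x + ν (m ℕ.+ n))      ≈⟨ *-cong (poch-+ m n e) (+-congˡ (ν-+ m n)) ⟩
    poch x m * poch y n * (x + (ν m + ν n))   ≈⟨ *-congˡ (trans (sym (+-assoc x _ _)) (+-congʳ (sym e))) ⟩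
    poch x m * poch y n * (y + ν n)           ≈⟨ *-assoc _ _ _ ⟩
    poch x m * (poch y n * (y + ν n))         ∎

  poch-suc : ∀ {x y} n → y ≈ x + 1# → poch x (suc n) ≈ x * poch y n
  poch-suc {x} {y} n e = trans (poch-+ 1 n (trans e (+-congˡ (sym 1-homo))))
    (*-congʳ (trans (*-identityˡ _) (trans (+-congˡ 0-homo) (+-identityʳ x))))

  binomialSum-cong : ∀ n {f g} → (∀ k l → k ℕ.+ l ≡ n → f k l ≈ g k l) →
    binomialSum n f ≈ binomialSum n g
  binomialSum-cong zero    e = e 0 0 ≡.refl
  binomialSum-cong (suc n) e = +-cong
    (binomialSum-cong n λ k l k+l≡n → e k (suc l) (≡.trans (ℕ.+-suc k l) (≡.cong suc k+l≡n)))
    (binomialSum-cong n λ k l k+l≡n → e (suc k) l (≡.cong suc k+l≡n))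

  private
    interchange : ∀ a b c d → (a + b) + (c + d) ≈ (a + c) + (b + d)
    interchange = solve 4 (λ a b c d → (a :+ b) :+ (c :+ d) := (a :+ c) :+ (b :+ d)) refl

  binomialSum-+ : ∀ n f g → binomialSum n (λ k l → f k l + g k l) ≈ binomialSum n f + binomialSum n g
  binomialSum-+ zero    f g = refl
  binomialSum-+ (suc n) f g =
    trans (+-cong (binomialSum-+ n _ _) (binomialSum-+ n _ _)) (interchange _ _ _ _)

  binomialSum-*ˡ : ∀ n x f → binomialSum n (λ k l → x * f k l) ≈ x * binomialSum n f
  binomialSum-*ˡ zero    x f = refl
  binomialSum-*ˡ (suc n) x f =
    trans (+-cong (binomialSum-*ˡ n x _) (binomialSum-*ˡ n x _)) (sym (distribˡ x _ _))

  binomialSum-zero : ∀ n → binomialSum n (λ _ _ → 0#) ≈ 0#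
  binomialSum-zero zero    = refl
  binomialSum-zero (suc n) = trans (+-cong (binomialSum-zero n) (binomialSum-zero n)) (+-identityˡ 0#)

  binomialSum-flip : ∀ n f → binomialSum n f ≈ binomialSum n (λ k l → f l k)
  binomialSum-flip zero    f = refl
  binomialSum-flip (suc n) f =
    trans (+-cong (binomialSum-flip n _) (binomialSum-flip n _)) (+-comm _ _)

  binomialSum-first : ∀ n f → (∀ k l → f (suc k) l ≈ 0#) → binomialSum n f ≈ f 0 n
  binomialSum-first zero    f e = refl
  binomialSum-first (suc n) f e = trans (+-cong
    (binomialSum-first n (λ k l → f k (suc l)) (λ k l → e k (suc l)))
    (trans (binomialSum-cong n (λ k l _ → e k l)) (binomialSum-zero n))) (+-identityʳ _)

  -- Both sides are the sum over `k + i + m = n` with trinomial coefficients, bracketed in two ways.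
  binomialSum-assoc : ∀ n (f : ℕ → ℕ → ℕ → Carrier) →
    binomialSum n (λ k l → binomialSum l (λ i m → f k i m)) ≈
    binomialSum n (λ j m → binomialSum j (λ k i → f k i m))
  binomialSum-assoc zero    f = refl
  binomialSum-assoc (suc n) f = begin
    binomialSum n (λ k l → binomialSum l (λ i m → f k i (suc m)) + binomialSum l (λ i m → f k (suc i) m))
      + binomialSum n (λ k l → binomialSum l (λ i m → f (suc k) i m))
      ≈⟨ +-cong (trans (binomialSum-+ n _ _) (+-cong (binomialSum-assoc n _) (binomialSum-assoc n _))) (binomialSum-assoc n _) ⟩
    (binomialSum n (λ j m → binomialSum j (λ k i → f k i (suc m))) + binomialSum n (λ j m → binomialSum j (λ k i → f k (suc i) m)))
      + binomialSum n (λ j m → binomialSum j (λ k i → f (suc k) i m))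
      ≈⟨ +-assoc _ _ _ ⟩
    binomialSum n (λ j m → binomialSum j (λ k i → f k i (suc m))) + (binomialSum n (λ j m → binomialSum j (λ k i → f k (suc i) m))
      + binomialSum n (λ j m → binomialSum j (λ k i → f (suc k) i m)))
      ≈⟨ +-congˡ (binomialSum-+ n _ _) ⟨
    binomialSum n (λ j m → binomialSum j (λ k i → f k i (suc m))) + binomialSum n (λ j m → binomialSum j (λ k i → f k (suc i) m) + binomialSum j (λ k i → f (suc k) i m)) ∎

  binomialSum-exchange : ∀ n (f : ℕ → ℕ → ℕ → Carrier) →
    binomialSum n (λ k l → binomialSum l (λ i m → f k i m)) ≈
    binomialSum n (λ i l → binomialSum l (λ k m → f k i m))
  binomialSum-exchange n f = begin
    binomialSum n (λ k l → binomialSum l (λ i m → f k i m))  ≈⟨ binomialSum-assoc n f ⟩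
    binomialSum n (λ j m → binomialSum j (λ k i → f k i m))  ≈⟨ binomialSum-cong n (λ j m _ → binomialSum-flip j _) ⟩
    binomialSum n (λ j m → binomialSum j (λ i k → f k i m))  ≈⟨ binomialSum-assoc n (λ i k m → f k i m) ⟨
    binomialSum n (λ i l → binomialSum l (λ k m → f k i m))  ∎

  -- Absorption: `k` times `n + 1` choose `k` is `n + 1` times `n` choose `k - 1`.
  binomialSum-weight : ∀ n (f : ℕ → ℕ → Carrier) →
    binomialSum (suc n) (λ k l → ν k * f k l) ≈ ν (suc n) * binomialSum n (λ k l → f (suc k) l)
  binomialSum-weight zero f =
    trans (+-congʳ (trans (*-congʳ 0-homo) (zeroˡ _))) (+-identityˡ _)
  binomialSum-weight (suc n) f = begin
    binomialSum (suc n) (λ k l → ν k * f k (suc l)) + binomialSum (suc n) (λ k l → ν (suc k) * f (suc k) l)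
      ≈⟨ +-cong (binomialSum-weight n (λ k l → f k (suc l))) (trans (binomialSum-cong (suc n) {g = λ k l → f (suc k) l + ν k * f (suc k) l} (λ k l _ → trans (*-congʳ (ν-suc k)) (expand (ν k) (f (suc k) l))))
           (trans (binomialSum-+ (suc n) (λ k l → f (suc k) l) (λ k l → ν k * f (suc k) l)) (+-congˡ (binomialSum-weight n (λ k l → f (suc k) l))))) ⟩
    ν (suc n) * x + (binomialSum (suc n) (λ k l → f (suc k) l) + ν (suc n) * y)
      ≈⟨ collect (ν (suc n)) x y ⟩
    (1# + ν (suc n)) * (x + y)
      ≈⟨ *-congʳ (ν-suc (suc n)) ⟨
    ν (suc (suc n)) * (x + y) ∎
    where
    x = binomialSum n (λ k l → f (suc k) (suc l))
    y = binomialSum n (λ k l → f (suc (suc k)) l)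
    expand : ∀ k f → (1# + k) * f ≈ f + k * f
    expand k f = trans (distribʳ f 1# k) (+-congʳ (*-identityˡ f))
    collect : ∀ n x y → n * x + ((x + y) + n * y) ≈ (1# + n) * (x + y)
    collect n x y = trans (solve 3 (λ n x y → n :* x :+ ((x :+ y) :+ n :* y) := (x :+ y) :+ n :* (x :+ y)) refl n x y)
      (sym (expand n (x + y)))

  -- The two halves of Pascal's rule contribute the new factors `b + l` and `a + k`, and their sum
  -- `a + b + n` is constant along `k + l = n`.
  vandermonde : ∀ a b n → binomialSum n (λ k l → poch a k * poch b l) ≈ poch (a + b) n
  vandermonde a b zero    = *-identityˡ 1#
  vandermonde a b (suc n) = begin
    binomialSum n (λ k l → poch a k * (poch b l * (b + ν l))) + binomialSum n (λ k l → poch a k * (a + ν k) * poch b l)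
      ≈⟨ binomialSum-+ n _ _ ⟨
    binomialSum n (λ k l → poch a k * (poch b l * (b + ν l)) + poch a k * (a + ν k) * poch b l)
      ≈⟨ binomialSum-cong n step ⟩
    binomialSum n (λ k l → (a + b + ν n) * (poch a k * poch b l))
      ≈⟨ binomialSum-*ˡ n _ _ ⟩
    (a + b + ν n) * binomialSum n (λ k l → poch a k * poch b l)
      ≈⟨ trans (*-congˡ (vandermonde a b n)) (*-comm _ _) ⟩
    poch (a + b) n * (a + b + ν n) ∎
    where
    step : ∀ k l → k ℕ.+ l ≡ n → poch a k * (poch b l * (b + ν l)) + poch a k * (a + ν k) * poch b l ≈ (a + b + ν n) * (poch a k * poch b l)
    step k l ≡.refl = trans
      (solve 6 (λ a b k l A B → A :* (B :* (b :+ l)) :+ A :* (a :+ k) :* B := (a :+ b :+ (k :+ l)) :* (A :* B)) refl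
        a b (ν k) (ν l) (poch a k) (poch b l))
      (*-congʳ (+-congˡ (sym (ν-+ k l))))

  -- Expanding (c + k)_l with c + k = (a + k) + (b + d) by Vandermonde reduces the
  -- sum to two more Vandermonde sums.
  saalschütz : ∀ {c} a b d → c ≈ a + b + d → ∀ n →
    binomialSum n (λ k l → poch a k * poch b k * poch d l * poch (c + ν k) l) ≈ poch (a + d) n * poch (b + d) n
  saalschütz {c} a b d c≈ n = begin
    binomialSum n (λ k l → poch a k * poch b k * poch d l * poch (c + ν k) l)
      ≈⟨ binomialSum-cong n (λ k l _ → trans (*-congˡ (expand k l)) (sym (binomialSum-*ˡ l _ _))) ⟩
    binomialSum n (λ k l → binomialSum l (λ i m → poch a k * poch b k * poch d l * (poch (a + ν k) i * poch (b + d) m)))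
      ≈⟨ binomialSum-cong n (λ k l _ → binomialSum-cong l (regroup k l)) ⟩
    binomialSum n (λ k l → binomialSum l (λ i m → poch a (k ℕ.+ i) * poch d m * poch (b + d) m * (poch b k * poch (d + ν m) i)))
      ≈⟨ binomialSum-assoc n (λ k i m → poch a (k ℕ.+ i) * poch d m * poch (b + d) m * (poch b k * poch (d + ν m) i)) ⟩
    binomialSum n (λ j m → binomialSum j (λ k i → poch a (k ℕ.+ i) * poch d m * poch (b + d) m * (poch b k * poch (d + ν m) i)))
      ≈⟨ binomialSum-cong n (λ j m j+m≡n → trans (binomialSum-cong j λ { k i ≡.refl → refl }) (collapse j m j+m≡n)) ⟩
    binomialSum n (λ j m → poch (b + d) n * (poch a j * poch d m))
      ≈⟨ trans (binomialSum-*ˡ n _ _) (trans (*-congˡ (vandermonde a d n)) (*-comm _ _)) ⟩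
    poch (a + d) n * poch (b + d) n ∎
    where
    expand : ∀ k l → poch (c + ν k) l ≈ binomialSum l (λ i m → poch (a + ν k) i * poch (b + d) m)
    expand k l = trans (poch-cong l (trans (+-congʳ c≈)
      (solve 4 (λ a b d k → a :+ b :+ d :+ k := (a :+ k) :+ (b :+ d)) refl a b d (ν k))))
      (sym (vandermonde (a + ν k) (b + d) l))
    regroup : ∀ k l i m → i ℕ.+ m ≡ l →
      poch a k * poch b k * poch d l * (poch (a + ν k) i * poch (b + d) m) ≈
      poch a (k ℕ.+ i) * poch d m * poch (b + d) m * (poch b k * poch (d + ν m) i)
    regroup k l i m ≡.refl = begin
      poch a k * poch b k * poch d (i ℕ.+ m) * (poch (a + ν k) i * poch (b + d) m)
        ≈⟨ *-congʳ (*-congˡ (trans (poch-≡ refl (ℕ.+-comm i m)) (poch-+ m i refl))) ⟩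
      poch a k * poch b k * (poch d m * poch (d + ν m) i) * (poch (a + ν k) i * poch (b + d) m)
        ≈⟨ solve 6 (λ A B D E F G → A :* B :* (D :* E) :* (F :* G) := (A :* F) :* D :* G :* (B :* E)) refl _ _ _ _ _ _ ⟩
      poch a k * poch (a + ν k) i * poch d m * poch (b + d) m * (poch b k * poch (d + ν m) i)
        ≈⟨ *-congʳ (*-congʳ (*-congʳ (poch-+ k i refl))) ⟨
      poch a (k ℕ.+ i) * poch d m * poch (b + d) m * (poch b k * poch (d + ν m) i) ∎
    collapse : ∀ j m → j ℕ.+ m ≡ n →
      binomialSum j (λ k i → poch a j * poch d m * poch (b + d) m * (poch b k * poch (d + ν m) i)) ≈
      poch (b + d) n * (poch a j * poch d m)
    collapse j m ≡.refl = begin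
      binomialSum j (λ k i → poch a j * poch d m * poch (b + d) m * (poch b k * poch (d + ν m) i))
        ≈⟨ trans (binomialSum-*ˡ j _ _) (*-congˡ (vandermonde b (d + ν m) j)) ⟩
      poch a j * poch d m * poch (b + d) m * poch (b + (d + ν m)) j
        ≈⟨ solve 4 (λ A B C D → A :* B :* C :* D := (C :* D) :* (A :* B)) refl _ _ _ _ ⟩
      poch (b + d) m * poch (b + (d + ν m)) j * (poch a j * poch d m)
        ≈⟨ *-congʳ (trans (poch-≡ refl (ℕ.+-comm j m)) (poch-+ m j (sym (+-assoc b d (ν m))))) ⟨
      poch (b + d) (j ℕ.+ m) * (poch a j * poch d m) ∎

-- Transformations of terminating hypergeometric series.

module Hypergeometric {c ℓ} (R : CommutativeRing c ℓ)
  (hom : ℤ.+-*-rawRing -Raw-AlmostCommutative⟶ fromCommutativeRing R) where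

  open ℤ-Algebra R hom

  -- A Sears transformation of balanced ₄F₃ series with all denominators cleared.
  sears : ∀ e q d δ g h → e + g + h ≈ q + d + δ → ∀ n →
    binomialSum n (λ j l → poch q j * poch d j * poch e j * poch δ l * (poch (e + g + ν j) l * poch (e + h + ν j) l)) ≈
    binomialSum n (λ i k → poch e k * poch δ i * poch g i * poch h i * (poch (q + δ + ν i) k * poch (d + δ + ν i) k))
  sears e q d δ g h balanced n = begin
    binomialSum n (λ j l → poch q j * poch d j * poch e j * poch δ l * (poch (e + g + ν j) l * poch (e + h + ν j) l))
      ≈⟨ binomialSum-cong n (λ j l _ → trans (*-congˡ (expand j l)) (sym (binomialSum-*ˡ l _ _))) ⟩
    binomialSum n (λ j l → binomialSum l (λ i m → poch q j * poch d j * poch e j * poch δ l *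
      (poch g i * poch h i * poch (e + ν j) m * poch (q + d + δ + ν j + ν i) m)))
      ≈⟨ binomialSum-cong n (λ j l _ → binomialSum-cong l (regroup j l)) ⟩
    binomialSum n (λ j l → binomialSum l (λ i m → term j i m))
      ≈⟨ binomialSum-exchange n term ⟩
    binomialSum n (λ i k → binomialSum k (λ j m → term j i m))
      ≈⟨ binomialSum-cong n (λ i k _ → collapse i k) ⟩
    binomialSum n (λ i k → poch e k * poch δ i * poch g i * poch h i * (poch (q + δ + ν i) k * poch (d + δ + ν i) k)) ∎
    where
    term : ℕ → ℕ → ℕ → Carrier
    term j i m = poch e (j ℕ.+ m) * poch δ i * poch g i * poch h i *
      (poch q j * poch d j * poch (δ + ν i) m * poch (q + d + δ + ν i + ν j) m)
    -- `saalschütz` read backwards. By `balanced` its long argument is `q + d + δ + j + i`, which is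
    -- also the one required to sum over `j` by `saalschütz` once the order of summation is
    -- exchanged.
    expand : ∀ j l → poch (e + g + ν j) l * poch (e + h + ν j) l ≈
      binomialSum l (λ i m → poch g i * poch h i * poch (e + ν j) m * poch (q + d + δ + ν j + ν i) m)
    expand j l = trans (*-cong (poch-cong l (shuffle e g (ν j))) (poch-cong l (shuffle e h (ν j))))
      (sym (saalschütz g h (e + ν j) (trans (+-congʳ (sym balanced)) (shuffle′ e g h (ν j))) l))
      where
      shuffle : ∀ e g j → e + g + j ≈ g + (e + j)
      shuffle = solve 3 (λ e g j → e :+ g :+ j := g :+ (e :+ j)) refl
      shuffle′ : ∀ e g h j → e + g + h + j ≈ g + h + (e + j)
      shuffle′ = solve 4 (λ e g h j → e :+ g :+ h :+ j := g :+ h :+ (e :+ j)) refl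
    regroup : ∀ j l i m → i ℕ.+ m ≡ l →
      poch q j * poch d j * poch e j * poch δ l * (poch g i * poch h i * poch (e + ν j) m * poch (q + d + δ + ν j + ν i) m) ≈
      term j i m
    regroup j l i m ≡.refl = begin
      poch q j * poch d j * poch e j * poch δ (i ℕ.+ m) * (poch g i * poch h i * poch (e + ν j) m * poch (q + d + δ + ν j + ν i) m)
        ≈⟨ *-cong (*-congˡ (poch-+ i m refl)) (*-congˡ (poch-cong m (swap (q + d + δ) (ν j) (ν i)))) ⟩
      poch q j * poch d j * poch e j * (poch δ i * poch (δ + ν i) m) * (poch g i * poch h i * poch (e + ν j) m * poch (q + d + δ + ν i + ν j) m)
        ≈⟨ solve 9 (λ A B C D E F G H I → A :* B :* C :* (D :* E) :* (F :* G :* H :* I) := (C :* H) :* D :* F :* G :* (A :* B :* E :* I)) refl _ _ _ _ _ _ _ _ _ ⟩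
      poch e j * poch (e + ν j) m * poch δ i * poch g i * poch h i * (poch q j * poch d j * poch (δ + ν i) m * poch (q + d + δ + ν i + ν j) m)
        ≈⟨ *-congʳ (*-congʳ (*-congʳ (*-congʳ (poch-+ j m refl)))) ⟨
      term j i m ∎
      where
      swap : ∀ x j i → x + j + i ≈ x + i + j
      swap = solve 3 (λ x j i → x :+ j :+ i := x :+ i :+ j) refl
    collapse : ∀ i k → binomialSum k (λ j m → term j i m) ≈
      poch e k * poch δ i * poch g i * poch h i * (poch (q + δ + ν i) k * poch (d + δ + ν i) k)
    collapse i k = begin
      binomialSum k (λ j m → term j i m)
        ≈⟨ binomialSum-cong k (λ { j m ≡.refl → refl }) ⟩
      binomialSum k (λ j m → poch e k * poch δ i * poch g i * poch h i *
        (poch q j * poch d j * poch (δ + ν i) m * poch (q + d + δ + ν i + ν j) m))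
        ≈⟨ binomialSum-*ˡ k _ _ ⟩
      poch e k * poch δ i * poch g i * poch h i *
        binomialSum k (λ j m → poch q j * poch d j * poch (δ + ν i) m * poch (q + d + δ + ν i + ν j) m)
        ≈⟨ *-congˡ (saalschütz q d (δ + ν i) (+-assoc (q + d) δ (ν i)) k) ⟩
      poch e k * poch δ i * poch g i * poch h i * (poch (q + (δ + ν i)) k * poch (d + (δ + ν i)) k)
        ≈⟨ *-congˡ (*-cong (poch-cong k (+-assoc q δ (ν i))) (poch-cong k (+-assoc d δ (ν i)))) ⟨
      poch e k * poch δ i * poch g i * poch h i * (poch (q + δ + ν i) k * poch (d + δ + ν i) k) ∎

  -- Bailey's lemma with all denominators cleared; the pair (α , β) of the usual
  -- formulation is φ together with the inner sum on the right.
  bailey : ∀ {c} d e δ → c ≈ d + e + δ → ∀ n (φ : ℕ → ℕ → Carrier) →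
    binomialSum n (λ k l → φ k l * (poch d k * poch e k * (poch (e + δ + ν k) l * poch (d + δ + ν k) l) * poch (c + ν (k ℕ.+ k ℕ.+ l)) l)) ≈
    binomialSum n (λ j m → poch d j * poch e j * poch δ m * poch (c + ν (j ℕ.+ j)) (m ℕ.+ m) *
      binomialSum j (λ k i → φ k (i ℕ.+ m) * poch (c + ν (k ℕ.+ k ℕ.+ i)) i))
  bailey {c} d e δ c≈ n φ = begin
    binomialSum n (λ k l → φ k l * (poch d k * poch e k * (poch (e + δ + ν k) l * poch (d + δ + ν k) l) * poch (c + ν (k ℕ.+ k ℕ.+ l)) l))
      ≈⟨ binomialSum-cong n (λ k l _ → trans (*-congˡ (trans (*-congʳ (*-congˡ (expand k l))) (rotate _ _ _))) (trans (sym (*-assoc _ _ _)) (sym (binomialSum-*ˡ l _ _)))) ⟩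
    binomialSum n (λ k l → binomialSum l (λ i m → φ k l * (poch d k * poch e k * poch (c + ν (k ℕ.+ k ℕ.+ l)) l) *
      (poch (e + ν k) i * poch (d + ν k) i * poch δ m * poch (c + ν (k ℕ.+ k) + ν i) m)))
      ≈⟨ binomialSum-cong n (λ k l _ → binomialSum-cong l (regroup k l)) ⟩
    binomialSum n (λ k l → binomialSum l (λ i m → term k i m))
      ≈⟨ binomialSum-assoc n term ⟩
    binomialSum n (λ j m → binomialSum j (λ k i → term k i m))
      ≈⟨ binomialSum-cong n (λ j m _ → trans (binomialSum-cong j λ { k i ≡.refl → refl }) (binomialSum-*ˡ j _ _)) ⟩
    binomialSum n (λ j m → outer j m * binomialSum j (λ k i → φ k (i ℕ.+ m) * poch (c + ν (k ℕ.+ k ℕ.+ i)) i)) ∎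
    where
    outer : ℕ → ℕ → Carrier
    outer j m = poch d j * poch e j * poch δ m * poch (c + ν (j ℕ.+ j)) (m ℕ.+ m)
    term : ℕ → ℕ → ℕ → Carrier
    term k i m = outer (k ℕ.+ i) m * (φ k (i ℕ.+ m) * poch (c + ν (k ℕ.+ k ℕ.+ i)) i)
    rotate : ∀ x y z → x * y * z ≈ x * z * y
    rotate = solve 3 (λ x y z → x :* y :* z := x :* z :* y) refl
    expand : ∀ k l → poch (e + δ + ν k) l * poch (d + δ + ν k) l ≈
      binomialSum l (λ i m → poch (e + ν k) i * poch (d + ν k) i * poch δ m * poch (c + ν (k ℕ.+ k) + ν i) m)
    expand k l = trans (*-cong (poch-cong l (swap e δ (ν k))) (poch-cong l (swap d δ (ν k))))
      (sym (saalschütz (e + ν k) (d + ν k) δ (trans (+-cong c≈ (ν-+ k k)) (shuffle d e δ (ν k))) l))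
      where
      swap : ∀ x j i → x + j + i ≈ x + i + j
      swap = solve 3 (λ x j i → x :+ j :+ i := x :+ i :+ j) refl
      shuffle : ∀ d e δ k → d + e + δ + (k + k) ≈ e + k + (d + k) + δ
      shuffle = solve 4 (λ d e δ k → d :+ e :+ δ :+ (k :+ k) := e :+ k :+ (d :+ k) :+ δ) refl
    -- Both sides are the rising factorial of length `i + 2m` starting at `c + 2k + i`, cut after
    -- `m` and after `i` factors.
    merge : ∀ k i m →
      poch (c + ν (k ℕ.+ k ℕ.+ (i ℕ.+ m))) (i ℕ.+ m) * poch (c + ν (k ℕ.+ k) + ν i) m ≈
      poch (c + ν ((k ℕ.+ i) ℕ.+ (k ℕ.+ i))) (m ℕ.+ m) * poch (c + ν (k ℕ.+ k ℕ.+ i)) i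
    merge k i m = begin
      poch (c + ν (k ℕ.+ k ℕ.+ (i ℕ.+ m))) (i ℕ.+ m) * poch (c + ν (k ℕ.+ k) + ν i) m
        ≈⟨ trans (*-comm _ _) (*-congʳ (poch-cong m (trans (+-assoc _ _ _) (+-congˡ (sym (ν-+ (k ℕ.+ k) i)))))) ⟩
      poch y m * poch (c + ν (k ℕ.+ k ℕ.+ (i ℕ.+ m))) (i ℕ.+ m)
        ≈⟨ poch-+ m (i ℕ.+ m) (shift (≡.sym (ℕ.+-assoc (k ℕ.+ k) i m))) ⟨
      poch y (m ℕ.+ (i ℕ.+ m))
        ≈⟨ poch-≡ refl (arrange i m) ⟩
      poch y (i ℕ.+ (m ℕ.+ m))
        ≈⟨ trans (poch-+ i (m ℕ.+ m) (shift (arrange′ k i))) (*-comm _ _) ⟩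
      poch (c + ν ((k ℕ.+ i) ℕ.+ (k ℕ.+ i))) (m ℕ.+ m) * poch y i ∎
      where
      y = c + ν (k ℕ.+ k ℕ.+ i)
      shift : ∀ {u v} → u ≡ k ℕ.+ k ℕ.+ i ℕ.+ v → c + ν u ≈ y + ν v
      shift ≡.refl = trans (+-congˡ (ν-+ (k ℕ.+ k ℕ.+ i) _)) (sym (+-assoc c _ _))
      arrange : ∀ i m → m ℕ.+ (i ℕ.+ m) ≡ i ℕ.+ (m ℕ.+ m)
      arrange = ℕ-Solver.solve-∀
      arrange′ : ∀ k i → (k ℕ.+ i) ℕ.+ (k ℕ.+ i) ≡ k ℕ.+ k ℕ.+ i ℕ.+ i
      arrange′ = ℕ-Solver.solve-∀
    regroup : ∀ k l i m → i ℕ.+ m ≡ l →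
      φ k l * (poch d k * poch e k * poch (c + ν (k ℕ.+ k ℕ.+ l)) l) *
        (poch (e + ν k) i * poch (d + ν k) i * poch δ m * poch (c + ν (k ℕ.+ k) + ν i) m) ≈ term k i m
    regroup k l i m ≡.refl = begin
      φ k l * (poch d k * poch e k * poch (c + ν (k ℕ.+ k ℕ.+ l)) l) *
        (poch (e + ν k) i * poch (d + ν k) i * poch δ m * poch (c + ν (k ℕ.+ k) + ν i) m)
        ≈⟨ solve 8 (λ p A B C D E F G → p :* (A :* B :* C) :* (D :* E :* F :* G) := (A :* E) :* (B :* D) :* F :* p :* (C :* G)) refl _ _ _ _ _ _ _ _ ⟩
      poch d k * poch (d + ν k) i * (poch e k * poch (e + ν k) i) * poch δ m * φ k l *
        (poch (c + ν (k ℕ.+ k ℕ.+ l)) l * poch (c + ν (k ℕ.+ k) + ν i) m)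
        ≈⟨ *-cong (*-congʳ (*-congʳ (*-cong (sym (poch-+ k i refl)) (sym (poch-+ k i refl))))) (merge k i m) ⟩
      poch d (k ℕ.+ i) * poch e (k ℕ.+ i) * poch δ m * φ k l *
        (poch (c + ν ((k ℕ.+ i) ℕ.+ (k ℕ.+ i))) (m ℕ.+ m) * poch (c + ν (k ℕ.+ k ℕ.+ i)) i)
        ≈⟨ solve 6 (λ A B C p D E → A :* B :* C :* p :* (D :* E) := A :* B :* C :* D :* (p :* E)) refl _ _ _ _ _ _ ⟩
      term k i m ∎

  -- The factor (a + 2k) (a)ₖ (-1)ᵏ; the (-n)ₖ / k! of the series is contained in binomialSum.
  well-poised : Carrier → ℕ → Carrier
  well-poised a k = sign k * (a + ν (k ℕ.+ k)) * poch a k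

  -- With `a + 2k = (a + k) + k`, absorption shifts the second part by one in `k`. There it cancels
  -- term by term against the two halves of Pascal's rule for the first part. This is the
  -- orthogonality behind the unit Bailey pair.
  well-poised-sum : ∀ a n → binomialSum (suc n) (λ k l → well-poised a k * poch (1# + a + ν (k ℕ.+ k ℕ.+ l)) l) ≈ 0#
  well-poised-sum a n = begin
    binomialSum (suc n) (λ k l → well-poised a k * poch (1# + a + ν (k ℕ.+ k ℕ.+ l)) l)
      ≈⟨ binomialSum-cong (suc n) {g = λ k l → (a + ν k) * h k l + ν k * h k l} (λ k l _ → split k l) ⟩
    binomialSum (suc n) (λ k l → (a + ν k) * h k l + ν k * h k l)
      ≈⟨ trans (binomialSum-+ (suc n) (λ k l → (a + ν k) * h k l) (λ k l → ν k * h k l)) (+-congˡ (trans (binomialSum-weight n h) (sym (binomialSum-*ˡ n _ _)))) ⟩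
    (binomialSum n (λ k l → (a + ν k) * h k (suc l)) + binomialSum n (λ k l → (a + ν (suc k)) * h (suc k) l))
      + binomialSum n (λ k l → ν (suc n) * h (suc k) l)
      ≈⟨ trans (+-assoc _ _ _) (+-congˡ (sym (binomialSum-+ n (λ k l → (a + ν (suc k)) * h (suc k) l) (λ k l → ν (suc n) * h (suc k) l)))) ⟩
    binomialSum n (λ k l → (a + ν k) * h k (suc l))
      + binomialSum n (λ k l → (a + ν (suc k)) * h (suc k) l + ν (suc n) * h (suc k) l)
      ≈⟨ binomialSum-+ n (λ k l → (a + ν k) * h k (suc l)) (λ k l → (a + ν (suc k)) * h (suc k) l + ν (suc n) * h (suc k) l) ⟨
    binomialSum n (λ k l → (a + ν k) * h k (suc l) + ((a + ν (suc k)) * h (suc k) l + ν (suc n) * h (suc k) l))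
      ≈⟨ trans (binomialSum-cong n cancel) (binomialSum-zero n) ⟩
    0# ∎
    where
    h : ℕ → ℕ → Carrier
    h k l = sign k * poch a k * poch (1# + a + ν (k ℕ.+ k ℕ.+ l)) l
    split : ∀ k l → well-poised a k * poch (1# + a + ν (k ℕ.+ k ℕ.+ l)) l ≈ (a + ν k) * h k l + ν k * h k l
    split k l = trans (*-congʳ (*-congʳ (*-congˡ (+-congˡ (ν-+ k k)))))
      (solve 5 (λ s a k A B → s :* (a :+ (k :+ k)) :* A :* B := (a :+ k) :* (s :* A :* B) :+ k :* (s :* A :* B)) refl _ _ _ _ _)
    cancel : ∀ k l → k ℕ.+ l ≡ n →
      (a + ν k) * h k (suc l) + ((a + ν (suc k)) * h (suc k) l + ν (suc n) * h (suc k) l) ≈ 0#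
    cancel k l ≡.refl = begin
      (a + ν k) * h k (suc l) + ((a + ν (suc k)) * h (suc k) l + ν (suc (k ℕ.+ l)) * h (suc k) l)
        ≈⟨ +-cong (*-congˡ (*-congˡ (trans (poch-cong (suc l) (reflexive (≡.cong (λ z → 1# + a + ν z) (index k l)))) (poch-suc l (sym y+1)))))
             (trans (sym (distribʳ _ _ _)) (*-congʳ y≈)) ⟩
      (a + ν k) * (sign k * poch a k * (y * P)) + y * (- sign k * (poch a k * (a + ν k)) * P)
        ≈⟨ solve 5 (λ x s A y P → x :* (s :* A :* (y :* P)) :+ y :* (:- s :* (A :* x) :* P) := con (+ 0)) refl _ _ _ _ _ ⟩
      ι (+ 0) ≈⟨ 0-homo ⟩
      0# ∎
      where
      y = 1# + a + ν (suc (k ℕ.+ k ℕ.+ l))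
      P = poch (1# + a + ν (suc k ℕ.+ suc k ℕ.+ l)) l
      index : ∀ k l → k ℕ.+ k ℕ.+ suc l ≡ suc (k ℕ.+ k ℕ.+ l)
      index = ℕ-Solver.solve-∀
      index′ : ∀ k l → suc k ℕ.+ suc k ℕ.+ l ≡ suc (k ℕ.+ k ℕ.+ l) ℕ.+ 1
      index′ = ℕ-Solver.solve-∀
      y+1 : y + 1# ≈ 1# + a + ν (suc k ℕ.+ suc k ℕ.+ l)
      y+1 = trans (+-assoc _ _ _) (+-congˡ (trans (+-congˡ (sym 1-homo)) (trans (sym (ν-+ _ 1)) (reflexive (≡.cong ν (≡.sym (index′ k l)))))))
      y≈ : a + ν (suc k) + ν (suc (k ℕ.+ l)) ≈ y
      y≈ = trans (+-cong (+-congˡ (ν-suc k)) (trans (ν-suc _) (+-congˡ (ν-+ k l))))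
        (trans (solve 4 (λ a k l o → a :+ (o :+ k) :+ (o :+ (k :+ l)) := o :+ a :+ (o :+ (k :+ k :+ l))) refl a (ν k) (ν l) 1#)
          (+-congˡ (sym (trans (ν-suc _) (+-congˡ (trans (ν-+ (k ℕ.+ k) l) (+-congʳ (ν-+ k k))))))))

  -- The terminating very-well-poised ₅F₄ summation: in `bailey` with the unit pair all inner sums
  -- vanish by `well-poised-sum`, except the one for `j = 0`.
  five-four-sum : ∀ {s} a b c q → s ≈ 1# + a → s ≈ b + c + q → ∀ n →
    binomialSum n (λ k l → well-poised a k * (poch b k * poch c k * (poch (c + q + ν k) l * poch (b + q + ν k) l) * poch (s + ν (k ℕ.+ k ℕ.+ l)) l)) ≈
    a * poch q n * poch s (n ℕ.+ n)
  five-four-sum {s} a b c q s≈ s≈′ n = begin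
    binomialSum n (λ k l → well-poised a k * (poch b k * poch c k * (poch (c + q + ν k) l * poch (b + q + ν k) l) * poch (s + ν (k ℕ.+ k ℕ.+ l)) l))
      ≈⟨ bailey b c q s≈′ n (λ k _ → well-poised a k) ⟩
    binomialSum n (λ j m → outer j m * inner j)
      ≈⟨ binomialSum-first n (λ j m → outer j m * inner j) (λ j m → trans (*-congˡ (vanishes j)) (zeroʳ _)) ⟩
    1# * 1# * poch q n * poch (s + ν 0) (n ℕ.+ n) * (1# * (a + ν 0) * 1# * 1#)
      ≈⟨ *-cong (*-congˡ (poch-cong (n ℕ.+ n) (x+ν0 s))) (*-congʳ (*-congʳ (*-congˡ (x+ν0 a)))) ⟩
    1# * 1# * poch q n * poch s (n ℕ.+ n) * (1# * a * 1# * 1#)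
      ≈⟨ *-cong (*-congʳ (trans (*-congʳ (*-identityˡ _)) (*-identityˡ _))) (trans (*-identityʳ _) (trans (*-identityʳ _) (*-identityˡ _))) ⟩
    poch q n * poch s (n ℕ.+ n) * a
      ≈⟨ solve 3 (λ x y a → x :* y :* a := a :* x :* y) refl _ _ _ ⟩
    a * poch q n * poch s (n ℕ.+ n) ∎
    where
    outer : ℕ → ℕ → Carrier
    outer j m = poch b j * poch c j * poch q m * poch (s + ν (j ℕ.+ j)) (m ℕ.+ m)
    inner : ℕ → Carrier
    inner j = binomialSum j (λ k i → well-poised a k * poch (s + ν (k ℕ.+ k ℕ.+ i)) i)
    vanishes : ∀ j → inner (suc j) ≈ 0#
    vanishes j = trans (binomialSum-cong (suc j) {g = λ k i → well-poised a k * poch (1# + a + ν (k ℕ.+ k ℕ.+ i)) i} (λ k i _ → *-congˡ (poch-cong i (+-congʳ s≈)))) (well-poised-sum a j)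
    x+ν0 : ∀ x → x + ν 0 ≈ x
    x+ν0 x = trans (+-congˡ 0-homo) (+-identityʳ x)

  -- A very-well-poised ₇F₆ as a balanced ₄F₃: Bailey's lemma applied twice, then sears.
  transformation : ∀ {s} a b c d e q δ g h → s ≈ 1# + a → s ≈ b + c + q → s ≈ d + e + δ →
    e + g ≈ c + q → e + h ≈ b + q → ∀ n →
    binomialSum n (λ k l → well-poised a k * (poch b k * poch c k * (poch (c + q + ν k) l * poch (b + q + ν k) l))
      * (poch d k * poch e k * (poch (e + δ + ν k) l * poch (d + δ + ν k) l) * poch (s + ν (k ℕ.+ k ℕ.+ l)) l)) ≈
    a * poch s (n ℕ.+ n) *
      binomialSum n (λ i k → poch e k * poch δ i * poch g i * poch h i * (poch (q + δ + ν i) k * poch (d + δ + ν i) k))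
  transformation {s} a b c d e q δ g h s≈ s≈bc s≈de eg eh n = begin
    binomialSum n (λ k l → φ k l * (poch d k * poch e k * (poch (e + δ + ν k) l * poch (d + δ + ν k) l) * poch (s + ν (k ℕ.+ k ℕ.+ l)) l))
      ≈⟨ bailey d e δ s≈de n φ ⟩
    binomialSum n (λ j m → poch d j * poch e j * poch δ m * poch (s + ν (j ℕ.+ j)) (m ℕ.+ m) *
      binomialSum j (λ k i → φ k (i ℕ.+ m) * poch (s + ν (k ℕ.+ k ℕ.+ i)) i))
      ≈⟨ binomialSum-cong n step ⟩
    binomialSum n (λ j m → a * poch s (n ℕ.+ n) * (poch q j * poch d j * poch e j * poch δ m * (poch (e + g + ν j) m * poch (e + h + ν j) m)))
      ≈⟨ binomialSum-*ˡ n _ _ ⟩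
    a * poch s (n ℕ.+ n) * binomialSum n (λ j m → poch q j * poch d j * poch e j * poch δ m * (poch (e + g + ν j) m * poch (e + h + ν j) m))
      ≈⟨ *-congˡ (sears e q d δ g h balanced n) ⟩
    a * poch s (n ℕ.+ n) * binomialSum n (λ i k → poch e k * poch δ i * poch g i * poch h i * (poch (q + δ + ν i) k * poch (d + δ + ν i) k)) ∎
    where
    φ : ℕ → ℕ → Carrier
    φ k l = well-poised a k * (poch b k * poch c k * (poch (c + q + ν k) l * poch (b + q + ν k) l))
    balanced : e + g + h ≈ q + d + δ
    balanced = begin
      e + g + h                         ≈⟨ solve 3 (λ e g h → e :+ g :+ h := (e :+ g) :+ (e :+ h) :- e) refl e g h ⟩
      (e + g) + (e + h) - e             ≈⟨ +-congʳ (+-cong eg eh) ⟩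
      (c + q) + (b + q) - e             ≈⟨ solve 4 (λ b c q e → (c :+ q) :+ (b :+ q) :- e := (b :+ c :+ q) :+ q :- e) refl b c q e ⟩
      (b + c + q) + q - e               ≈⟨ +-congʳ (+-congʳ (trans (sym s≈bc) s≈de)) ⟩
      (d + e + δ) + q - e               ≈⟨ solve 4 (λ d e δ q → (d :+ e :+ δ) :+ q :- e := q :+ d :+ δ) refl d e δ q ⟩
      q + d + δ                         ∎
    -- Splitting the rising factorials of length `i + m` after `i` factors leaves tails that start
    -- at `k + i = j`. They come out of the sum, and what remains is a ₅F₄ of length `j`.
    inner : ∀ j m → binomialSum j (λ k i → φ k (i ℕ.+ m) * poch (s + ν (k ℕ.+ k ℕ.+ i)) i) ≈
      poch (c + q + ν j) m * poch (b + q + ν j) m * (a * poch q j * poch s (j ℕ.+ j))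
    inner j m = trans (binomialSum-cong j pull) (trans (binomialSum-*ˡ j _ _) (*-congˡ (five-four-sum a b c q s≈ s≈bc j)))
      where
      pull : ∀ k i → k ℕ.+ i ≡ j → φ k (i ℕ.+ m) * poch (s + ν (k ℕ.+ k ℕ.+ i)) i ≈
        poch (c + q + ν j) m * poch (b + q + ν j) m *
          (well-poised a k * (poch b k * poch c k * (poch (c + q + ν k) i * poch (b + q + ν k) i) * poch (s + ν (k ℕ.+ k ℕ.+ i)) i))
      pull k i ≡.refl = trans (*-congʳ (*-congˡ (*-congˡ (*-cong (cut (c + q)) (cut (b + q))))))
        (solve 8 (λ w A B C D E F G → w :* (A :* B :* ((C :* D) :* (E :* F))) :* G := D :* F :* (w :* (A :* B :* (C :* E) :* G))) refl _ _ _ _ _ _ _ _)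
        where
        cut : ∀ x → poch (x + ν k) (i ℕ.+ m) ≈ poch (x + ν k) i * poch (x + ν (k ℕ.+ i)) m
        cut x = poch-+ i m (trans (+-congˡ (ν-+ k i)) (sym (+-assoc x _ _)))
    step : ∀ j m → j ℕ.+ m ≡ n →
      poch d j * poch e j * poch δ m * poch (s + ν (j ℕ.+ j)) (m ℕ.+ m) *
        binomialSum j (λ k i → φ k (i ℕ.+ m) * poch (s + ν (k ℕ.+ k ℕ.+ i)) i) ≈
      a * poch s (n ℕ.+ n) * (poch q j * poch d j * poch e j * poch δ m * (poch (e + g + ν j) m * poch (e + h + ν j) m))
    step j m ≡.refl = begin
      poch d j * poch e j * poch δ m * poch (s + ν (j ℕ.+ j)) (m ℕ.+ m) *
        binomialSum j (λ k i → φ k (i ℕ.+ m) * poch (s + ν (k ℕ.+ k ℕ.+ i)) i)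
        ≈⟨ *-congˡ (inner j m) ⟩
      poch d j * poch e j * poch δ m * poch (s + ν (j ℕ.+ j)) (m ℕ.+ m) *
        (poch (c + q + ν j) m * poch (b + q + ν j) m * (a * poch q j * poch s (j ℕ.+ j)))
        ≈⟨ solve 9 (λ D E Δ S U V a Q S′ → D :* E :* Δ :* S :* (U :* V :* (a :* Q :* S′)) := a :* (S′ :* S) :* (Q :* D :* E :* Δ :* (U :* V))) refl _ _ _ _ _ _ _ _ _ ⟩
      a * (poch s (j ℕ.+ j) * poch (s + ν (j ℕ.+ j)) (m ℕ.+ m)) *
        (poch q j * poch d j * poch e j * poch δ m * (poch (c + q + ν j) m * poch (b + q + ν j) m))
        ≈⟨ *-cong (*-congˡ (sym (trans (poch-≡ refl (arrange j m)) (poch-+ (j ℕ.+ j) (m ℕ.+ m) refl))))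
             (*-congˡ (*-cong (poch-cong m (+-congʳ (sym eg))) (poch-cong m (+-congʳ (sym eh))))) ⟩
      a * poch s ((j ℕ.+ m) ℕ.+ (j ℕ.+ m)) *
        (poch q j * poch d j * poch e j * poch δ m * (poch (e + g + ν j) m * poch (e + h + ν j) m)) ∎
      where
      arrange : ∀ j m → (j ℕ.+ m) ℕ.+ (j ℕ.+ m) ≡ (j ℕ.+ j) ℕ.+ (m ℕ.+ m)
      arrange = ℕ-Solver.solve-∀

-- Reversal and vanishing of rising factorials, and the passage from binomial to ordinary sums.

module Pochhammer {c ℓ} (R : CommutativeRing c ℓ)
  (hom : ℤ.+-*-rawRing -Raw-AlmostCommutative⟶ fromCommutativeRing R) where

  open ℤ-Algebra R hom

  poch-1 : ∀ k → poch 1# k ≈ ν (k !)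
  poch-1 zero    = sym 1-homo
  poch-1 (suc k) = begin
    poch 1# k * (1# + ν k)       ≈⟨ *-cong (poch-1 k) (sym (ν-suc k)) ⟩
    ν (k !) * ν (suc k)          ≈⟨ *-homo (+ (k !)) (+ suc k) ⟨
    ι (+ (k !) ℤ.* + suc k)      ≈⟨ reflexive (≡.cong ι (≡.trans (ℤ.*-comm (+ (k !)) (+ suc k)) (≡.sym (ℤ.pos-* (suc k) (k !))))) ⟩
    ν (suc k !)                  ∎

  -- Read backwards, the factors are negated: `x + i = - (y + (k - 1 - i))`.
  poch-reverse : ∀ {x y} k → y + x + ν k ≈ 1# → poch x k ≈ sign k * poch y k
  poch-reverse zero e = sym (*-identityˡ 1#)
  poch-reverse {x} {y} (suc k) e = begin
    poch x (suc k)                       ≈⟨ poch-suc k refl ⟩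
    x * poch (x + 1#) k                  ≈⟨ *-congˡ (poch-reverse k (trans (shift y x 1# (ν k)) (trans (+-congˡ (sym (ν-suc k))) e))) ⟩
    x * (sign k * poch y k)              ≈⟨ solve 5 (λ x y k S P → x :* (S :* P) := :- S :* (P :* (y :+ k)) :+ S :* P :* (y :+ x :+ k)) refl x y (ν k) (sign k) (poch y k) ⟩
    sign (suc k) * poch y (suc k) + sign k * poch y k * (y + x + ν k)
                                         ≈⟨ +-congˡ (*-congˡ y+x+k) ⟩
    sign (suc k) * poch y (suc k) + sign k * poch y k * 0#
                                         ≈⟨ trans (+-congˡ (zeroʳ _)) (+-identityʳ _) ⟩
    sign (suc k) * poch y (suc k)        ∎
    where
    shift : ∀ y x o k → y + (x + o) + k ≈ y + x + (o + k)
    shift = solve 4 (λ y x o k → y :+ (x :+ o) :+ k := y :+ x :+ (o :+ k)) refl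
    y+x+k : y + x + ν k ≈ 0#
    y+x+k = begin
      y + x + ν k                   ≈⟨ solve 3 (λ y o k → y :+ k := y :+ (o :+ k) :- o) refl (y + x) 1# (ν k) ⟩
      y + x + (1# + ν k) - 1#       ≈⟨ +-congʳ (trans (+-congˡ (sym (ν-suc k))) e) ⟩
      1# - 1#                       ≈⟨ -‿inverseʳ 1# ⟩
      0#                            ∎

  poch-vanish : ∀ {x} t d → x + ν t ≈ 0# → poch x (suc t ℕ.+ d) ≈ 0#
  poch-vanish {x} t d e = trans (poch-+ (suc t) d refl)
    (trans (*-congʳ (trans (*-congˡ e) (zeroʳ _))) (zeroˡ _))

  -- The factors run from `1 + s - k` to `s` in steps of one and so pass through `0`.
  poch-ν-vanish : ∀ s {x k} → s < k → x + ν k ≈ 1# + ν s → poch x k ≈ 0#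
  poch-ν-vanish s {x} {k} s<k e with ℕ.m≤n⇒∃[o]m+o≡n s<k
  ... | d , ≡.refl = trans (poch-≡ refl (≡.cong suc (ℕ.+-comm s d)))
    (poch-vanish d s (begin
      x + ν d                                       ≈⟨ solve 4 (λ x o d s → x :+ d := x :+ (o :+ (s :+ d)) :- (o :+ s)) refl x 1# (ν d) (ν s) ⟩
      x + (1# + (ν s + ν d)) - (1# + ν s)           ≈⟨ +-congʳ (trans (+-congˡ (trans (+-congˡ (sym (ν-+ s d))) (sym (ν-suc _)))) e) ⟩
      1# + ν s - (1# + ν s)                         ≈⟨ -‿inverseʳ _ ⟩
      0#                                            ∎))

  antidiagonalSum-cong : ∀ n {f g} → (∀ k l → k ℕ.+ l ≡ n → f k l ≈ g k l) →
    antidiagonalSum n f ≈ antidiagonalSum n g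
  antidiagonalSum-cong zero    e = e 0 0 ≡.refl
  antidiagonalSum-cong (suc n) e = +-cong (e 0 (suc n) ≡.refl)
    (antidiagonalSum-cong n λ k l k+l≡n → e (suc k) l (≡.cong suc k+l≡n))

  antidiagonalSum-+ : ∀ n (f g : ℕ → ℕ → Carrier) →
    antidiagonalSum n (λ k l → f k l + g k l) ≈ antidiagonalSum n f + antidiagonalSum n g
  antidiagonalSum-+ zero    f g = refl
  antidiagonalSum-+ (suc n) f g = trans (+-congˡ (antidiagonalSum-+ n _ _))
    (solve 4 (λ a b c d → (a :+ b) :+ (c :+ d) := (a :+ c) :+ (b :+ d)) refl _ _ _ _)

  antidiagonalSum-*ˡ : ∀ n x f → antidiagonalSum n (λ k l → x * f k l) ≈ x * antidiagonalSum n f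
  antidiagonalSum-*ˡ zero    x f = refl
  antidiagonalSum-*ˡ (suc n) x f = trans (+-congˡ (antidiagonalSum-*ˡ n x _)) (sym (distribˡ x _ _))

  antidiagonalSum-last : ∀ n (f : ℕ → ℕ → Carrier) →
    antidiagonalSum (suc n) f ≈ antidiagonalSum n (λ k l → f k (suc l)) + f (suc n) 0
  antidiagonalSum-last zero    f = refl
  antidiagonalSum-last (suc n) f = trans (+-congˡ (antidiagonalSum-last n (λ k l → f (suc k) l))) (sym (+-assoc _ _ _))

  -- The product of `k!` and the binomial coefficient is `(l + 1)_k`, so a binomial sum becomes an
  -- ordinary one without dividing by a factorial.
  binomialSum-factorial : ∀ n (f : ℕ → ℕ → Carrier) →
    binomialSum n (λ k l → ν (k !) * f k l) ≈ antidiagonalSum n (λ k l → poch (1# + ν l) k * f k l)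
  binomialSum-factorial zero    f = *-congʳ 1-homo
  binomialSum-factorial (suc n) f = begin
    binomialSum n (λ k l → ν (k !) * f k (suc l)) + binomialSum n (λ k l → ν (suc k !) * f (suc k) l)
      ≈⟨ +-cong (binomialSum-factorial n (λ k l → f k (suc l)))
           (trans (binomialSum-cong n λ k l _ → trans (*-congʳ (factorial k)) (*-assoc _ _ _))
             (binomialSum-factorial n (λ k l → ν (suc k) * f (suc k) l))) ⟩
    antidiagonalSum n (λ k l → poch (1# + ν l) k * f k (suc l)) + antidiagonalSum n (λ k l → poch (1# + ν l) k * (ν (suc k) * f (suc k) l))
      -- The added term has `l = 0` and contains the rising factorial of `0`, hence is zero; it
      -- completes the first sum to the range of the second, so that the two can be added by
      -- Pascal's rule.
      ≈⟨ +-congʳ (trans (sym (trans (+-congˡ (trans (*-congʳ (trans (poch-suc n (sym (trans (+-congʳ 0-homo) (+-identityˡ 1#)))) (trans (*-congʳ 0-homo) (zeroˡ _)))) (zeroˡ _))) (+-identityʳ _)))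
           (trans (+-congʳ (antidiagonalSum-cong n λ k l _ → *-congʳ (poch-cong k (sym (ν-suc l))))) (sym (antidiagonalSum-last n (λ k l → poch (ν l) k * f k l))))) ⟩
    1# * f 0 (suc n) + antidiagonalSum n (λ k l → poch (ν l) (suc k) * f (suc k) l) + antidiagonalSum n (λ k l → poch (1# + ν l) k * (ν (suc k) * f (suc k) l))
      ≈⟨ trans (+-assoc _ _ _) (+-congˡ (trans (sym (antidiagonalSum-+ n _ _)) (antidiagonalSum-cong n λ k l _ → pascal k l))) ⟩
    1# * f 0 (suc n) + antidiagonalSum n (λ k l → poch (1# + ν l) (suc k) * f (suc k) l) ∎
    where
    factorial : ∀ k → ν (suc k !) ≈ ν (k !) * ν (suc k)
    factorial k = trans (reflexive (≡.cong ι (ℤ.pos-* (suc k) (k !)))) (trans (*-homo (+ suc k) (+ (k !))) (*-comm _ _))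
    pascal : ∀ k l → poch (ν l) (suc k) * f (suc k) l + poch (1# + ν l) k * (ν (suc k) * f (suc k) l) ≈ poch (1# + ν l) (suc k) * f (suc k) l
    pascal k l = trans (+-cong (*-congʳ (poch-suc k (+-comm 1# (ν l)))) (*-congˡ (*-congʳ (ν-suc k))))
      (solve 5 (λ o l k P f → l :* P :* f :+ P :* ((o :+ k) :* f) := P :* (o :+ l :+ k) :* f) refl 1# (ν l) (ν k) (poch (1# + ν l) k) (f (suc k) l))

  rangeSum-cong : ∀ n {f g} → (∀ k → k < n → f k ≈ g k) → rangeSum n f ≈ rangeSum n g
  rangeSum-cong zero    e = refl
  rangeSum-cong (suc n) e = +-cong (e 0 (s≤s z≤n)) (rangeSum-cong n λ k k<n → e (suc k) (s≤s k<n))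

  rangeSum-*ˡ : ∀ n x f → rangeSum n (λ k → x * f k) ≈ x * rangeSum n f
  rangeSum-*ˡ zero    x f = sym (zeroʳ x)
  rangeSum-*ˡ (suc n) x f = trans (+-congˡ (rangeSum-*ˡ n x _)) (sym (distribˡ x _ _))

  rangeSum-truncate : ∀ m d (f : ℕ → Carrier) → (∀ k → m ≤ k → f k ≈ 0#) → rangeSum (m ℕ.+ d) f ≈ rangeSum m f
  rangeSum-truncate zero    zero    f e = refl
  rangeSum-truncate zero    (suc d) f e = trans (+-cong (e 0 z≤n) (rangeSum-truncate 0 d (λ k → f (suc k)) (λ k _ → e (suc k) z≤n))) (+-identityˡ 0#)
  rangeSum-truncate (suc m) d f e = +-congˡ (rangeSum-truncate m d (λ k → f (suc k)) (λ k m≤k → e (suc k) (s≤s m≤k)))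

  antidiagonalSum-rangeSum : ∀ n (f : ℕ → Carrier) → antidiagonalSum n (λ k _ → f k) ≈ rangeSum (suc n) f
  antidiagonalSum-rangeSum zero    f = sym (+-identityʳ _)
  antidiagonalSum-rangeSum (suc n) f = +-congˡ (antidiagonalSum-rangeSum n _)

  open Exp semiring public using (_^_)

  ^-cong : ∀ n {x y} → x ≈ y → x ^ n ≈ y ^ n
  ^-cong zero    e = refl
  ^-cong (suc n) e = *-cong e (^-cong n e)

  ι-poch : ∀ x k → ι (Z.poch x k) ≈ poch (ι x) k
  ι-poch x zero    = 1-homo
  ι-poch x (suc k) = trans (*-homo _ _) (*-cong (ι-poch x k) (+-homo _ _))

  ι-rangeSum : ∀ n f → ι (Z.rangeSum n f) ≈ rangeSum n (λ k → ι (f k))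
  ι-rangeSum zero    f = 0-homo
  ι-rangeSum (suc n) f = trans (+-homo _ _) (+-congˡ (ι-rangeSum n _))

  ι-binomialSum : ∀ n f → ι (Z.binomialSum n f) ≈ binomialSum n (λ k l → ι (f k l))
  ι-binomialSum zero    f = refl
  ι-binomialSum (suc n) f = trans (+-homo _ _) (+-cong (ι-binomialSum n _) (ι-binomialSum n _))

  ι-^ : ∀ x n → ι (x ℤ.^ n) ≈ ι x ^ n
  ι-^ x zero    = 1-homo
  ι-^ x (suc n) = trans (*-homo _ _) (*-congˡ (ι-^ x n))

-- Fifth roots of unity, and the quotient by an annihilator.

module FifthRoots {c ℓ} (R : CommutativeRing c ℓ)
  (hom : ℤ.+-*-rawRing -Raw-AlmostCommutative⟶ fromCommutativeRing R) where

  open ℤ-Algebra R hom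
  open Pochhammer R hom

  private
    one : ι (+ 1) ≈ 1#
    one = 1-homo

  -- z is a primitive fifth root of unity and σ = z + z⁻¹.
  module _ {σ z : Carrier} (σ²+σ≈1 : σ * σ + σ ≈ ι (+ 1)) (z²+1≈σz : z * z + ι (+ 1) ≈ σ * z) where

    z₁ z₂ z₃ z₄ : Carrier
    z₁ = z
    z₄ = σ - z
    z₂ = z₁ * z₁
    z₃ = z₄ * z₄

    private
      -- The solver does not know the relations satisfied by `σ` and `z`; `x` is the explicit
      -- cofactor with which a relation `v ≈ w` enters.
      replace : ∀ {u v w y x} → v ≈ w → u ≈ y + (v - w) * x → u ≈ y
      replace {u} {v} {w} {y} {x} v≈w e = begin
        u                  ≈⟨ e ⟩
        y + (v - w) * x    ≈⟨ +-congˡ (*-congʳ (trans (+-congʳ v≈w) (-‿inverseʳ w))) ⟩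
        y + 0# * x         ≈⟨ trans (+-congˡ (zeroˡ x)) (+-identityʳ y) ⟩
        y                  ∎

    z₁+z₄ : z₁ + z₄ ≈ σ
    z₁+z₄ = solve 2 (λ σ z → z :+ (σ :- z) := σ) refl σ z

    z₁z₄ : z₁ * z₄ ≈ ι (+ 1)
    z₁z₄ = replace z²+1≈σz
      (solve 2 (λ σ z → z :* (σ :- z) := con (+ 1) :+ (z :* z :+ con (+ 1) :- σ :* z) :* con (ℤ.-1ℤ)) refl σ z)

    z₂z₃ : z₂ * z₃ ≈ ι (+ 1)
    z₂z₃ = trans (solve 2 (λ x y → (x :* x) :* (y :* y) := (x :* y) :* (x :* y)) refl z₁ z₄)
      (trans (*-cong z₁z₄ z₁z₄) (trans (*-congʳ one) (*-identityˡ _)))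

    z₂+z₃ : z₂ + z₃ ≈ ι (ℤ.-1ℤ) - σ
    z₂+z₃ = replace σ²+σ≈1 (replace {x = ι (+ 2)} z²+1≈σz
      (solve 2 (λ σ z → z :* z :+ (σ :- z) :* (σ :- z) :=
        (con ℤ.-1ℤ :- σ) :+ (σ :* σ :+ σ :- con (+ 1)) :* con (+ 1) :+ (z :* z :+ con (+ 1) :- σ :* z) :* con (+ 2)) refl σ z))

    z-sum : z₁ + z₂ + (z₃ + z₄) ≈ ι ℤ.-1ℤ
    z-sum = trans (solve 4 (λ a b c d → a :+ b :+ (c :+ d) := (a :+ d) :+ (b :+ c)) refl z₁ z₂ z₃ z₄)
      (trans (+-cong z₁+z₄ z₂+z₃) (solve 1 (λ σ → σ :+ (con ℤ.-1ℤ :- σ) := con ℤ.-1ℤ) refl σ))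

    private
      quadratic : ∀ y w u v → (y + u * w) * (y + v * w) ≈ y * y + (u + v) * (w * y) + (u * v) * (w * w)
      quadratic = solve 4 (λ y w u v → (y :+ u :* w) :* (y :+ v :* w) := y :* y :+ (u :+ v) :* (w :* y) :+ (u :* v) :* (w :* w)) refl

    -- Multiplying conjugate factors first, `z₁` with `z₄` and `z₂` with `z₃`, gives quadratics with
    -- coefficients in `σ` alone, so that `σ² + σ = 1` finishes the computation.
    linear-product : ∀ y w → (y + z₁ * w) * (y + z₂ * w) * ((y + z₃ * w) * (y + z₄ * w)) * (y + w) ≈ y ^ 5 + w ^ 5
    linear-product y w = begin
      (y + z₁ * w) * (y + z₂ * w) * ((y + z₃ * w) * (y + z₄ * w)) * (y + w)
        ≈⟨ solve 5 (λ a b c d e → a :* b :* (c :* d) :* e := (a :* d) :* (b :* c) :* e) refl _ _ _ _ _ ⟩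
      (y + z₁ * w) * (y + z₄ * w) * ((y + z₂ * w) * (y + z₃ * w)) * (y + w)
        ≈⟨ *-congʳ (*-cong (trans (quadratic y w z₁ z₄) (+-cong (+-congˡ (*-congʳ z₁+z₄)) (*-congʳ z₁z₄)))
             (trans (quadratic y w z₂ z₃) (+-cong (+-congˡ (*-congʳ z₂+z₃)) (*-congʳ z₂z₃)))) ⟩
      (y * y + σ * (w * y) + ι (+ 1) * (w * w)) * (y * y + (ι ℤ.-1ℤ - σ) * (w * y) + ι (+ 1) * (w * w)) * (y + w)
        ≈⟨ replace σ²+σ≈1 (solve 3 (λ σ y w →
             (y :* y :+ σ :* (w :* y) :+ con (+ 1) :* (w :* w)) :* (y :* y :+ (con ℤ.-1ℤ :- σ) :* (w :* y) :+ con (+ 1) :* (w :* w)) :* (y :+ w) :=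
             (y :^ 5 :+ w :^ 5) :+ (σ :* σ :+ σ :- con (+ 1)) :* (:- ((y :* y) :* (w :* w) :* (y :+ w)))) refl σ y w) ⟩
      y ^ 5 + w ^ 5 ∎

    -- `linear-product` in each factor, where `w⁵ = 0` removes the perturbation: this is how five
    -- perturbed parameters become a fifth power again.
    poch-product : ∀ y w → w ^ 5 ≈ 0# → ∀ k →
      poch (y + z₁ * w) k * poch (y + z₂ * w) k * (poch (y + z₃ * w) k * poch (y + z₄ * w) k) * poch (y + w) k ≈ poch y k ^ 5
    poch-product y w w⁵ zero = solve 1 (λ o → o :* o :* (o :* o) :* o := o :^ 5) refl 1#
    poch-product y w w⁵ (suc k) = begin
      poch (y + z₁ * w) (suc k) * poch (y + z₂ * w) (suc k) * (poch (y + z₃ * w) (suc k) * poch (y + z₄ * w) (suc k)) * poch (y + w) (suc k)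
        ≈⟨ solve 10 (λ A a B b C c D d E e → (A :* a) :* (B :* b) :* ((C :* c) :* (D :* d)) :* (E :* e) :=
             A :* B :* (C :* D) :* E :* (a :* b :* (c :* d) :* e)) refl _ _ _ _ _ _ _ _ _ _ ⟩
      poch (y + z₁ * w) k * poch (y + z₂ * w) k * (poch (y + z₃ * w) k * poch (y + z₄ * w) k) * poch (y + w) k *
        ((y + z₁ * w + ν k) * (y + z₂ * w + ν k) * ((y + z₃ * w + ν k) * (y + z₄ * w + ν k)) * (y + w + ν k))
        ≈⟨ *-cong (poch-product y w w⁵ k) (*-cong (*-cong (*-cong (swap _) (swap _)) (*-cong (swap _) (swap _))) (swap w)) ⟩
      poch y k ^ 5 * ((Y + z₁ * w) * (Y + z₂ * w) * ((Y + z₃ * w) * (Y + z₄ * w)) * (Y + w))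
        ≈⟨ *-congˡ (trans (linear-product Y w) (trans (+-congˡ w⁵) (+-identityʳ _))) ⟩
      poch y k ^ 5 * Y ^ 5
        ≈⟨ solve 2 (λ A Y → A :^ 5 :* Y :^ 5 := (A :* Y) :^ 5) refl (poch y k) Y ⟩
      (poch y k * Y) ^ 5 ∎
      where
      Y = y + ν k
      swap : ∀ u → y + u + ν k ≈ y + ν k + u
      swap u = solve 3 (λ y u k → y :+ u :+ k := y :+ k :+ u) refl y u (ν k)

    -- The three factors are 1 + 2σ and two whose product is 1 - 2 (1 + σ).
    pair-product : (ι (+ 1) + ι (+ 2) * (z₃ + z₄)) * (ι (+ 1) + ι (+ 2) * (z₁ + z₄)) * (ι (+ 1) + ι (+ 2) * (z₂ + z₄)) ≈ ι (ℤ.- (+ 5))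
    pair-product = begin
      (ι (+ 1) + ι (+ 2) * (z₃ + z₄)) * (ι (+ 1) + ι (+ 2) * (z₁ + z₄)) * (ι (+ 1) + ι (+ 2) * (z₂ + z₄))
        ≈⟨ solve 4 (λ a b c d → (con (+ 1) :+ con (+ 2) :* (c :+ d)) :* (con (+ 1) :+ con (+ 2) :* (a :+ d)) :* (con (+ 1) :+ con (+ 2) :* (b :+ d)) :=
             (con (+ 1) :+ con (+ 2) :* (a :+ d)) :* ((con (+ 1) :+ con (+ 2) :* d) :* (con (+ 1) :+ con (+ 2) :* d :+ con (+ 2) :* (b :+ c)) :+ con (+ 4) :* (b :* c))) refl z₁ z₂ z₃ z₄ ⟩
      (ι (+ 1) + ι (+ 2) * (z₁ + z₄)) * ((ι (+ 1) + ι (+ 2) * z₄) * (ι (+ 1) + ι (+ 2) * z₄ + ι (+ 2) * (z₂ + z₃)) + ι (+ 4) * (z₂ * z₃))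
        ≈⟨ *-cong (+-congˡ (*-congˡ z₁+z₄)) (+-cong (*-congˡ (+-congˡ (*-congˡ z₂+z₃))) (*-congˡ z₂z₃)) ⟩
      (ι (+ 1) + ι (+ 2) * σ) * ((ι (+ 1) + ι (+ 2) * z₄) * (ι (+ 1) + ι (+ 2) * z₄ + ι (+ 2) * (ι ℤ.-1ℤ - σ)) + ι (+ 4) * ι (+ 1))
        ≈⟨ replace σ²+σ≈1 (replace {x = (ι (+ 1) + ι (+ 2) * σ) * ι (+ 4)} z²+1≈σz (solve 2 (λ σ z →
             (con (+ 1) :+ con (+ 2) :* σ) :* ((con (+ 1) :+ con (+ 2) :* (σ :- z)) :* (con (+ 1) :+ con (+ 2) :* (σ :- z) :+ con (+ 2) :* (con ℤ.-1ℤ :- σ)) :+ con (+ 4) :* con (+ 1)) :=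
             con (ℤ.- (+ 5)) :+ (σ :* σ :+ σ :- con (+ 1)) :* con (ℤ.- (+ 4)) :+ (z :* z :+ con (+ 1) :- σ :* z) :* ((con (+ 1) :+ con (+ 2) :* σ) :* con (+ 4))) refl σ z)) ⟩
      ι (ℤ.- (+ 5)) ∎

-- The quotient of R by the annihilator of w.
module Annihilator {c ℓ} (R : CommutativeRing c ℓ)
  (hom : ℤ.+-*-rawRing -Raw-AlmostCommutative⟶ fromCommutativeRing R)
  (w : CommutativeRing.Carrier R) where

  open ℤ-Algebra R hom

  private
    scale : ∀ {x y} → x ≈ y → w * x ≈ w * y
    scale = *-congˡ

  quotient : CommutativeRing c ℓ
  quotient = record
    { Carrier = Carrier
    ; _≈_ = λ x y → w * x ≈ w * y
    ; _+_ = _+_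
    ; _*_ = _*_
    ; -_ = -_
    ; 0# = 0#
    ; 1# = 1#
    ; isCommutativeRing = record
      { isRing = record
        { +-isAbelianGroup = record
          { isGroup = record
            { isMonoid = record
              { isSemigroup = record
                { isMagma = record
                  { isEquivalence = record { refl = refl ; sym = sym ; trans = trans }
                  ; ∙-cong = λ e f → trans (distribˡ w _ _) (trans (+-cong e f) (sym (distribˡ w _ _)))
                  }
                ; assoc = λ x y z → scale (+-assoc x y z)
                }
              ; identity = (λ x → scale (+-identityˡ x)) , (λ x → scale (+-identityʳ x))
              }
            ; inverse = (λ x → scale (-‿inverseˡ x)) , (λ x → scale (-‿inverseʳ x))
            ; ⁻¹-cong = λ {x} {y} e → trans (negate w x) (trans (-‿cong e) (sym (negate w y)))
            }
          ; comm = λ x y → scale (+-comm x y)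
          }
        ; *-cong = λ {x} {y} {u} {v} e f → trans (sym (*-assoc w x u)) (trans (*-congʳ e)
            (trans (rotate w y u) (trans (*-congˡ f) (rotate′ w y v))))
        ; *-assoc = λ x y z → scale (*-assoc x y z)
        ; *-identity = (λ x → scale (*-identityˡ x)) , (λ x → scale (*-identityʳ x))
        ; distrib = (λ x y z → scale (distribˡ x y z)) , (λ x y z → scale (distribʳ x y z))
        }
      ; *-comm = λ x y → scale (*-comm x y)
      }
    }
    where
    negate : ∀ w x → w * - x ≈ - (w * x)
    negate = solve 2 (λ w x → w :* :- x := :- (w :* x)) refl
    rotate : ∀ w y u → w * y * u ≈ y * (w * u)
    rotate = solve 3 (λ w y u → w :* y :* u := y :* (w :* u)) refl
    rotate′ : ∀ w y u → y * (w * u) ≈ w * (y * u)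
    rotate′ = solve 3 (λ w y u → y :* (w :* u) := w :* (y :* u)) refl

  quotient-hom : ℤ.+-*-rawRing -Raw-AlmostCommutative⟶ fromCommutativeRing quotient
  quotient-hom = record
    { ⟦_⟧ = ι
    ; +-homo = λ x y → scale (+-homo x y)
    ; *-homo = λ x y → scale (*-homo x y)
    ; -‿homo = λ x → scale (-‿homo x)
    ; 0-homo = scale 0-homo
    ; 1-homo = scale 1-homo
    }

-- The sum modulo `p⁵`, evaluated in a ring containing fifth roots of unity.

module Evaluation {c ℓ} (R : CommutativeRing c ℓ)
  (hom : ℤ.+-*-rawRing -Raw-AlmostCommutative⟶ fromCommutativeRing R) where

  open ℤ-Algebra R hom
  open Pochhammer R hom
  open Hypergeometric R hom
  open FifthRoots R hom

  -- The parametrisation p = 3j + 2 + s, r = 1 - s, n = (2p - r)/3 = 2j + 1 + s makes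
  -- all bounds on p, r and n statements about natural numbers.
  module At {σ z : Carrier} (σ²+σ≈1 : σ * σ + σ ≈ ι (+ 1)) (z²+1≈σz : z * z + ι (+ 1) ≈ σ * z)
    (j s n p : ℕ) (n≡ : n ≡ suc (j ℕ.+ j ℕ.+ s)) (p≡ : p ≡ suc n ℕ.+ j) (r : ℤ) (r≡ : r ≡ 1ℤ ℤ.- + s)
    (char : ∀ {x y} → x ≡ y [mod + (p ℕ.^ 5) ] → ι x ≈ ι y)
    (third : ℤ) (3*third : + 3 ℤ.* third ≡ 1ℤ [mod + (p ℕ.^ 5) ])
    (inv! : ℕ → ℤ) (k!*inv! : ∀ k → k < p → + (k !) ℤ.* inv! k ≡ 1ℤ [mod + (p ℕ.^ 5) ]) where

    private
      ζ₁ = z₁ σ²+σ≈1 z²+1≈σz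
      ζ₂ = z₂ σ²+σ≈1 z²+1≈σz
      ζ₃ = z₃ σ²+σ≈1 z²+1≈σz
      ζ₄ = z₄ σ²+σ≈1 z²+1≈σz

    aℤ : ℤ
    aℤ = r ℤ.* third

    -- The factor `a + 2k` is a third of `6k + r`; the missing `3` is restored when the integer
    -- congruences are compared.
    summandℤ : ℕ → ℤ
    summandℤ k = (aℤ ℤ.+ + (k ℕ.+ k)) ℤ.* Z.poch aℤ k ℤ.^ 6 ℤ.* inv! k ℤ.^ 6

    -- The terms of the ₄F₃ modulo `p`, after the factor divisible by `p` has been taken out of
    -- three rising factorials of `1 - a`. The `j` factors before it remain, and those after it are
    -- `1, 2, ...` modulo `p`, hence the factorial.
    leadingℤ : ℕ → ℕ → ℤ
    leadingℤ i k = Z.poch aℤ k ℤ.* (Z.poch (1ℤ ℤ.- aℤ) j ℤ.* + ((i ∸ suc j) !)) ℤ.^ 3 ℤ.*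
      (Z.poch (1ℤ ℤ.+ + s ℤ.- + k) k ℤ.* Z.poch (1ℤ ℤ.+ + i) k)

    private
      P a τ x w : Carrier
      P = ν p
      a = ι aℤ
      τ = ι third
      x = ι (+ 2) * P * τ
      w = - x

      ι-eq : ∀ {x y} → x ≡ y → ι x ≈ ι y
      ι-eq e = reflexive (≡.cong ι e)

      P^5≈0 : P ^ 5 ≈ 0#
      P^5≈0 = trans (sym (ι-^ (+ p) 5)) (trans (ι-eq (≡.sym (pos-^ p 5))) (trans (char (Modular.m≡0 ∣.∣-refl)) 0-homo))

      x^5≈0 : x ^ 5 ≈ 0#
      x^5≈0 = trans (solve 3 (λ t P τ → (t :* P :* τ) :^ 5 := P :^ 5 :* (t :* τ) :^ 5) refl (ι (+ 2)) P τ)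
        (trans (*-congʳ P^5≈0) (zeroˡ _))

      w^5≈0 : w ^ 5 ≈ 0#
      w^5≈0 = trans (solve 1 (λ x → (:- x) :^ 5 := x :^ 5 :* con ℤ.-1ℤ) refl x)
        (trans (*-congʳ x^5≈0) (zeroˡ _))

      3τ≈1 : ι (+ 3) * τ ≈ ι (+ 1)
      3τ≈1 = trans (sym (*-homo (+ 3) third)) (char 3*third)

      a≈ : a ≈ (ι (+ 1) - ν s) * τ
      a≈ = trans (*-homo r third) (*-congʳ (trans (ι-eq r≡) (trans (+-homo (+ 1) (ℤ.- + s)) (+-congˡ (-‿homo (+ s))))))

      n≈ : ν n ≈ ι (+ 1) + (ν j + ν j + ν s)
      n≈ = trans (reflexive (≡.cong ν n≡)) (trans (+-homo (+ 1) _) (+-congˡ (trans (ν-+ (j ℕ.+ j) s) (+-congʳ (ν-+ j j)))))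

      P≈ : P ≈ ι (+ 1) + (ι (+ 1) + (ν j + ν j + ν s)) + ν j
      P≈ = trans (reflexive (≡.cong ν p≡)) (trans (ν-+ (suc n) j) (+-congʳ (trans (+-homo (+ 1) (+ n)) (+-congˡ n≈))))

      using-3τ : ∀ {u y} v → u ≈ y + (ι (+ 3) * τ - ι (+ 1)) * v → u ≈ y
      using-3τ {u} {y} v e = begin
        u                                    ≈⟨ e ⟩
        y + (ι (+ 3) * τ - ι (+ 1)) * v      ≈⟨ +-congˡ (*-congʳ (trans (+-congʳ 3τ≈1) (-‿inverseʳ _))) ⟩
        y + 0# * v                           ≈⟨ trans (+-congˡ (zeroˡ v)) (+-identityʳ y) ⟩
        y                                    ∎

      a+n≈x : a + ν n ≈ x
      a+n≈x = trans (+-cong a≈ n≈) (trans (using-3τ (- (ι (+ 1) + (ν j + ν j + ν s)))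
        (solve 3 (λ τ j s → (con (+ 1) :- s) :* τ :+ (con (+ 1) :+ (j :+ j :+ s)) :=
          con (+ 2) :* (con (+ 1) :+ (con (+ 1) :+ (j :+ j :+ s)) :+ j) :* τ :+ (con (+ 3) :* τ :- con (+ 1)) :* (:- (con (+ 1) :+ (j :+ j :+ s)))) refl τ (ν j) (ν s)))
        (*-congʳ (*-congˡ (sym P≈))))

      -- This is `p + r = 3 (j + 1)`; it locates the factor `p/3` in the rising factorials of
      -- `1 - a`.
      1-a+j≈Pτ : 1# - a + ν j ≈ P * τ
      1-a+j≈Pτ = trans (+-congʳ (+-cong (sym 1-homo) (-‿cong a≈))) (trans (using-3τ (- (ι (+ 1) + ν j))
        (solve 3 (λ τ j s → con (+ 1) :- (con (+ 1) :- s) :* τ :+ j :=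
          (con (+ 1) :+ (con (+ 1) :+ (j :+ j :+ s)) :+ j) :* τ :+ (con (+ 3) :* τ :- con (+ 1)) :* (:- (con (+ 1) :+ j))) refl τ (ν j) (ν s)))
        (*-congʳ (sym P≈)))

      upper : Carrier → Carrier
      upper u = a + u * w

      lower : Carrier → Carrier
      lower u = 1# + u * x

      -- `1 + a - upper u - upper v`, the complementary parameter in Bailey's lemma.
      paired : Carrier → Carrier → Carrier
      paired u v = 1# - a + (u + v) * x

      upper+paired : ∀ u v → upper u + paired u v ≈ lower v
      upper+paired u v = solve 5 (λ a x o u v → (a :+ u :* :- x) :+ (o :- a :+ (u :+ v) :* x) := o :+ v :* x) refl a x 1# u v

      upper+paired′ : ∀ u v → upper v + paired u v ≈ lower u
      upper+paired′ u v = solve 5 (λ a x o u v → (a :+ v :* :- x) :+ (o :- a :+ (u :+ v) :* x) := o :+ u :* x) refl a x 1# u v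

      triple : ∀ u v → 1# + a ≈ upper u + upper v + paired u v
      triple u v = solve 5 (λ a x o u v → o :+ a := (a :+ u :* :- x) :+ (a :+ v :* :- x) :+ (o :- a :+ (u :+ v) :* x)) refl a x 1# u v

      -- Only the four primitive roots occur here. The root `1` gives the numerator parameter
      -- `a - x = -n`, which is the one hidden in `binomialSum`.
      b c′ d e q δ g h : Carrier
      b  = upper ζ₁
      c′ = upper ζ₂
      d  = upper ζ₃
      e  = upper ζ₄
      q  = paired ζ₁ ζ₂
      δ  = paired ζ₃ ζ₄
      g  = paired ζ₁ ζ₄
      h  = paired ζ₂ ζ₄

      left right : ℕ → ℕ → Carrier
      left k l = well-poised a k * (poch b k * poch c′ k * (poch (c′ + q + ν k) l * poch (b + q + ν k) l))
        * (poch d k * poch e k * (poch (e + δ + ν k) l * poch (d + δ + ν k) l) * poch (1# + a + ν (k ℕ.+ k ℕ.+ l)) l)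
      right i k = poch e k * poch δ i * poch g i * poch h i * (poch (q + δ + ν i) k * poch (d + δ + ν i) k)

      left≈right : binomialSum n left ≈ a * poch (1# + a) (n ℕ.+ n) * binomialSum n right
      left≈right = transformation a b c′ d e q δ g h refl (triple ζ₁ ζ₂) (triple ζ₃ ζ₄)
        (trans (upper+paired′ ζ₁ ζ₄) (sym (upper+paired′ ζ₁ ζ₂)))
        (trans (upper+paired′ ζ₂ ζ₄) (sym (upper+paired ζ₁ ζ₂))) n

      J : ℕ → Carrier
      J k = ι (inv! k)

      n<p : n < p
      n<p = ≡.subst (n <_) (≡.sym p≡) (ℕ.m≤m+n (suc n) j)

      k!J≈1 : ∀ k → k ≤ n → ν (k !) * J k ≈ 1#
      k!J≈1 k k≤n = trans (sym (*-homo _ _)) (trans (char (k!*inv! k (ℕ.≤-<-trans k≤n n<p))) 1-homo)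

      N : Carrier
      N = ν (n !)

      summand : ℕ → Carrier
      summand k = (a + ν (k ℕ.+ k)) * poch a k ^ 6 * J k ^ 6

      -- With the sign, `(1 + l)_k` is `(-n)_k = (a - x)_k`, the fifth perturbed numerator;
      -- `(1 + a + 2k + l)_l` is `(1 + k + x)_l`, the fifth perturbed denominator. Both groups of
      -- five collapse by `poch-product`, the second to `(n!/k!)⁵`.
      left-term : ∀ k l → k ℕ.+ l ≡ n → poch (1# + ν l) k * (J k * left k l) ≈ N ^ 5 * summand k
      left-term k l k+l≡n = begin
        poch (1# + ν l) k * (J k * left k l)
          ≈⟨ *-congˡ (*-congˡ (*-cong (*-congˡ (*-congˡ (*-cong (down (upper+paired′ ζ₁ ζ₂)) (down (upper+paired ζ₁ ζ₂)))))
               (*-cong (*-congˡ (*-cong (down (upper+paired′ ζ₃ ζ₄)) (down (upper+paired ζ₃ ζ₄)))) (poch-cong l last)))) ⟩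
        poch (1# + ν l) k * (J k * (sign k * (a + ν (k ℕ.+ k)) * poch a k * (poch b k * poch c′ k * (L ζ₁ * L ζ₂))
          * (poch d k * poch e k * (L ζ₃ * L ζ₄) * poch (1# + ν k + x) l)))
          ≈⟨ solve 14 (λ T J s y A B₁ B₂ B₃ B₄ L₁ L₂ L₃ L₄ L₀ →
               T :* (J :* (s :* y :* A :* (B₁ :* B₂ :* (L₁ :* L₂)) :* (B₃ :* B₄ :* (L₃ :* L₄) :* L₀))) :=
               J :* y :* A :* (B₁ :* B₂ :* (B₃ :* B₄) :* (s :* T)) :* (L₁ :* L₂ :* (L₃ :* L₄) :* L₀)) refl
               (poch (1# + ν l) k) (J k) (sign k) (a + ν (k ℕ.+ k)) (poch a k) (poch b k) (poch c′ k) (poch d k) (poch e k) (L ζ₁) (L ζ₂) (L ζ₃) (L ζ₄) (poch (1# + ν k + x) l) ⟩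
        J k * (a + ν (k ℕ.+ k)) * poch a k * (poch b k * poch c′ k * (poch d k * poch e k) * (sign k * poch (1# + ν l) k))
          * (L ζ₁ * L ζ₂ * (L ζ₃ * L ζ₄) * poch (1# + ν k + x) l)
          ≈⟨ *-cong (*-congˡ (trans (*-congˡ (sym (poch-reverse k reversed))) (poch-product σ²+σ≈1 z²+1≈σz a w w^5≈0 k)))
               (poch-product σ²+σ≈1 z²+1≈σz (1# + ν k) x x^5≈0 l) ⟩
        J k * (a + ν (k ℕ.+ k)) * poch a k * poch a k ^ 5 * poch (1# + ν k) l ^ 5
          ≈⟨ *-congˡ (^-cong 5 tail-factorial) ⟩
        J k * (a + ν (k ℕ.+ k)) * poch a k * poch a k ^ 5 * (N * J k) ^ 5
          ≈⟨ solve 4 (λ J y A N → J :* y :* A :* A :^ 5 :* (N :* J) :^ 5 := N :^ 5 :* (y :* A :^ 6 :* J :^ 6)) refl (J k) (a + ν (k ℕ.+ k)) (poch a k) N ⟩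
        N ^ 5 * summand k ∎
        where
        L : Carrier → Carrier
        L u = poch (1# + ν k + u * x) l
        k+l≈n : ν k + ν l ≈ ν n
        k+l≈n = trans (sym (ν-+ k l)) (reflexive (≡.cong ν k+l≡n))
        swap : ∀ u v y → u + v + y ≈ u + y + v
        swap = solve 3 (λ u v y → u :+ v :+ y := u :+ y :+ v) refl
        down : ∀ {u v} → u ≈ lower v → poch (u + ν k) l ≈ L v
        down {v = v} u≈ = poch-cong l (trans (+-congʳ u≈) (swap 1# (v * x) (ν k)))
        last : 1# + a + ν (k ℕ.+ k ℕ.+ l) ≈ 1# + ν k + x
        last = begin
          1# + a + ν (k ℕ.+ k ℕ.+ l)      ≈⟨ +-congˡ (trans (ν-+ (k ℕ.+ k) l) (trans (+-congʳ (ν-+ k k)) (+-assoc _ _ _))) ⟩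
          1# + a + (ν k + (ν k + ν l))    ≈⟨ +-congˡ (+-congˡ k+l≈n) ⟩
          1# + a + (ν k + ν n)            ≈⟨ solve 4 (λ o a k n → o :+ a :+ (k :+ n) := o :+ k :+ (a :+ n)) refl 1# a (ν k) (ν n) ⟩
          1# + ν k + (a + ν n)            ≈⟨ +-congˡ a+n≈x ⟩
          1# + ν k + x                    ∎
        reversed : 1# + ν l + (a + w) + ν k ≈ 1#
        reversed = begin
          1# + ν l + (a - x) + ν k        ≈⟨ solve 5 (λ o l a x k → o :+ l :+ (a :- x) :+ k := o :+ (a :+ (k :+ l) :- x)) refl 1# (ν l) a x (ν k) ⟩
          1# + (a + (ν k + ν l) - x)      ≈⟨ +-congˡ (+-congʳ (trans (+-congˡ k+l≈n) a+n≈x)) ⟩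
          1# + (x - x)                    ≈⟨ trans (+-congˡ (-‿inverseʳ x)) (+-identityʳ 1#) ⟩
          1#                              ∎
        tail-factorial : poch (1# + ν k) l ≈ N * J k
        tail-factorial = begin
          poch (1# + ν k) l                          ≈⟨ trans (sym (*-identityˡ _)) (*-congʳ (sym (k!J≈1 k (ℕ.m+n≤o⇒m≤o k (ℕ.≤-reflexive k+l≡n))))) ⟩
          ν (k !) * J k * poch (1# + ν k) l          ≈⟨ solve 3 (λ u v y → u :* v :* y := u :* y :* v) refl _ _ _ ⟩
          ν (k !) * poch (1# + ν k) l * J k          ≈⟨ *-congʳ (*-congʳ (poch-1 k)) ⟨
          poch 1# k * poch (1# + ν k) l * J k        ≈⟨ *-congʳ (poch-+ k l refl) ⟨
          poch 1# (k ℕ.+ l) * J k                    ≈⟨ *-congʳ (trans (poch-≡ refl k+l≡n) (poch-1 n)) ⟩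
          N * J k                                    ∎

      left-sum : binomialSum n left ≈ N ^ 5 * rangeSum p summand
      left-sum = begin
        binomialSum n left
          ≈⟨ binomialSum-cong n {g = λ k l → ν (k !) * (J k * left k l)} (λ k l k+l≡n → sym (trans (sym (*-assoc _ _ _))
               (trans (*-congʳ (k!J≈1 k (ℕ.m+n≤o⇒m≤o k (ℕ.≤-reflexive k+l≡n)))) (*-identityˡ _)))) ⟩
        binomialSum n (λ k l → ν (k !) * (J k * left k l))
          ≈⟨ binomialSum-factorial n (λ k l → J k * left k l) ⟩
        antidiagonalSum n (λ k l → poch (1# + ν l) k * (J k * left k l))
          ≈⟨ antidiagonalSum-cong n left-term ⟩
        antidiagonalSum n (λ k l → N ^ 5 * summand k)
          ≈⟨ trans (antidiagonalSum-*ˡ n (N ^ 5) (λ k _ → summand k)) (*-congˡ (antidiagonalSum-rangeSum n summand)) ⟩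
        N ^ 5 * rangeSum (suc n) summand
          ≈⟨ *-congˡ (trans (reflexive (≡.cong (λ l → rangeSum l summand) p≡)) (rangeSum-truncate (suc n) j summand vanish)) ⟨
        N ^ 5 * rangeSum p summand ∎
        where
        -- For `k > n` the rising factorial contains `a + n = x`, and its sixth power is a multiple
        -- of `x⁵ = 0`.
        vanish : ∀ k → suc n ≤ k → summand k ≈ 0#
        vanish k n<k with ℕ.m≤n⇒∃[o]m+o≡n n<k
        ... | m , ≡.refl = begin
          (a + ν (k ℕ.+ k)) * poch a k ^ 6 * J k ^ 6
            ≈⟨ solve 3 (λ y A J → y :* A :^ 6 :* J :^ 6 := A :* (A :* A :^ 4) :* (y :* J :^ 6)) refl (a + ν (k ℕ.+ k)) (poch a k) (J k) ⟩
          poch a k * (poch a k * poch a k ^ 4) * (y * J k ^ 6)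
            ≈⟨ *-congʳ (*-cong A≈ (*-cong A≈ (*-cong A≈ (*-cong A≈ (*-cong A≈ (*-cong A≈ refl)))))) ⟩
          (A * x * B) * ((A * x * B) * (A * x * B) ^ 4) * (y * J k ^ 6)
            ≈⟨ solve 4 (λ A x B Y → (A :* x :* B) :* ((A :* x :* B) :* (A :* x :* B) :^ 4) :* Y := x :^ 5 :* (x :* A :^ 6 :* B :^ 6 :* Y)) refl A x B (y * J k ^ 6) ⟩
          x ^ 5 * (x * A ^ 6 * B ^ 6 * (y * J k ^ 6))
            ≈⟨ trans (*-congʳ x^5≈0) (zeroˡ _) ⟩
          0# ∎
          where
          y = a + ν (k ℕ.+ k)
          A = poch a n
          B = poch (a + ν (suc n)) m
          A≈ : poch a k ≈ A * x * B
          A≈ = trans (poch-+ (suc n) m refl) (*-congʳ (*-congˡ a+n≈x))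

      -- For `j < i`, the rising factorial of length `i` without its factor number `j`.
      U : Carrier → Carrier → ℕ → Carrier
      U u v i = poch (paired u v) j * poch (paired u v + ν (suc j)) (i ∸ suc j)

      -- The falling factorial `s (s - 1) ... (s - k + 1)`, which is `(r - 1)_k` up to sign.
      falling : ℕ → Carrier
      falling k = poch (1# + ν s - ν k) k

      core : ℕ → ℕ → Carrier
      core i k = poch e k * (U ζ₃ ζ₄ i * U ζ₁ ζ₄ i * U ζ₂ ζ₄ i) * (falling k * poch (lower ζ₄ + ν i) k)

      -- The j-th factor of the rising factorial is 1 - a + j + (u + v) x = (p/3) (1 + 2 (u + v)).
      p-part : ∀ u v i → j < i → poch (paired u v) i ≈ P * τ * (ι (+ 1) + ι (+ 2) * (u + v)) * U u v i
      p-part u v i j<i = begin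
        poch y i                                              ≈⟨ poch-≡ refl (≡.sym (ℕ.m+[n∸m]≡n j<i)) ⟩
        poch y (suc j ℕ.+ (i ∸ suc j))                        ≈⟨ poch-+ (suc j) (i ∸ suc j) refl ⟩
        poch y j * (y + ν j) * poch (y + ν (suc j)) (i ∸ suc j)
          ≈⟨ *-congʳ (*-congˡ factor) ⟩
        poch y j * (P * τ * (ι (+ 1) + ι (+ 2) * (u + v))) * poch (y + ν (suc j)) (i ∸ suc j)
          ≈⟨ solve 3 (λ A B C → A :* B :* C := B :* (A :* C)) refl _ _ _ ⟩
        P * τ * (ι (+ 1) + ι (+ 2) * (u + v)) * U u v i ∎
        where
        y = paired u v
        factor : y + ν j ≈ P * τ * (ι (+ 1) + ι (+ 2) * (u + v))
        factor = begin
          1# - a + (u + v) * x + ν j      ≈⟨ solve 3 (λ b y j → b :+ y :+ j := b :+ j :+ y) refl (1# - a) ((u + v) * x) (ν j) ⟩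
          1# - a + ν j + (u + v) * x      ≈⟨ +-congʳ 1-a+j≈Pτ ⟩
          P * τ + (u + v) * (ι (+ 2) * P * τ)
            ≈⟨ solve 3 (λ P τ u → P :* τ :+ u :* (con (+ 2) :* P :* τ) := P :* τ :* (con (+ 1) :+ con (+ 2) :* u)) refl P τ (u + v) ⟩
          P * τ * (ι (+ 1) + ι (+ 2) * (u + v)) ∎

      -- The primitive roots sum to `-1`, so the left side is `2 - 2a - x + i`. Then `x = a + n` and
      -- `3a = r = 1 - s` remove everything but `s` and `k`.
      falling-argument : ∀ i k → i ℕ.+ k ≡ n → q + δ + ν i ≈ 1# + ν s - ν k
      falling-argument i k i+k≡n = begin
        q + δ + ν i
          ≈⟨ solve 9 (λ o a x u v y z i k → (o :- a :+ (u :+ v) :* x) :+ (o :- a :+ (y :+ z) :* x) :+ i :=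
               (o :- a) :+ (o :- a) :+ (u :+ v :+ (y :+ z)) :* x :+ (i :+ k) :- k) refl 1# a x ζ₁ ζ₂ ζ₃ ζ₄ (ν i) (ν k) ⟩
        (1# - a) + (1# - a) + (ζ₁ + ζ₂ + (ζ₃ + ζ₄)) * x + (ν i + ν k) - ν k
          ≈⟨ +-congʳ (+-cong (+-cong (+-cong (+-congʳ (sym 1-homo)) (+-congʳ (sym 1-homo))) (*-cong (z-sum σ²+σ≈1 z²+1≈σz) (sym a+n≈x)))
               (trans (sym (ν-+ i k)) (reflexive (≡.cong ν i+k≡n)))) ⟩
        (ι (+ 1) - a) + (ι (+ 1) - a) + ι ℤ.-1ℤ * (a + ν n) + ν n - ν k
          ≈⟨ +-congʳ (trans (solve 2 (λ a n → (con (+ 1) :- a) :+ (con (+ 1) :- a) :+ con ℤ.-1ℤ :* (a :+ n) :+ n := con (+ 2) :- con (+ 3) :* a) refl a (ν n))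
               (trans (+-congˡ (-‿cong (*-congˡ a≈))) (using-3τ (ν s - ι (+ 1)) (solve 2 (λ s τ → con (+ 2) :- con (+ 3) :* ((con (+ 1) :- s) :* τ) :=
                 (con (+ 1) :+ s) :+ (con (+ 3) :* τ :- con (+ 1)) :* (s :- con (+ 1))) refl (ν s) τ)))) ⟩
        ι (+ 1) + ν s - ν k
          ≈⟨ +-congʳ (+-congʳ 1-homo) ⟩
        1# + ν s - ν k ∎

      constant : Carrier
      constant = τ ^ 3 * ι (ℤ.- (+ 5))

      -- For `i ≤ j` the rising factorials do not reach the factor with `p`; but then `k > s`, so
      -- `falling k` annihilates both sides.
      right-term : ∀ i k → i ℕ.+ k ≡ n → right i k ≈ P ^ 3 * constant * core i k
      right-term i k i+k≡n = trans
        (*-congˡ (*-cong (poch-cong k (falling-argument i k i+k≡n)) (poch-cong k (+-congʳ (upper+paired ζ₃ ζ₄)))))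
        (split (ℕ.≤-<-connex i j))
        where
        open import Data.Sum using (_⊎_)
        D = poch (lower ζ₄ + ν i) k
        k-large : i ≤ j → s < k
        k-large i≤j = ℕ.≮⇒≥ λ k<1+s → ℕ.<-irrefl i+k≡n
          (≡.subst (i ℕ.+ k <_) (≡.sym n≡) (s≤s (ℕ.≤-trans (ℕ.+-mono-≤ i≤j (ℕ.≤-pred k<1+s)) (ℕ.+-monoˡ-≤ s (ℕ.m≤m+n j j)))))
        split : i ≤ j ⊎ j < i → poch e k * poch δ i * poch g i * poch h i * (falling k * D) ≈ P ^ 3 * constant * core i k
        split (inj₁ i≤j) = trans (*-congˡ (trans (*-congʳ zero′) (zeroˡ D))) (trans (zeroʳ _)
            (sym (trans (*-congˡ (trans (*-congˡ (trans (*-congʳ zero′) (zeroˡ D))) (zeroʳ _))) (zeroʳ _))))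
          where
          zero′ : falling k ≈ 0#
          zero′ = poch-ν-vanish s (k-large i≤j) (solve 2 (λ y k → y :- k :+ k := y) refl (1# + ν s) (ν k))
        split (inj₂ j<i) = begin
          poch e k * poch δ i * poch g i * poch h i * (falling k * D)
            ≈⟨ *-congʳ (*-cong (*-cong (*-congˡ (p-part ζ₃ ζ₄ i j<i)) (p-part ζ₁ ζ₄ i j<i)) (p-part ζ₂ ζ₄ i j<i)) ⟩
          poch e k * (P * τ * r₃ * U ζ₃ ζ₄ i) * (P * τ * r₁ * U ζ₁ ζ₄ i) * (P * τ * r₂ * U ζ₂ ζ₄ i) * (falling k * D)
            ≈⟨ solve 10 (λ E P τ r₃ r₁ r₂ U₃ U₁ U₂ Y → E :* (P :* τ :* r₃ :* U₃) :* (P :* τ :* r₁ :* U₁) :* (P :* τ :* r₂ :* U₂) :* Y :=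
                 P :^ 3 :* (τ :^ 3 :* (r₃ :* r₁ :* r₂)) :* (E :* (U₃ :* U₁ :* U₂) :* Y)) refl
                 (poch e k) P τ r₃ r₁ r₂ (U ζ₃ ζ₄ i) (U ζ₁ ζ₄ i) (U ζ₂ ζ₄ i) (falling k * D) ⟩
          P ^ 3 * (τ ^ 3 * (r₃ * r₁ * r₂)) * core i k
            ≈⟨ *-congʳ (*-congˡ (*-congˡ (pair-product σ²+σ≈1 z²+1≈σz))) ⟩
          P ^ 3 * constant * core i k ∎
          where
          r₃ = ι (+ 1) + ι (+ 2) * (ζ₃ + ζ₄)
          r₁ = ι (+ 1) + ι (+ 2) * (ζ₁ + ζ₄)
          r₂ = ι (+ 1) + ι (+ 2) * (ζ₂ + ζ₄)

      -- `-10/81`, the product of `2/3` from the prefactor and `-5/27` from the three rising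
      -- factorials.
      κ : Carrier
      κ = ι (ℤ.- (+ 10)) * τ ^ 4

      right-sum : a * poch (1# + a) (n ℕ.+ n) * binomialSum n right ≈
        P ^ 4 * (κ * (poch a n * poch (x + 1#) n * binomialSum n core))
      right-sum = begin
        a * poch (1# + a) (n ℕ.+ n) * binomialSum n right
          ≈⟨ *-cong prefactor (trans (binomialSum-cong n right-term) (binomialSum-*ˡ n (P ^ 3 * constant) core)) ⟩
        poch a n * (x * poch (x + 1#) n) * (P ^ 3 * constant * binomialSum n core)
          ≈⟨ solve 5 (λ A P τ X C → A :* ((con (+ 2) :* P :* τ) :* X) :* (P :^ 3 :* (τ :^ 3 :* con (ℤ.- (+ 5))) :* C) :=
               P :^ 4 :* ((con (ℤ.- (+ 10)) :* τ :^ 4) :* (A :* X :* C))) refl (poch a n) P τ (poch (x + 1#) n) (binomialSum n core) ⟩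
        P ^ 4 * (κ * (poch a n * poch (x + 1#) n * binomialSum n core)) ∎
        where
        -- The whole product is `(a)_k` with `k = 2n + 1`, cut at its middle factor `a + n = x`.
        prefactor : a * poch (1# + a) (n ℕ.+ n) ≈ poch a n * (x * poch (x + 1#) n)
        prefactor = begin
          a * poch (1# + a) (n ℕ.+ n)             ≈⟨ poch-suc (n ℕ.+ n) (+-comm 1# a) ⟨
          poch a (suc (n ℕ.+ n))                  ≈⟨ poch-≡ refl (≡.sym (ℕ.+-suc n n)) ⟩
          poch a (n ℕ.+ suc n)                    ≈⟨ poch-+ n (suc n) refl ⟩
          poch a n * poch (a + ν n) (suc n)       ≈⟨ *-congˡ (trans (poch-cong (suc n) a+n≈x) (poch-suc n refl)) ⟩
          poch a n * (x * poch (x + 1#) n)        ∎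

      -- Everything multiplied by p⁴ may be computed modulo p.
      module W where
        open Annihilator R hom (P ^ 4) public
        open Pochhammer quotient quotient-hom public
        open ℤ-Algebra quotient quotient-hom public

      open W using () renaming (_≈_ to _≋_)

      P≋0 : P ≋ 0#
      P≋0 = trans (solve 1 (λ P → P :^ 4 :* P := P :^ 5) refl P) (trans P^5≈0 (sym (zeroʳ _)))

      x≋0 : x ≋ 0#
      x≋0 = W.trans (W.*-congʳ (W.trans (W.*-congˡ P≋0) (W.zeroʳ _))) (W.zeroˡ _)

      drop : ∀ {y} u → y + u * x ≋ y
      drop u = W.trans (W.+-congˡ (W.trans (W.*-congˡ x≋0) (W.zeroʳ u))) (W.+-identityʳ _)

      reduced : ℕ → ℕ → Carrier
      reduced i k = poch a k * (poch (1# - a) j * ν ((i ∸ suc j) !)) ^ 3 * (falling k * poch (1# + ν i) k)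

      U≋ : ∀ u v i → U u v i ≋ poch (1# - a) j * ν ((i ∸ suc j) !)
      U≋ u v i = W.*-cong (W.poch-cong j (drop (u + v)))
        (W.trans (W.poch-cong (i ∸ suc j) offset) (W.poch-1 (i ∸ suc j)))
        where
        -- The factor number `j` is `0` modulo `p`, so the next one is `1` and the rest of the
        -- product is a factorial.
        offset : paired u v + ν (suc j) ≋ 1#
        offset = W.trans (W.+-cong (drop (u + v)) (W.ν-suc j))
          (W.trans (*-congˡ (solve 3 (λ a o j → (o :- a) :+ (o :+ j) := o :- a :+ j :+ o) refl a 1# (ν j)))
            (W.trans (W.+-congʳ (W.trans (*-congˡ 1-a+j≈Pτ) (W.trans (W.*-congʳ P≋0) (W.zeroˡ τ)))) (W.+-identityˡ 1#)))

      core≋ : ∀ i k → core i k ≋ reduced i k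
      core≋ i k = W.*-cong (W.*-cong (W.poch-cong k (W.trans (*-congˡ (+-congˡ (move ζ₄ x))) (drop (- ζ₄))))
        (W.trans (W.*-cong (W.*-cong (U≋ ζ₃ ζ₄ i) (U≋ ζ₁ ζ₄ i)) (U≋ ζ₂ ζ₄ i)) (*-congˡ (solve 1 (λ y → y :* y :* y := y :^ 3) refl _))))
        (W.*-congˡ (W.poch-cong k (W.+-congʳ (drop ζ₄))))
        where
        move : ∀ u x → u * - x ≈ - u * x
        move = solve 2 (λ u x → u :* :- x := :- u :* x) refl

      sum≋ : κ * (poch a n * poch (x + 1#) n * binomialSum n core) ≋ κ * (poch a n * N * binomialSum n reduced)
      sum≋ = W.*-congˡ (W.*-cong (W.*-congˡ (W.trans (W.poch-cong n (W.trans (W.+-congʳ x≋0) (W.+-identityˡ 1#))) (W.poch-1 n)))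
        (W.binomialSum-cong n λ i k _ → core≋ i k))

    sumℤ : ℤ
    sumℤ = ℤ.- (+ 10) ℤ.* third ℤ.^ 4 ℤ.* (Z.poch aℤ n ℤ.* + (n !) ℤ.* Z.binomialSum n leadingℤ)

    -- Both sides are images of integers: `ζ` has disappeared, so the equality can be pulled back to
    -- `ℤ/p⁵`.
    evaluation : ι ((+ (n !)) ℤ.^ 5 ℤ.* Z.rangeSum p summandℤ) ≈ ι ((+ p) ℤ.^ 4 ℤ.* sumℤ)
    evaluation = begin
      ι ((+ (n !)) ℤ.^ 5 ℤ.* Z.rangeSum p summandℤ)
        ≈⟨ trans (*-homo _ _) (*-cong (ι-^ (+ (n !)) 5) (trans (ι-rangeSum p summandℤ) (rangeSum-cong p λ k _ → ι-summand k))) ⟩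
      N ^ 5 * rangeSum p summand
        ≈⟨ trans (sym left-sum) (trans left≈right (trans right-sum sum≋)) ⟩
      P ^ 4 * (κ * (poch a n * N * binomialSum n reduced))
        ≈⟨ trans (*-homo _ _) (*-cong (ι-^ (+ p) 4) (trans (*-homo _ _) (*-cong (trans (*-homo _ _) (*-congˡ (ι-^ third 4)))
             (trans (*-homo _ _) (*-cong (trans (*-homo _ _) (*-congʳ (ι-poch aℤ n))) (trans (ι-binomialSum n leadingℤ) (binomialSum-cong n λ i k _ → ι-leading i k))))))) ⟨
      ι ((+ p) ℤ.^ 4 ℤ.* sumℤ) ∎
      where
      ι-summand : ∀ k → ι (summandℤ k) ≈ summand k
      ι-summand k = trans (*-homo _ _) (*-cong (trans (*-homo _ _) (*-cong (+-homo _ _) (trans (ι-^ _ 6) (^-cong 6 (ι-poch aℤ k))))) (ι-^ _ 6))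
      ι-leading : ∀ i k → ι (leadingℤ i k) ≈ reduced i k
      ι-leading i k = trans (*-homo _ _) (*-cong
        (trans (*-homo _ _) (*-cong (ι-poch aℤ k) (trans (ι-^ _ 3) (^-cong 3 (trans (*-homo _ _) (*-congʳ (trans (ι-poch _ j) (poch-cong j (trans (+-homo _ _) (+-cong 1-homo (-‿homo aℤ)))))))))))
        (trans (*-homo _ _) (*-cong (trans (ι-poch _ k) (poch-cong k (trans (+-homo _ _) (+-cong (trans (+-homo _ _) (+-congʳ 1-homo)) (-‿homo (+ k))))))
          (trans (ι-poch _ k) (poch-cong k (trans (+-homo _ _) (+-congʳ 1-homo)))))))

-- The rings `ℤ/m` and `ℤ/m` with `ζ` adjoined.

module _ (m : ℤ) where
  open Modular {m}

  ℤ/ : CommutativeRing 0ℓ 0ℓ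
  ℤ/ = record
    { Carrier = ℤ
    ; _≈_ = λ x y → x ≡ y [mod m ]
    ; _+_ = ℤ._+_
    ; _*_ = ℤ._*_
    ; -_ = ℤ.-_
    ; 0# = ℤ.0ℤ
    ; 1# = 1ℤ
    ; isCommutativeRing = record
      { isRing = record
        { +-isAbelianGroup = record
          { isGroup = record
            { isMonoid = record
              { isSemigroup = record
                { isMagma = record
                  { isEquivalence = record { refl = mod-refl ; sym = mod-sym ; trans = mod-trans }
                  ; ∙-cong = mod-+
                  }
                ; assoc = λ x y z → mod-reflexive (ℤ.+-assoc x y z)
                }
              ; identity = (λ x → mod-reflexive (ℤ.+-identityˡ x)) , (λ x → mod-reflexive (ℤ.+-identityʳ x))
              }
            ; inverse = (λ x → mod-reflexive (ℤ.+-inverseˡ x)) , (λ x → mod-reflexive (ℤ.+-inverseʳ x))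
            ; ⁻¹-cong = mod-neg
            }
          ; comm = λ x y → mod-reflexive (ℤ.+-comm x y)
          }
        ; *-cong = mod-*
        ; *-assoc = λ x y z → mod-reflexive (ℤ.*-assoc x y z)
        ; *-identity = (λ x → mod-reflexive (ℤ.*-identityˡ x)) , (λ x → mod-reflexive (ℤ.*-identityʳ x))
        ; distrib = (λ x y z → mod-reflexive (ℤ.*-distribˡ-+ x y z)) , (λ x y z → mod-reflexive (ℤ.*-distribʳ-+ x y z))
        }
      ; *-comm = λ x y → mod-reflexive (ℤ.*-comm x y)
      }
    }

  ℤ/-hom : ℤ.+-*-rawRing -Raw-AlmostCommutative⟶ fromCommutativeRing ℤ/
  ℤ/-hom = record
    { ⟦_⟧ = λ x → x
    ; +-homo = λ _ _ → mod-refl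
    ; *-homo = λ _ _ → mod-refl
    ; -‿homo = λ _ → mod-refl
    ; 0-homo = mod-refl
    ; 1-homo = mod-refl
    }

-- R[θ] / (θ² - uθ - v), with (x , y) standing for x + yθ.
module Quadratic {c ℓ} (R : CommutativeRing c ℓ)
  (hom : ℤ.+-*-rawRing -Raw-AlmostCommutative⟶ fromCommutativeRing R)
  (u v : CommutativeRing.Carrier R) where

  open ℤ-Algebra R hom

  extension : CommutativeRing c ℓ
  extension = record
    { Carrier = Carrier × Carrier
    ; _≈_ = λ (x , y) (x′ , y′) → x ≈ x′ × y ≈ y′
    ; _+_ = λ (x , y) (x′ , y′) → x + x′ , y + y′
    ; _*_ = λ (x , y) (x′ , y′) → x * x′ + v * (y * y′) , x * y′ + y * x′ + u * (y * y′)
    ; -_ = λ (x , y) → - x , - y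
    ; 0# = 0# , 0#
    ; 1# = 1# , 0#
    ; isCommutativeRing = record
      { isRing = record
        { +-isAbelianGroup = record
          { isGroup = record
            { isMonoid = record
              { isSemigroup = record
                { isMagma = record
                  { isEquivalence = record
                    { refl = refl , refl
                    ; sym = λ (e , f) → sym e , sym f
                    ; trans = λ (e , f) (e′ , f′) → trans e e′ , trans f f′
                    }
                  ; ∙-cong = λ (e , f) (e′ , f′) → +-cong e e′ , +-cong f f′
                  }
                ; assoc = λ (x , y) (x′ , y′) (x″ , y″) → +-assoc x x′ x″ , +-assoc y y′ y″
                }
              ; identity = (λ (x , y) → +-identityˡ x , +-identityˡ y) , (λ (x , y) → +-identityʳ x , +-identityʳ y)
              }
            ; inverse = (λ (x , y) → -‿inverseˡ x , -‿inverseˡ y) , (λ (x , y) → -‿inverseʳ x , -‿inverseʳ y)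
            ; ⁻¹-cong = λ (e , f) → -‿cong e , -‿cong f
            }
          ; comm = λ (x , y) (x′ , y′) → +-comm x x′ , +-comm y y′
          }
        ; *-cong = λ (e , f) (e′ , f′) → +-cong (*-cong e e′) (*-congˡ (*-cong f f′))
            , +-cong (+-cong (*-cong e f′) (*-cong f e′)) (*-congˡ (*-cong f f′))
        ; *-assoc = λ (x , y) (x′ , y′) (x″ , y″) → assoc₁ x y x′ y′ x″ y″ u v , assoc₂ x y x′ y′ x″ y″ u v
        ; *-identity = (λ (x , y) → identityˡ x y , identityˡ′ x y)
            , (λ (x , y) → trans (commute₁ x y 1# 0#) (identityˡ x y) , trans (commute₂ x y 1# 0#) (identityˡ′ x y))
        ; distrib = (λ (x , y) (x′ , y′) (x″ , y″) → distrib₁ x y x′ y′ x″ y″ v , distrib₂ x y x′ y′ x″ y″ u)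
            , (λ (x , y) (x′ , y′) (x″ , y″) →
                trans (commute₁ _ _ x y) (trans (distrib₁ x y x′ y′ x″ y″ v) (+-cong (commute₁ x y x′ y′) (commute₁ x y x″ y″)))
              , trans (commute₂ _ _ x y) (trans (distrib₂ x y x′ y′ x″ y″ u) (+-cong (commute₂ x y x′ y′) (commute₂ x y x″ y″))))
        }
      ; *-comm = λ (x , y) (x′ , y′) → commute₁ x y x′ y′ , commute₂ x y x′ y′
      }
    }
    where
    commute₁ : ∀ x y x′ y′ → x * x′ + v * (y * y′) ≈ x′ * x + v * (y′ * y)
    commute₁ x y x′ y′ = +-cong (*-comm x x′) (*-congˡ (*-comm y y′))
    commute₂ : ∀ x y x′ y′ → x * y′ + y * x′ + u * (y * y′) ≈ x′ * y + y′ * x + u * (y′ * y)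
    commute₂ x y x′ y′ = solve 5 (λ x y x′ y′ u → x :* y′ :+ y :* x′ :+ u :* (y :* y′) := x′ :* y :+ y′ :* x :+ u :* (y′ :* y)) refl x y x′ y′ u
    assoc₁ : ∀ x y x′ y′ x″ y″ u v →
      (x * x′ + v * (y * y′)) * x″ + v * ((x * y′ + y * x′ + u * (y * y′)) * y″) ≈
      x * (x′ * x″ + v * (y′ * y″)) + v * (y * (x′ * y″ + y′ * x″ + u * (y′ * y″)))
    assoc₁ = solve 8 (λ x y x′ y′ x″ y″ u v →
      (x :* x′ :+ v :* (y :* y′)) :* x″ :+ v :* ((x :* y′ :+ y :* x′ :+ u :* (y :* y′)) :* y″) :=
      x :* (x′ :* x″ :+ v :* (y′ :* y″)) :+ v :* (y :* (x′ :* y″ :+ y′ :* x″ :+ u :* (y′ :* y″)))) refl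
    assoc₂ : ∀ x y x′ y′ x″ y″ u v →
      (x * x′ + v * (y * y′)) * y″ + (x * y′ + y * x′ + u * (y * y′)) * x″ + u * ((x * y′ + y * x′ + u * (y * y′)) * y″) ≈
      x * (x′ * y″ + y′ * x″ + u * (y′ * y″)) + y * (x′ * x″ + v * (y′ * y″)) + u * (y * (x′ * y″ + y′ * x″ + u * (y′ * y″)))
    assoc₂ = solve 8 (λ x y x′ y′ x″ y″ u v →
      (x :* x′ :+ v :* (y :* y′)) :* y″ :+ (x :* y′ :+ y :* x′ :+ u :* (y :* y′)) :* x″ :+ u :* ((x :* y′ :+ y :* x′ :+ u :* (y :* y′)) :* y″) :=
      x :* (x′ :* y″ :+ y′ :* x″ :+ u :* (y′ :* y″)) :+ y :* (x′ :* x″ :+ v :* (y′ :* y″)) :+ u :* (y :* (x′ :* y″ :+ y′ :* x″ :+ u :* (y′ :* y″)))) refl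
    distrib₁ : ∀ x y x′ y′ x″ y″ v → x * (x′ + x″) + v * (y * (y′ + y″)) ≈ (x * x′ + v * (y * y′)) + (x * x″ + v * (y * y″))
    distrib₁ = solve 7 (λ x y x′ y′ x″ y″ v → x :* (x′ :+ x″) :+ v :* (y :* (y′ :+ y″)) := (x :* x′ :+ v :* (y :* y′)) :+ (x :* x″ :+ v :* (y :* y″))) refl
    distrib₂ : ∀ x y x′ y′ x″ y″ u → x * (y′ + y″) + y * (x′ + x″) + u * (y * (y′ + y″)) ≈
      (x * y′ + y * x′ + u * (y * y′)) + (x * y″ + y * x″ + u * (y * y″))
    distrib₂ = solve 7 (λ x y x′ y′ x″ y″ u → x :* (y′ :+ y″) :+ y :* (x′ :+ x″) :+ u :* (y :* (y′ :+ y″)) :=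
      (x :* y′ :+ y :* x′ :+ u :* (y :* y′)) :+ (x :* y″ :+ y :* x″ :+ u :* (y :* y″))) refl
    identityˡ : ∀ x y → 1# * x + v * (0# * y) ≈ x
    identityˡ x y = trans (+-cong (*-identityˡ x) (trans (*-congˡ (zeroˡ y)) (zeroʳ v))) (+-identityʳ x)
    identityˡ′ : ∀ x y → 1# * y + 0# * x + u * (0# * y) ≈ y
    identityˡ′ x y = trans (+-cong (trans (+-cong (*-identityˡ y) (zeroˡ x)) (+-identityʳ y)) (trans (*-congˡ (zeroˡ y)) (zeroʳ u))) (+-identityʳ y)

  private module E = CommutativeRing extension

  extension-hom : ℤ.+-*-rawRing -Raw-AlmostCommutative⟶ fromCommutativeRing extension
  extension-hom = record
    { ⟦_⟧ = λ i → ι i , 0#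
    ; +-homo = λ i j → +-homo i j , sym (+-identityˡ 0#)
    ; *-homo = λ i j → sym (trans (+-cong (sym (*-homo i j)) (trans (*-congˡ (zeroˡ 0#)) (zeroʳ v))) (+-identityʳ _))
                     , sym (trans (+-cong (trans (+-cong (zeroʳ (ι i)) (zeroˡ (ι j))) (+-identityˡ 0#)) (trans (*-congˡ (zeroˡ 0#)) (zeroʳ u))) (+-identityˡ 0#))
    ; -‿homo = λ i → -‿homo i , trans (sym (-‿inverseʳ 0#)) (+-identityˡ (- 0#))
    ; 0-homo = 0-homo , refl
    ; 1-homo = 1-homo , refl
    }

  θ : E.Carrier
  θ = 0# , 1#

  embed : Carrier → E.Carrier
  embed x = x , 0#

-- ℤ/m with the fifth roots of unity adjoined: first σ = ζ + ζ⁻¹, then ζ.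
module Cyclotomic (m : ℤ) where

  module S = Quadratic (ℤ/ m) (ℤ/-hom m) ℤ.-1ℤ 1ℤ
  module T = Quadratic S.extension S.extension-hom S.θ (ℤ.-1ℤ , ℤ.0ℤ)
  open ℤ-Algebra T.extension T.extension-hom

  σ ζ : Carrier
  σ = T.embed S.θ
  ζ = T.θ

  σ²+σ≈1 : σ * σ + σ ≈ ι (+ 1)
  σ²+σ≈1 = (Modular.mod-refl , Modular.mod-refl) , (Modular.mod-refl , Modular.mod-refl)

  ζ²+1≈σζ : ζ * ζ + ι (+ 1) ≈ σ * ζ
  ζ²+1≈σζ = (Modular.mod-refl , Modular.mod-refl) , (Modular.mod-refl , Modular.mod-refl)

  ι-cong : ∀ {x y} → x ≡ y [mod m ] → ι x ≈ ι y
  ι-cong e = (e , Modular.mod-refl) , (Modular.mod-refl , Modular.mod-refl)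

  -- Elements are quadruples over `ℤ/m` compared componentwise, and an integer sits in the first
  -- component.
  ι-injective : ∀ {x y} → ι x ≈ ι y → x ≡ y [mod m ]
  ι-injective ((e , _) , _) = e

-- Comparison of both sides modulo `p`.

module Reduction {c ℓ} (R : CommutativeRing c ℓ)
  (hom : ℤ.+-*-rawRing -Raw-AlmostCommutative⟶ fromCommutativeRing R) where

  open ℤ-Algebra R hom
  open Pochhammer R hom

  module At (j s n p : ℕ) (n≡ : n ≡ suc (j ℕ.+ j ℕ.+ s)) (p≡ : p ≡ suc n ℕ.+ j)
    (p≈0 : ν p ≈ 0#)
    (τ : Carrier) (3τ≈1 : ι (+ 3) * τ ≈ ι (+ 1))
    (r a 2a : Carrier) (r≈ : r ≈ ι (+ 1) - ν s) (a≈ : a ≈ r * τ) (2a≈ : 2a ≈ ι (+ 2) * r * τ) where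

    private
      m : ℕ
      m = j ℕ.+ s

      n≈ : ν n ≈ ι (+ 1) + (ν j + ν j + ν s)
      n≈ = trans (reflexive (≡.cong ν n≡)) (trans (+-homo (+ 1) _) (+-congˡ (trans (ν-+ (j ℕ.+ j) s) (+-congʳ (ν-+ j j)))))

      P≈ : ν p ≈ ι (+ 1) + (ι (+ 1) + (ν j + ν j + ν s)) + ν j
      P≈ = trans (reflexive (≡.cong ν p≡)) (trans (ν-+ (suc n) j) (+-congʳ (trans (+-homo (+ 1) (+ n)) (+-congˡ n≈))))

      relation : ι (+ 1) + (ι (+ 1) + (ν j + ν j + ν s)) + ν j ≈ 0#
      relation = trans (sym P≈) p≈0

      via : ∀ {u v y x} → v ≈ 0# → u ≈ y + v * x → u ≈ y
      via {u} {v} {y} {x} v≈0 e = trans e (trans (+-congˡ (trans (*-congʳ v≈0) (zeroˡ x))) (+-identityʳ y))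

      3τ-1≈0 : ι (+ 3) * τ - ι (+ 1) ≈ 0#
      3τ-1≈0 = trans (+-congʳ 3τ≈1) (-‿inverseʳ _)

      N Jf M : Carrier
      N  = ν (n !)
      Jf = ν (j !)
      M  = ν (m !)

    -- Modulo p the parameters a, 1 - a and 2a are the integers -n, -j and -m.
    a+n≈0 : a + ν n ≈ 0#
    a+n≈0 = trans (+-cong (trans a≈ (*-congʳ r≈)) n≈) (trans (via 3τ-1≈0 (via relation
      (solve 3 (λ τ j s → (con (+ 1) :- s) :* τ :+ (con (+ 1) :+ (j :+ j :+ s)) :=
        con (+ 0) :+ (con (+ 3) :* τ :- con (+ 1)) :* (:- (con (+ 1) :+ (j :+ j :+ s)))
          :+ (con (+ 1) :+ (con (+ 1) :+ (j :+ j :+ s)) :+ j) :* (con (+ 2) :* τ)) refl τ (ν j) (ν s)))) 0-homo)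

    1-a+j≈0 : 1# - a + ν j ≈ 0#
    1-a+j≈0 = trans (+-congʳ (+-cong (sym 1-homo) (-‿cong (trans a≈ (*-congʳ r≈))))) (trans (via 3τ-1≈0 (via relation
      (solve 3 (λ τ j s → con (+ 1) :- (con (+ 1) :- s) :* τ :+ j :=
        con (+ 0) :+ (con (+ 3) :* τ :- con (+ 1)) :* (:- (con (+ 1) :+ j))
          :+ (con (+ 1) :+ (con (+ 1) :+ (j :+ j :+ s)) :+ j) :* τ) refl τ (ν j) (ν s)))) 0-homo)

    2a+m≈0 : 2a + ν m ≈ 0#
    2a+m≈0 = trans (+-cong (trans 2a≈ (*-congʳ (*-congˡ r≈))) (ν-+ j s)) (trans (via 3τ-1≈0 (via relation
      (solve 3 (λ τ j s → con (+ 2) :* (con (+ 1) :- s) :* τ :+ (j :+ s) :=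
        con (+ 0) :+ (con (+ 3) :* τ :- con (+ 1)) :* (con (+ 2) :+ con (+ 2) :* j)
          :+ (con (+ 1) :+ (con (+ 1) :+ (j :+ j :+ s)) :+ j) :* (con (+ 1) :- con (+ 2) :* τ)) refl τ (ν j) (ν s)))) 0-homo)

    private
      sign-square : ∀ k → sign k * sign k ≈ 1#
      sign-square zero    = *-identityˡ 1#
      sign-square (suc k) = trans (solve 1 (λ x → :- x :* :- x := x :* x) refl (sign k)) (sign-square k)

      sign-+ : ∀ k l → sign (k ℕ.+ l) ≈ sign k * sign l
      sign-+ zero    l = sym (*-identityˡ _)
      sign-+ (suc k) l = trans (-‿cong (sign-+ k l)) (solve 2 (λ x y → :- (x :* y) := :- x :* y) refl (sign k) (sign l))

      poch-neg : ∀ {x} k → x + ν k ≈ 0# → poch x k ≈ sign k * ν (k !)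
      poch-neg {x} k e = trans (poch-reverse k (trans (+-assoc 1# x (ν k)) (trans (+-congˡ e) (+-identityʳ 1#)))) (*-congˡ (poch-1 k))

      mirror : ∀ {x} k l → x + ν (l ℕ.+ k) ≈ 0# → poch (1# + ν l) k ≈ sign k * poch x k
      mirror {x} k l e = poch-reverse k (trans (solve 4 (λ x o l k → x :+ (o :+ l) :+ k := o :+ (x :+ (l :+ k))) refl x 1# (ν l) (ν k))
        (trans (+-congˡ (trans (+-congˡ (sym (ν-+ l k))) e)) (+-identityʳ 1#)))

    -- The upper `k` factors of `m!`, reversed and negated, start at `-m`, which is `2a` modulo `p`.
    -- This is how `(2a)_k` enters the denominators.
    m!-split : ∀ l k → l ℕ.+ k ≡ m → ν (m !) ≈ ν (l !) * (sign k * poch 2a k)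
    m!-split l k l+k≡m = begin
      ν (m !)                          ≈⟨ trans (sym (poch-1 m)) (poch-≡ refl (≡.sym l+k≡m)) ⟩
      poch 1# (l ℕ.+ k)                ≈⟨ poch-+ l k refl ⟩
      poch 1# l * poch (1# + ν l) k    ≈⟨ *-cong (poch-1 l) (mirror k l (trans (+-congˡ (reflexive (≡.cong ν l+k≡m))) 2a+m≈0)) ⟩
      ν (l !) * (sign k * poch 2a k)   ∎

    -- Here `n + j = p - 1`, so `n + 1` is `-j` modulo `p` and the upper `j` factors are those of
    -- `j!` up to sign. Wilson's theorem for the left side then ties `n!` to `j!`.
    n+j!-split : ν ((n ℕ.+ j) !) ≈ ν (n !) * (sign j * ν (j !))
    n+j!-split = begin
      ν ((n ℕ.+ j) !)                  ≈⟨ poch-1 (n ℕ.+ j) ⟨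
      poch 1# (n ℕ.+ j)                ≈⟨ poch-+ n j refl ⟩
      poch 1# n * poch (1# + ν n) j    ≈⟨ *-cong (poch-1 n) (trans (poch-reverse j wraps) (*-congˡ (poch-1 j))) ⟩
      ν (n !) * (sign j * ν (j !))     ∎
      where
      wraps : 1# + (1# + ν n) + ν j ≈ 1#
      wraps = trans (+-assoc 1# _ _) (trans (+-congˡ (trans (+-congʳ (sym (ν-suc n))) (trans (sym (ν-+ (suc n) j))
        (trans (reflexive (≡.cong ν (≡.sym p≡))) p≈0)))) (+-identityʳ 1#))

    falling : ℕ → Carrier
    falling k = poch (1# + ν s - ν k) k

    reduced : ℕ → ℕ → Carrier
    reduced i k = poch a k * (poch (1# - a) j * ν ((i ∸ suc j) !)) ^ 3 * (falling k * poch (1# + ν i) k)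

    module _ (inv : ℕ → Carrier) (inverse! : ∀ k → k < p → ν (k !) * inv k ≈ 1#)
      (D : ℕ → Carrier) (inverse-D : ∀ k → k ≤ s → poch 1# k * poch 2a k ^ 3 * D k ≈ 1#)
      where

      term : ℕ → Carrier
      term k = poch (r - 1#) k * poch a k ^ 3 * D k

      private
        C : Carrier
        C = (poch (1# - a) j * M) ^ 3

        s≤n : s ≤ n
        s≤n = ≡.subst (s ≤_) (≡.sym n≡) (ℕ.m≤n⇒m≤1+n (ℕ.m≤n+m s (j ℕ.+ j)))

        n<p : n < p
        n<p = ≡.subst (n <_) (≡.sym p≡) (ℕ.m≤m+n (suc n) j)

        falling≈ : ∀ k → falling k ≈ sign k * poch (r - 1#) k
        falling≈ k = poch-reverse k (trans (+-congʳ (+-congʳ (+-congʳ r≈)))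
          (trans (solve 4 (λ i s o k → (i :- s :- o) :+ (o :+ s :- k) :+ k := i) refl (ι (+ 1)) (ν s) 1# (ν k)) 1-homo))

        -- Each of the three `(i - j - 1)!` needs a factor `sign k * poch 2a k` to become `m!`,
        -- which no longer depends on `k`. The three signs come from `falling k` and from the two
        -- copies of `(1 + i)_k`.
        term-small : ∀ k i → k ℕ.+ i ≡ n → k ≤ s → poch (1# + ν i) k * (inv k * reduced i k) ≈ C * term k
        term-small k i k+i≡n k≤s = begin
          poch (1# + ν i) k * (inv k * (poch a k * (B * ν (l !)) ^ 3 * (falling k * poch (1# + ν i) k)))
            ≈⟨ *-cong upper (*-congˡ (*-congˡ (*-cong (falling≈ k) upper))) ⟩
          S * A * (inv k * (A * (B * ν (l !)) ^ 3 * (S * Q * (S * A))))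
            ≈⟨ *-congˡ (*-congʳ inv≈) ⟩
          S * A * (E ^ 3 * D k * (A * (B * ν (l !)) ^ 3 * (S * Q * (S * A))))
            ≈⟨ solve 7 (λ S A E D B L Q → S :* A :* (E :^ 3 :* D :* (A :* (B :* L) :^ 3 :* (S :* Q :* (S :* A)))) :=
                 (B :* (L :* (S :* E))) :^ 3 :* (Q :* A :^ 3 :* D)) refl S A E (D k) B (ν (l !)) Q ⟩
          (B * (ν (l !) * (S * E))) ^ 3 * (Q * A ^ 3 * D k)
            ≈⟨ *-congʳ (^-cong 3 (*-congˡ (sym m!≈))) ⟩
          C * term k ∎
          where
          S = sign k
          A = poch a k
          B = poch (1# - a) j
          Q = poch (r - 1#) k
          E = poch 2a k
          l = i ∸ suc j
          i+k≡n : i ℕ.+ k ≡ n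
          i+k≡n = ≡.trans (ℕ.+-comm i k) k+i≡n
          j<i : j < i
          j<i = ℕ.+-cancelʳ-≤ k (suc j) i (ℕ.≤-trans (s≤s (ℕ.+-monoʳ-≤ j k≤s))
            (ℕ.≤-trans (s≤s (ℕ.+-monoˡ-≤ s (ℕ.m≤m+n j j))) (ℕ.≤-reflexive (≡.sym (≡.trans i+k≡n n≡)))))
          l+k≡m : l ℕ.+ k ≡ m
          l+k≡m = ℕ.+-cancelˡ-≡ (suc j) _ _ (≡.trans (≡.sym (ℕ.+-assoc (suc j) l k))
            (≡.trans (≡.cong (ℕ._+ k) (ℕ.m+[n∸m]≡n j<i)) (≡.trans i+k≡n (≡.trans n≡ (≡.cong suc (ℕ.+-assoc j j s))))))
          upper : poch (1# + ν i) k ≈ S * A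
          upper = mirror k i (trans (+-congˡ (reflexive (≡.cong ν i+k≡n))) a+n≈0)
          m!≈ : M ≈ ν (l !) * (S * E)
          m!≈ = m!-split l k l+k≡m
          inv≈ : inv k ≈ E ^ 3 * D k
          inv≈ = begin
            inv k                                  ≈⟨ trans (sym (*-identityʳ _)) (*-congˡ (sym (inverse-D k k≤s))) ⟩
            inv k * (poch 1# k * E ^ 3 * D k)      ≈⟨ *-congˡ (*-congʳ (*-congʳ (poch-1 k))) ⟩
            inv k * (ν (k !) * E ^ 3 * D k)        ≈⟨ solve 4 (λ i f e d → i :* (f :* e :* d) := f :* i :* (e :* d)) refl (inv k) (ν (k !)) (E ^ 3) (D k) ⟩
            ν (k !) * inv k * (E ^ 3 * D k)        ≈⟨ trans (*-congʳ (inverse! k (ℕ.≤-<-trans (ℕ.≤-trans k≤s s≤n) n<p))) (*-identityˡ _) ⟩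
            E ^ 3 * D k                            ∎

      binomialSum-reduced : binomialSum n reduced ≈ C * rangeSum (suc s) term
      binomialSum-reduced = begin
        binomialSum n reduced
          ≈⟨ binomialSum-flip n reduced ⟩
        binomialSum n (λ k i → reduced i k)
          ≈⟨ binomialSum-cong n {g = λ k i → ν (k !) * (inv k * reduced i k)} (λ k i k+i≡n → sym (trans (sym (*-assoc _ _ _))
               (trans (*-congʳ (inverse! k (ℕ.≤-<-trans (ℕ.m+n≤o⇒m≤o k (ℕ.≤-reflexive k+i≡n)) n<p))) (*-identityˡ _)))) ⟩
        binomialSum n (λ k i → ν (k !) * (inv k * reduced i k))
          ≈⟨ binomialSum-factorial n (λ k i → inv k * reduced i k) ⟩
        antidiagonalSum n (λ k i → poch (1# + ν i) k * (inv k * reduced i k))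
          ≈⟨ antidiagonalSum-cong n {g = λ k _ → cut k} (λ k i k+i≡n → each k i k+i≡n (ℕ.≤-<-connex k s)) ⟩
        antidiagonalSum n (λ k _ → cut k)
          ≈⟨ antidiagonalSum-rangeSum n cut ⟩
        rangeSum (suc n) cut
          ≈⟨ trans (reflexive (≡.cong (λ z → rangeSum (suc z) cut) (≡.sym (ℕ.m+[n∸m]≡n s≤n)))) (rangeSum-truncate (suc s) (n ∸ s) cut cut-large) ⟩
        rangeSum (suc s) cut
          ≈⟨ rangeSum-cong (suc s) {g = λ k → C * term k} (λ k k≤s → cut-small k (ℕ.≤-pred k≤s)) ⟩
        rangeSum (suc s) (λ k → C * term k)
          ≈⟨ rangeSum-*ˡ (suc s) C term ⟩
        C * rangeSum (suc s) term ∎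
        where
        open import Data.Sum using (_⊎_)
        open import Relation.Nullary using (yes; no; Dec; contradiction)
        -- `D k` is known to be an inverse only for `k ≤ s`; beyond `s` the actual terms vanish
        -- through `falling k`, hence the default `0`.
        cut : ℕ → Carrier
        cut k with k ℕ.≤? s
        ... | yes _ = C * term k
        ... | no _  = 0#
        cut-small : ∀ k → k ≤ s → cut k ≈ C * term k
        cut-small k k≤s with k ℕ.≤? s
        ... | yes _  = refl
        ... | no k≰s = contradiction k≤s k≰s
        cut-large : ∀ k → s < k → cut k ≈ 0#
        cut-large k s<k with k ℕ.≤? s
        ... | yes k≤s = contradiction k≤s (ℕ.<⇒≱ s<k)
        ... | no _    = refl
        each : ∀ k i → k ℕ.+ i ≡ n → k ≤ s ⊎ s < k → poch (1# + ν i) k * (inv k * reduced i k) ≈ cut k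
        each k i k+i≡n (inj₁ k≤s) = trans (term-small k i k+i≡n k≤s) (sym (cut-small k k≤s))
        each k i k+i≡n (inj₂ s<k) = trans
          (*-congˡ (*-congˡ (trans (*-congˡ (trans (*-congʳ vanish) (zeroˡ _))) (zeroʳ _))))
          (trans (*-congˡ (zeroʳ _)) (trans (zeroʳ _) (sym (cut-large k s<k))))
          where
          vanish : falling k ≈ 0#
          vanish = poch-ν-vanish s s<k (solve 2 (λ y k → y :- k :+ k := y) refl (1# + ν s) (ν k))

      module _ {G₁ G₂ G₃ : Carrier} (G₁n! : G₁ * N ≈ - a) (G₂m! : G₂ * M ≈ - 2a) (G₃j! : G₃ * Jf ≈ 1#)
        (n!j! : N * (sign j * Jf) ≈ - 1#)
        {IG i81 : Carrier} (inverse-G : G₂ ^ 3 * G₃ ^ 4 * IG ≈ 1#) (81i≈1 : ι (+ 81) * i81 ≈ 1#) where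

        comparison : ι (+ 3) * (ι (ℤ.- (+ 10)) * τ ^ 4 * (poch a n * N * binomialSum n reduced)) ≈
          N ^ 5 * (sign s * ι (+ 80) * r * i81 * (G₁ ^ 2 * IG) * rangeSum (suc s) term)
        comparison = begin
          ι (+ 3) * (ι (ℤ.- (+ 10)) * τ ^ 4 * (poch a n * N * binomialSum n reduced))
            ≈⟨ *-congˡ (*-congˡ (*-cong (*-congʳ (trans (poch-neg n a+n≈0) (*-congʳ sign-n))) (trans binomialSum-reduced (*-congʳ (^-cong 3 (*-congʳ (poch-neg j 1-a+j≈0))))))) ⟩
          ι (+ 3) * (ι (ℤ.- (+ 10)) * τ ^ 4 * (- sign s * N * N * ((sign j * Jf * M) ^ 3 * Σ)))
            ≈⟨ *-congˡ (*-congʳ (*-congˡ τ⁴)) ⟩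
          ι (+ 3) * (ι (ℤ.- (+ 10)) * i81 * (- sign s * N * N * ((sign j * Jf * M) ^ 3 * Σ)))
            ≈⟨ solve 7 (λ i S N Y J M Σ → con (+ 3) :* (con (ℤ.- (+ 10)) :* i :* (:- S :* N :* N :* ((Y :* J :* M) :^ 3 :* Σ))) :=
                 con (+ 30) :* i :* S :* N :^ 2 :* (Y :* Y) :* Y :* (M :^ 3 :* J :^ 3) :* Σ) refl i81 (sign s) N (sign j) Jf M Σ ⟩
          ι (+ 30) * i81 * sign s * N ^ 2 * (sign j * sign j) * sign j * (M ^ 3 * Jf ^ 3) * Σ
            ≈⟨ *-congʳ (*-congʳ (*-cong (trans (*-congˡ (sign-square j)) (*-identityʳ _)) (trans (sym (*-identityʳ _)) (trans (*-congˡ unit) (sym (*-assoc _ _ _)))))) ⟩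
          ι (+ 30) * i81 * sign s * N ^ 2 * (sign j * - 1# * (N * (sign j * Jf))) * (M ^ 3 * Jf ^ 3) * Σ
            ≈⟨ solve 8 (λ i S N Y J M Σ o → con (+ 30) :* i :* S :* N :^ 2 :* (Y :* :- o :* (N :* (Y :* J))) :* (M :^ 3 :* J :^ 3) :* Σ :=
                 con (ℤ.- (+ 30)) :* i :* S :* N :^ 3 :* (Y :* Y) :* o :* (M :^ 3 :* J :^ 4) :* Σ) refl i81 (sign s) N (sign j) Jf M Σ 1# ⟩
          ι (ℤ.- (+ 30)) * i81 * sign s * N ^ 3 * (sign j * sign j) * 1# * (M ^ 3 * Jf ^ 4) * Σ
            ≈⟨ *-congʳ (*-cong (trans (*-identityʳ _) (trans (*-congˡ (sign-square j)) (*-identityʳ _))) MJ) ⟩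
          ι (ℤ.- (+ 30)) * i81 * sign s * N ^ 3 * ((- 2a) ^ 3 * IG) * Σ
            ≈⟨ *-congʳ (*-congˡ (*-congʳ (^-cong 3 (-‿cong 2a≈2*a)))) ⟩
          ι (ℤ.- (+ 30)) * i81 * sign s * N ^ 3 * ((- (ι (+ 2) * a)) ^ 3 * IG) * Σ
            -- The origin of `80`: `-30 (-2a)³ = 240 a³ = 80 (3a) (-a)²`, where `3a` is `r` and
            -- `(-a)²` is absorbed into the square of `G₁ * N`.
            ≈⟨ solve 6 (λ i S N a I Σ → con (ℤ.- (+ 30)) :* i :* S :* N :^ 3 :* ((:- (con (+ 2) :* a)) :^ 3 :* I) :* Σ :=
                 N :^ 3 :* (S :* con (+ 80) :* (con (+ 3) :* a) :* i :* ((:- a) :^ 2 :* I) :* Σ)) refl i81 (sign s) N a IG Σ ⟩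
          N ^ 3 * (sign s * ι (+ 80) * (ι (+ 3) * a) * i81 * ((- a) ^ 2 * IG) * Σ)
            ≈⟨ *-congˡ (*-congʳ (*-cong (*-congʳ (*-congˡ 3a≈r)) (*-congʳ (^-cong 2 (sym G₁n!))))) ⟩
          N ^ 3 * (sign s * ι (+ 80) * r * i81 * ((G₁ * N) ^ 2 * IG) * Σ)
            ≈⟨ solve 7 (λ i S N r G I Σ → N :^ 3 :* (S :* con (+ 80) :* r :* i :* ((G :* N) :^ 2 :* I) :* Σ) :=
                 N :^ 5 :* (S :* con (+ 80) :* r :* i :* (G :^ 2 :* I) :* Σ)) refl i81 (sign s) N r G₁ IG Σ ⟩
          N ^ 5 * (sign s * ι (+ 80) * r * i81 * (G₁ ^ 2 * IG) * Σ) ∎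
          where
          Σ = rangeSum (suc s) term
          sign-n : sign n ≈ - sign s
          sign-n = trans (reflexive (≡.cong sign n≡)) (-‿cong (trans (sign-+ (j ℕ.+ j) s) (trans (*-congʳ (trans (sign-+ j j) (sign-square j))) (*-identityˡ _))))
          τ⁴ : τ ^ 4 ≈ i81
          τ⁴ = begin
            τ ^ 4                          ≈⟨ trans (sym (*-identityʳ _)) (*-congˡ (sym 81i≈1)) ⟩
            τ ^ 4 * (ι (+ 81) * i81)       ≈⟨ solve 2 (λ τ i → τ :^ 4 :* (con (+ 81) :* i) := (con (+ 3) :* τ) :^ 4 :* i) refl τ i81 ⟩
            (ι (+ 3) * τ) ^ 4 * i81        ≈⟨ *-congʳ (^-cong 4 3τ≈1) ⟩
            ι (+ 1) ^ 4 * i81              ≈⟨ solve 1 (λ i → con (+ 1) :^ 4 :* i := i) refl i81 ⟩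
            i81                            ∎
          -- Wilson's theorem once more: inserting this unit turns `n!² j!³` into `n!³ j!⁴`, the
          -- power of `j!` that matches the fourth power of `G₃`.
          unit : 1# ≈ - 1# * (N * (sign j * Jf))
          unit = sym (trans (*-congˡ n!j!) (trans (solve 1 (λ o → :- o :* :- o := o :* o) refl 1#) (*-identityˡ 1#)))
          MJ : M ^ 3 * Jf ^ 4 ≈ (- 2a) ^ 3 * IG
          MJ = begin
            M ^ 3 * Jf ^ 4                                        ≈⟨ trans (sym (*-identityʳ _)) (*-congˡ (sym inverse-G)) ⟩
            M ^ 3 * Jf ^ 4 * (G₂ ^ 3 * G₃ ^ 4 * IG)               ≈⟨ solve 5 (λ M J G H I → M :^ 3 :* J :^ 4 :* (G :^ 3 :* H :^ 4 :* I) := (G :* M) :^ 3 :* (H :* J) :^ 4 :* I) refl M Jf G₂ G₃ IG ⟩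
            (G₂ * M) ^ 3 * (G₃ * Jf) ^ 4 * IG                     ≈⟨ *-congʳ (*-cong (^-cong 3 G₂m!) (trans (^-cong 4 (trans G₃j! (sym 1-homo))) (solve 0 (con (+ 1) :^ 4 := con (+ 1)) refl))) ⟩
            (- 2a) ^ 3 * ι (+ 1) * IG                             ≈⟨ *-congʳ (trans (*-congˡ 1-homo) (*-identityʳ _)) ⟩
            (- 2a) ^ 3 * IG                                       ∎
          2a≈2*a : 2a ≈ ι (+ 2) * a
          2a≈2*a = trans 2a≈ (trans (*-assoc _ _ _) (*-congˡ (sym a≈)))
          3a≈r : ι (+ 3) * a ≈ r
          3a≈r = trans (*-congˡ a≈) (trans (solve 3 (λ t r τ → t :* (r :* τ) := r :* (t :* τ)) refl (ι (+ 3)) r τ)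
            (trans (*-congˡ (trans 3τ≈1 1-homo)) (*-identityʳ r)))

    -- Both sides vanish because `10` and `80` are even.
    comparison₂ : ι (+ 2) ≈ 0# → ∀ x y S g i Σ →
      ι (+ 3) * (ι (ℤ.- (+ 10)) * τ ^ 4 * x) ≈ y * (S * ι (+ 80) * r * i * g * Σ)
    comparison₂ 2≈0 x y S g i Σ = begin
      ι (+ 3) * (ι (ℤ.- (+ 10)) * τ ^ 4 * x)                  ≈⟨ solve 2 (λ τ x → con (+ 3) :* (con (ℤ.- (+ 10)) :* τ :^ 4 :* x) := con (+ 2) :* (con (ℤ.- (+ 15)) :* τ :^ 4 :* x)) refl τ x ⟩
      ι (+ 2) * (ι (ℤ.- (+ 15)) * τ ^ 4 * x)                  ≈⟨ trans (*-congʳ 2≈0) (zeroˡ _) ⟩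
      0#                                                      ≈⟨ trans (*-congʳ 2≈0) (zeroˡ _) ⟨
      ι (+ 2) * (ι (+ 40) * (y * (S * r * i * g * Σ)))        ≈⟨ solve 6 (λ y S r i g Σ → y :* (S :* con (+ 80) :* r :* i :* g :* Σ) := con (+ 2) :* (con (+ 40) :* (y :* (S :* r :* i :* g :* Σ)))) refl y S r i g Σ ⟨
      y * (S * ι (+ 80) * r * i * g * Σ)                      ∎

-- Values of `Γℕ` modulo `p`.

module GammaModulo {p : ℕ} (p-prime : Prime p) where

  open PrimeModulus p-prime
  open Modular {+ p}

  -- Unlike in `Γℕ-cong`, no power of `p` is lost: a block of length `p` contributes `Γℕ p p`, which
  -- is `1` by Wilson's theorem.
  Γℕ-mod-p : ∀ a b → + a ≡ + b [mod + p ] → Γℕ p a ≡ Γℕ p b [mod + p ]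
  Γℕ-mod-p a b e = [ (λ b≤a → go b≤a e) , (λ a≤b → mod-sym (go a≤b (mod-sym e))) ]′ (ℕ.≤-total b a)
    where
    go : ∀ {a b} → b ≤ a → + a ≡ + b [mod + p ] → Γℕ p a ≡ Γℕ p b [mod + p ]
    go {a} {b} b≤a e with ℕ≡⇒∣ b≤a e
    ... | k , ≡.refl = begin
      Γℕ p (b ℕ.+ k ℕ.* p)        ≈⟨ Γℕ-blocks ℕ.∣-refl b k ⟩
      Γℕ p b ℤ.* Γℕ p p ℤ.^ k     ≈⟨ mod-* (mod-refl {Γℕ p b}) (mod-^ k wilson) ⟩
      Γℕ p b ℤ.* 1ℤ ℤ.^ k         ≡⟨ ≡.cong (Γℕ p b ℤ.*_) (ℤ.^-zeroˡ k) ⟩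
      Γℕ p b ℤ.* 1ℤ               ≡⟨ ℤ.*-identityʳ (Γℕ p b) ⟩
      Γℕ p b                      ∎
      where open ≈-Reasoning modSetoid

  Γℕ-suc : ∀ {k} → 0 < k → k < p → Γℕ p (suc k) ≡ ℤ.- + k ℤ.* Γℕ p k
  Γℕ-suc 0<k k<p = Γℕ-step-∤ _ λ p∣k → p∤small 0<k k<p (∣ᵤ⇒∣ p∣k)

  -- Raising `k` by one multiplies `Γℕ p k` by `-k`, which is `m + 1` modulo `p` and so equals the
  -- factor split off from `(m + 1)!`. The induction ends at `k = p` with Wilson's theorem.
  Γℕ-complement : ∀ m k → m ℕ.+ k ≡ p → 0 < k → Γℕ p k ℤ.* + (m !) ≡ 1ℤ [mod + p ]
  Γℕ-complement zero    k ≡.refl 0<k = mod-trans (mod-reflexive (ℤ.*-identityʳ _)) wilson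
  Γℕ-complement (suc m) k m+k≡p 0<k = begin
    Γℕ p k ℤ.* + (suc m ℕ.* m !)              ≡⟨ ≡.cong (Γℕ p k ℤ.*_) (ℤ.pos-* (suc m) (m !)) ⟩
    Γℕ p k ℤ.* (+ suc m ℤ.* + (m !))          ≈⟨ mod-* (mod-refl {Γℕ p k}) (mod-* {+ suc m} {ℤ.- + k} (mod (divides 1ℤ sum)) (mod-refl {+ (m !)})) ⟩
    Γℕ p k ℤ.* (ℤ.- + k ℤ.* + (m !))          ≡⟨ rotate (Γℕ p k) (ℤ.- + k) (+ (m !)) ⟩
    ℤ.- + k ℤ.* Γℕ p k ℤ.* + (m !)            ≡⟨ ≡.cong (ℤ._* + (m !)) (Γℕ-suc 0<k k<p) ⟨
    Γℕ p (suc k) ℤ.* + (m !)                  ≈⟨ Γℕ-complement m (suc k) (≡.trans (ℕ.+-suc m k) m+k≡p) (s≤s z≤n) ⟩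
    1ℤ                                        ∎
    where
    open ≈-Reasoning modSetoid
    k<p : k < p
    k<p = ≡.subst (k <_) m+k≡p (s≤s (ℕ.m≤n+m k m))
    sum : + suc m ℤ.- (ℤ.- + k) ≡ 1ℤ ℤ.* + p
    sum = ≡.trans (≡.cong (ℤ._+_ (+ suc m)) (ℤ.neg-involutive (+ k))) (≡.trans (≡.cong +_ m+k≡p) (≡.sym (ℤ.*-identityˡ (+ p))))
    rotate : ∀ x y z → x ℤ.* (y ℤ.* z) ≡ y ℤ.* x ℤ.* z
    rotate = ℤ-Solver.solve-∀

  p∤! : ∀ {m} → m < p → ¬ + p ∣.∣ + (m !)
  p∤! {m} m<p p∣m! = p∤1 (∣-resp (Γℕ-complement m (p ∸ m) (ℕ.m+[n∸m]≡n (ℕ.<⇒≤ m<p)) (ℕ.m<n⇒0<n∸m m<p)) (∣.∣n⇒∣m*n (Γℕ p (p ∸ m)) p∣m!))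

  p∤^ : ∀ {x} k → ¬ + p ∣.∣ x → ¬ + p ∣.∣ x ℤ.^ k
  p∤^ zero    p∤x = p∤1
  p∤^ (suc k) p∤x p∣ = [ p∤x , p∤^ k p∤x ]′ (euclid _ _ p∣)

  p∤* : ∀ {x y} → ¬ + p ∣.∣ x → ¬ + p ∣.∣ y → ¬ + p ∣.∣ x ℤ.* y
  p∤* p∤x p∤y p∣ = [ p∤x , p∤y ]′ (euclid _ _ p∣)

-- From residues modulo `p⁵` to congruences in `ℤₚ`.

module Lifting {p : ℕ} (p-prime : Prime p) where

  open Padic p p-prime
  open Modular
  private instance
    p≢0 : NonZero p
    p≢0 = prime⇒nonZero p-prime

  coherent⁺ : ∀ x k n → residue x (k ℕ.+ n) ≡ residue x n [mod + (p ℕ.^ n) ]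
  coherent⁺ x zero    n = mod-refl
  coherent⁺ x (suc k) n = mod-trans (weaken (p^∣ k) (coherent x (k ℕ.+ n))) (coherent⁺ x k n)
    where
    p^∣ : ∀ k → + (p ℕ.^ n) ∣.∣ + (p ℕ.^ (k ℕ.+ n))
    p^∣ k = ∣ᵤ⇒∣ (≡.subst (p ℕ.^ n ℕ.∣_) (≡.sym (ℕ.^-distribˡ-+-* p k n)) (ℕ.n∣m*n (p ℕ.^ k)))

  -- Dividing by `p^N` costs `N` levels of precision, so level `n` of the quotient is read off from
  -- level `n + N` of the difference.
  residue-≡⇒≡ : ∀ N x y → residue x N ≡ residue y N [mod + (p ℕ.^ N) ] → x ≡ y [modp^ N ]
  residue-≡⇒≡ N x y e = z , equal λ n → mod-trans
      (mod-sym (≡.subst (λ k → residue d k ≡ residue d n [mod + (p ℕ.^ n) ]) (ℕ.+-comm N n) (coherent⁺ d N n)))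
      (mod-reflexive (≡.trans (division n) (ℤ.*-comm (digits n) Pᴺ)))
    where
    d = x - y
    Pᴺ = + (p ℕ.^ N)
    instance
      Pᴺ≢0 : ℤ.NonZero Pᴺ
      Pᴺ≢0 = ℕ.m^n≢0 p N
    Pᴺ∣ : ∀ n → Pᴺ ∣.∣ residue d (n ℕ.+ N)
    Pᴺ∣ n = ≡0⇒∣ (mod-trans (coherent⁺ d n N) (m≡0 (_≡_[mod_].difference e)))
    digits : ℕ → ℤ
    digits n = ∣.quotient (Pᴺ∣ n)
    division : ∀ n → residue d (n ℕ.+ N) ≡ digits n ℤ.* Pᴺ
    division n with divides _ eq ← Pᴺ∣ n = eq
    z : ℤₚ
    z .residue = digits
    z .coherent n = mod (∣.*-cancelʳ-∣ Pᴺ {{Pᴺ≢0}} (≡.subst₂ ∣._∣_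
      (≡.trans (≡.cong +_ (ℕ.^-distribˡ-+-* p n N)) (ℤ.pos-* (p ℕ.^ n) (p ℕ.^ N)))
      (≡.trans (≡.cong₂ ℤ._-_ (division (suc n)) (division n)) (factor (digits (suc n)) (digits n) Pᴺ))
      (_≡_[mod_].difference (coherent d (n ℕ.+ N)))))
      where
      factor : ∀ a b P → a ℤ.* P ℤ.- b ℤ.* P ≡ (a ℤ.- b) ℤ.* P
      factor = ℤ-Solver.solve-∀


  residue-pochhammer : ∀ x k l → residue (pochhammer x k) l ≡ Z.poch (residue x l) k
  residue-pochhammer x zero    l = ≡.refl
  residue-pochhammer x (suc k) l = ≡.cong (ℤ._* (residue x l ℤ.+ + k)) (residue-pochhammer x k l)

  residue-∑ : ∀ n f l → residue (∑ n f) l ≡ Z.rangeSum n (λ k → residue (f k) l)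
  residue-∑ zero    f l = ≡.refl
  residue-∑ (suc n) f l = ≡.cong (ℤ._+_ (residue (f 0) l)) (residue-∑ n (λ k → f (suc k)) l)

  residue-⁻¹ : ∀ x l → ¬ + p ∣.∣ residue x 1 → residue x l ℤ.* residue (x ⁻¹) l ≡ 1ℤ [mod + (p ℕ.^ l) ]
  residue-⁻¹ x l p∤x = residues (⁻¹-inverse x p∤x) l

  rangeSum-≡ : ∀ l (f g : ℕ → ℤ) → (∀ k → f k ≡ g k) → Z.rangeSum l f ≡ Z.rangeSum l g
  rangeSum-≡ zero    f g e = ≡.refl
  rangeSum-≡ (suc l) f g e = ≡.cong₂ ℤ._+_ (e 0) (rangeSum-≡ l (λ k → f (suc k)) (λ k → g (suc k)) λ k → e (suc k))

  inverse : ∀ x i → residue x 5 ≡ i → ¬ + p ∣.∣ i → i ℤ.* residue (x ⁻¹) 5 ≡ 1ℤ [mod + (p ℕ.^ 5) ]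
  inverse x i ≡.refl p∤i = residue-⁻¹ x 5 λ p∣x → p∤i (∣-resp (mod-sym (residue-mod-p x 4)) p∣x)

  residue-sign : ∀ k l → residue ((- 1#) ^ k) l ≡ Z.sign k
  residue-sign zero    l = ≡.refl
  residue-sign (suc k) l = ≡.trans (≡.cong (ℤ._*_ -1ℤ) (residue-sign k l)) (ℤ.-1*i≡-i (Z.sign k))

  Γₚ-mod-p : ∀ x c l → residue x 1 ≡ + c [mod + p ] → residue (Γₚ x) l ≡ Γℕ p c [mod + p ]
  Γₚ-mod-p x c l e = GammaModulo.Γℕ-mod-p p-prime _ c (mod-trans (weaken p∣ (mod-sym (representative-≡ x (suc l))))
    (mod-trans (residue-mod-p x l) e))
    where
    p∣ : + p ∣.∣ + (p ℕ.^ suc l)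
    p∣ = ∣ᵤ⇒∣ (ℕ.m∣m*n (p ℕ.^ l))

  Γₚ-at : ∀ x c → residue x 5 ≡ + c [mod + p ] → residue (Γₚ x) 5 ≡ Γℕ p c [mod + p ]
  Γₚ-at x c e = Γₚ-mod-p x c 5 (mod-trans (mod-sym (residue-mod-p x 4)) e)

  conclude : ∀ x y {l g} → residue x 5 ≡ l → residue y 5 ≡ g → l ≡ g [mod + (p ℕ.^ 5) ] → x ≡ y [modp^ 5 ]
  conclude x y ≡.refl ≡.refl e = residue-≡⇒≡ 5 x y e

-- The congruence between integers modulo `p⁵`.

module IntegerCongruence (j s n p : ℕ) (n≡ : n ≡ suc (j ℕ.+ j ℕ.+ s)) (p≡ : p ≡ suc n ℕ.+ j)
  (p-prime : Prime p) (r : ℤ) (r≡ : r ≡ 1ℤ ℤ.- + s) (τ : ℤ) (3τ≡1 : + 3 ℤ.* τ ≡ 1ℤ [mod + (p ℕ.^ 5) ]) where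

  open PrimeModulus p-prime
  open GammaModulo p-prime

  private
    M : ℤ
    M = + (p ℕ.^ 5)
    module Q where
      open ℤ-Algebra (ℤ/ M) (ℤ/-hom M) public
      open Pochhammer (ℤ/ M) (ℤ/-hom M) public
    module F where
      open ℤ-Algebra (ℤ/ (+ p)) (ℤ/-hom (+ p)) public
      open Pochhammer (ℤ/ (+ p)) (ℤ/-hom (+ p)) public
    open Q using () renaming (_≈_ to _≡₅_)
    open F using () renaming (_≈_ to _≡₁_)

  reduce : ∀ {x y} → x ≡₅ y → x ≡₁ y
  reduce = weaken (∣ᵤ⇒∣ (ℕ.m∣m*n (p ℕ.^ 4)))

  a 2a : ℤ
  a = r ℤ.* τ
  2a = + 2 ℤ.* r ℤ.* τ

  m : ℕ
  m = j ℕ.+ s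

  private
    p≡0 : + p ≡₁ 0ℤ
    p≡0 = Modular.m≡0 ∣.∣-refl

    open Reduction.At (ℤ/ (+ p)) (ℤ/-hom (+ p)) j s n p n≡ p≡ p≡0 τ (reduce 3τ≡1) r a 2a (F.reflexive r≡) F.refl F.refl

    n<p : n < p
    n<p = ≡.subst (n <_) (≡.sym p≡) (ℕ.m≤m+n (suc n) j)

    n+j : suc n ℕ.+ j ≡ p
    n+j = ≡.sym p≡

    +n≡ : + n ≡ 1ℤ ℤ.+ (+ j ℤ.+ + j ℤ.+ + s)
    +n≡ = ≡.cong +_ n≡

    +p≡ : + p ≡ + 2 ℤ.+ (+ j ℤ.+ + j ℤ.+ + s) ℤ.+ + j
    +p≡ = ≡.cong +_ (≡.trans p≡ (≡.cong (λ l → suc l ℕ.+ j) n≡))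

    m<p : m < p
    m<p = ℕ.≤-<-trans (≡.subst (m ≤_) (≡.sym n≡) (ℕ.≤-trans (ℕ.+-monoˡ-≤ s (ℕ.m≤m+n j j)) (ℕ.n≤1+n _))) n<p

  private
    -- By `m!-split`, `(2a)_k` divides `m!` modulo `p`, and `m < p`. So the denominators on the
    -- right side of the theorem are units.
    p∤2a : ∀ k → k ≤ m → ¬ + p ∣.∣ Z.poch 2a k
    p∤2a k k≤m p∣ = p∤! m<p (Modular.∣-resp (F.sym (m!-split (m ∸ k) k (ℕ.m∸n+n≡m k≤m)))
      (∣.∣n⇒∣m*n (+ ((m ∸ k) !)) (∣.∣n⇒∣m*n (Z.sign k) p∣)))

  p∤denominator : ∀ k → k ≤ s → ¬ + p ∣.∣ Z.poch 1ℤ k ℤ.* Z.poch 2a k ℤ.^ 3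
  p∤denominator k k≤s = p∤* {Z.poch 1ℤ k} {Z.poch 2a k ℤ.^ 3}
    (λ p∣ → p∤! (ℕ.≤-<-trans k≤m m<p) (Modular.∣-resp (F.poch-1 k) p∣)) (p∤^ {Z.poch 2a k} 3 (p∤2a k k≤m))
    where
    k≤m : k ≤ m
    k≤m = ℕ.≤-trans k≤s (ℕ.m≤n+m s j)

  -- 1 + a, 1 + 2a and 1 - a are represented modulo p by 2 + j, 3 + 2j and 1 + n.
  a≡1+j : a ≡₁ + suc j
  a≡1+j = begin
    a                                                  ≈⟨ solve 3 (λ a j s → a := (a :+ (con (+ 1) :+ (j :+ j :+ s))) :- (con (+ 2) :+ (j :+ j :+ s) :+ j) :+ (con (+ 1) :+ j)) refl a (+ j) (+ s) ⟩
    (a ℤ.+ (1ℤ ℤ.+ (+ j ℤ.+ + j ℤ.+ + s))) ℤ.- (+ 2 ℤ.+ (+ j ℤ.+ + j ℤ.+ + s) ℤ.+ + j) ℤ.+ + suc j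
                                                       ≡⟨ ≡.cong₂ (λ x y → (a ℤ.+ x) ℤ.- y ℤ.+ + suc j) +n≡ +p≡ ⟨
    (a ℤ.+ + n) ℤ.- + p ℤ.+ + suc j                    ≈⟨ +-congʳ (+-cong a+n≈0 (-‿cong p≡0)) ⟩
    0ℤ ℤ.- 0ℤ ℤ.+ + suc j                              ≡⟨ ≡.refl ⟩
    + suc j                                            ∎
    where open F hiding (_+_; _*_; -_; _-_; 0#; 1#; _^_; _≈_)

  2a≡2+2j : 2a ≡₁ + suc (suc (j ℕ.+ j))
  2a≡2+2j = begin
    2a                                                 ≈⟨ solve 3 (λ a j s → a := (a :+ (j :+ s)) :- (con (+ 2) :+ (j :+ j :+ s) :+ j) :+ (con (+ 2) :+ (j :+ j))) refl 2a (+ j) (+ s) ⟩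
    (2a ℤ.+ + m) ℤ.- (+ 2 ℤ.+ (+ j ℤ.+ + j ℤ.+ + s) ℤ.+ + j) ℤ.+ + suc (suc (j ℕ.+ j))
                                                       ≡⟨ ≡.cong (λ y → (2a ℤ.+ + m) ℤ.- y ℤ.+ + suc (suc (j ℕ.+ j))) +p≡ ⟨
    (2a ℤ.+ + m) ℤ.- + p ℤ.+ + suc (suc (j ℕ.+ j))     ≈⟨ +-congʳ (+-cong 2a+m≈0 (-‿cong p≡0)) ⟩
    0ℤ ℤ.- 0ℤ ℤ.+ + suc (suc (j ℕ.+ j))                ≡⟨ ≡.refl ⟩
    + suc (suc (j ℕ.+ j))                              ∎
    where open F hiding (_+_; _*_; -_; _-_; 0#; 1#; _^_; _≈_)

  1+a : 1ℤ ℤ.+ a ≡₁ + suc (suc j)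
  1+a = F.+-congˡ {1ℤ} a≡1+j

  1+2a : 1ℤ ℤ.+ 2a ≡₁ + suc (suc (suc (j ℕ.+ j)))
  1+2a = F.+-congˡ {1ℤ} 2a≡2+2j

  1-a≡1+n : 1ℤ ℤ.- a ≡₁ + suc n
  1-a≡1+n = F.trans (F.solve 2 (λ a n → F.con (+ 1) F.:- a F.:= F.con (+ 1) F.:+ n F.:- (a F.:+ n)) F.refl a (+ n)) (F.trans (F.+-congˡ {+ suc n} (F.-‿cong a+n≈0)) (F.+-identityʳ (+ suc n)))

  module _ {G₁ G₂ G₃ : ℤ} (G₁≡ : G₁ ≡₁ Γℕ p (suc (suc j))) (G₂≡ : G₂ ≡₁ Γℕ p (suc (suc (suc (j ℕ.+ j)))))
    (G₃≡ : G₃ ≡₁ Γℕ p (suc n)) where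

    private
      -- One step of the recursion leads from `j + 2` to `j + 1`, where `n!` is the complementary
      -- factorial because `n + (j + 1) = p`; the factor picked up is `-(j + 1)`, that is `-a`.
      G₁n! : G₁ ℤ.* + (n !) ≡₁ ℤ.- a
      G₁n! = begin
        G₁ ℤ.* + (n !)                                  ≈⟨ *-congʳ G₁≡ ⟩
        Γℕ p (suc (suc j)) ℤ.* + (n !)                  ≈⟨ *-congʳ (reflexive (Γℕ-suc (s≤s z≤n) 1+j<p)) ⟩
        ℤ.- + suc j ℤ.* Γℕ p (suc j) ℤ.* + (n !)        ≡⟨ ℤ.*-assoc (ℤ.- + suc j) (Γℕ p (suc j)) (+ (n !)) ⟩
        ℤ.- + suc j ℤ.* (Γℕ p (suc j) ℤ.* + (n !))      ≈⟨ *-cong (-‿cong (sym a≡1+j)) (Γℕ-complement n (suc j) (≡.trans (ℕ.+-suc n j) n+j) (s≤s z≤n)) ⟩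
        ℤ.- a ℤ.* 1ℤ                                    ≈⟨ *-identityʳ (ℤ.- a) ⟩
        ℤ.- a                                           ∎
        where
        open F hiding (_+_; _*_; -_; _-_; 0#; 1#; _^_; _≈_)
        1+j<p : suc j < p
        1+j<p = ≡.subst (suc j <_) (≡.sym (≡.trans p≡ (≡.cong (λ l → suc l ℕ.+ j) n≡))) (s≤s (s≤s (ℕ.m≤n+m j _)))

      G₃j! : G₃ ℤ.* + (j !) ≡₁ 1ℤ
      G₃j! = begin
        G₃ ℤ.* + (j !)                 ≈⟨ *-congʳ G₃≡ ⟩
        Γℕ p (suc n) ℤ.* + (j !)       ≈⟨ Γℕ-complement j (suc n) (≡.trans (ℕ.+-comm j (suc n)) n+j) (s≤s z≤n) ⟩
        1ℤ                             ∎
        where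
        open F hiding (_+_; _*_; -_; _-_; 0#; 1#; _^_; _≈_)

      -- With `k = 2j + 2` one has `k + m = p`. The recursion step at `k` multiplies by `-k` only if
      -- `k < p`, which is the condition on `m`.
      G₂m! : 0 < m → G₂ ℤ.* + (m !) ≡₁ ℤ.- 2a
      G₂m! 0<m = begin
        G₂ ℤ.* + (m !)                          ≈⟨ *-congʳ G₂≡ ⟩
        Γℕ p (suc k) ℤ.* + (m !)                ≈⟨ *-congʳ (reflexive (Γℕ-suc (s≤s z≤n) (≡.subst (k <_) (≡.sym p≡k+m) (ℕ.m<m+n k 0<m)))) ⟩
        ℤ.- + k ℤ.* Γℕ p k ℤ.* + (m !)          ≡⟨ ℤ.*-assoc (ℤ.- + k) (Γℕ p k) (+ (m !)) ⟩
        ℤ.- + k ℤ.* (Γℕ p k ℤ.* + (m !))        ≈⟨ *-cong (-‿cong (sym 2a≡2+2j)) (Γℕ-complement m k (≡.trans (ℕ.+-comm m k) (≡.sym p≡k+m)) (s≤s z≤n)) ⟩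
        ℤ.- 2a ℤ.* 1ℤ                           ≈⟨ *-identityʳ (ℤ.- 2a) ⟩
        ℤ.- 2a                                  ∎
        where
        open F hiding (_+_; _*_; -_; _-_; 0#; 1#; _^_; _≈_)
        k = suc (suc (j ℕ.+ j))
        p≡k+m : p ≡ k ℕ.+ m
        p≡k+m = ≡.trans (≡.trans p≡ (≡.cong (λ l → suc l ℕ.+ j) n≡)) (arrange j s)
          where
          arrange : ∀ j s → suc (suc (j ℕ.+ j ℕ.+ s)) ℕ.+ j ≡ suc (suc (j ℕ.+ j)) ℕ.+ (j ℕ.+ s)
          arrange = ℕ-Solver.solve-∀

      -- Since `Γℕ p 1 = -1`, its complement gives `(p - 1)! ≡ -1`, and `n + j = p - 1`.
      n!j! : + (n !) ℤ.* (Z.sign j ℤ.* + (j !)) ≡₁ ℤ.- 1ℤ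
      n!j! = begin
        + (n !) ℤ.* (Z.sign j ℤ.* + (j !))          ≈⟨ n+j!-split ⟨
        + ((n ℕ.+ j) !)                             ≡⟨ ℤ.neg-involutive (+ ((n ℕ.+ j) !)) ⟨
        ℤ.- (ℤ.- + ((n ℕ.+ j) !))                   ≡⟨ ≡.cong ℤ.-_ (ℤ.-1*i≡-i (+ ((n ℕ.+ j) !))) ⟨
        ℤ.- (-1ℤ ℤ.* + ((n ℕ.+ j) !))               ≡⟨ ≡.cong (λ g → ℤ.- (g ℤ.* + ((n ℕ.+ j) !))) (Γℕ-step-∣ 0 (p ℕ.∣0)) ⟨
        ℤ.- (Γℕ p 1 ℤ.* + ((n ℕ.+ j) !))            ≈⟨ -‿cong (Γℕ-complement (n ℕ.+ j) 1 (≡.trans (ℕ.+-comm (n ℕ.+ j) 1) n+j) (s≤s z≤n)) ⟩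
        ℤ.- 1ℤ                                      ∎
        where
        open F hiding (_+_; _*_; -_; _-_; 0#; 1#; _^_; _≈_)

      p∤-factor : ∀ x y {z} → x ℤ.* y ≡₁ z → ¬ + p ∣.∣ z → ¬ + p ∣.∣ x
      p∤-factor x y e p∤z p∣x = p∤z (Modular.∣-resp e (∣.∣m⇒∣m*n y p∣x))

    p∤gamma : 0 < m → ¬ + p ∣.∣ G₂ ℤ.^ 3 ℤ.* G₃ ℤ.^ 4
    p∤gamma 0<m = p∤* {G₂ ℤ.^ 3} {G₃ ℤ.^ 4} (p∤^ {G₂} 3 (p∤-factor G₂ (+ (m !)) (G₂m! 0<m) p∤-2a)) (p∤^ {G₃} 4 (p∤-factor G₃ (+ (j !)) G₃j! p∤1))
      where
      p∤-2a : ¬ + p ∣.∣ ℤ.- 2a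
      p∤-2a p∣ = p∤small 0<m m<p (Modular.∣-resp (F.trans (F.solve 2 (λ x m → F.:- x F.:= m F.:- (x F.:+ m)) F.refl 2a (+ m))
        (F.trans (F.+-congˡ {+ m} (F.-‿cong 2a+m≈0)) (F.+-identityʳ (+ m)))) p∣)

    module _ {i81 IG : ℤ} {inv! k!⁻⁶ D : ℕ → ℤ}
      (k!*inv! : ∀ k → k < p → + (k !) ℤ.* inv! k ≡₅ 1ℤ)
      (inverse-k!⁶ : ∀ k → k < p → (+ (k !)) ℤ.^ 6 ℤ.* k!⁻⁶ k ≡₅ 1ℤ)
      (inverse-D : ∀ k → k ≤ s → Z.poch 1ℤ k ℤ.* Z.poch 2a k ℤ.^ 3 ℤ.* D k ≡₁ 1ℤ)
      (inverse-G : 0 < m → G₂ ℤ.^ 3 ℤ.* G₃ ℤ.^ 4 ℤ.* IG ≡₁ 1ℤ)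
      (81i≡1 : + 81 ℤ.* i81 ≡₁ 1ℤ) where

      private
        module C = Cyclotomic M
        module E = Evaluation.At C.T.extension C.T.extension-hom {C.σ} {C.ζ} C.σ²+σ≈1 C.ζ²+1≈σζ j s n p n≡ p≡ r r≡ C.ι-cong τ 3τ≡1 inv! k!*inv!

        evaluation : (+ (n !)) ℤ.^ 5 ℤ.* Z.rangeSum p E.summandℤ ≡₅ (+ p) ℤ.^ 4 ℤ.* E.sumℤ
        evaluation = C.ι-injective E.evaluation

        inverse!₁ : ∀ k → k < p → + (k !) ℤ.* inv! k ≡₁ 1ℤ
        inverse!₁ k k<p = reduce (k!*inv! k k<p)

        right-termℤ : ℕ → ℤ
        right-termℤ k = Z.poch (r ℤ.- 1ℤ) k ℤ.* Z.poch a k ℤ.^ 3 ℤ.* D k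

        Σᵣ : ℤ
        Σᵣ = Z.rangeSum (suc s) right-termℤ

        bracket : ℤ
        bracket = Z.sign s ℤ.* + 80 ℤ.* r ℤ.* i81 ℤ.* (G₁ ℤ.^ 2 ℤ.* IG) ℤ.* Σᵣ

        -- m = 0 only for p = 2, where G₂m! is not available but 10 and 80 vanish modulo p.
        matching : + 3 ℤ.* E.sumℤ ≡₁ (+ (n !)) ℤ.^ 5 ℤ.* bracket
        matching = [ zero-case , (λ 0<m → comparison inv! inverse!₁ D inverse-D {G₁} {G₂} {G₃} G₁n! (G₂m! 0<m) G₃j! n!j! {IG} {i81} (inverse-G 0<m) 81i≡1) ]′ (zero-or-positive m)
          where
          zero-or-positive : ∀ k → k ≡ 0 ⊎ 0 < k
          zero-or-positive zero    = inj₁ ≡.refl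
          zero-or-positive (suc k) = inj₂ (s≤s z≤n)
          zero-case : m ≡ 0 → + 3 ℤ.* E.sumℤ ≡₁ (+ (n !)) ℤ.^ 5 ℤ.* bracket
          zero-case m≡0 = comparison₂ (F.trans (F.reflexive (≡.sym +p≡2)) p≡0)
            (Z.poch a n ℤ.* + (n !) ℤ.* Z.binomialSum n E.leadingℤ) ((+ (n !)) ℤ.^ 5) (Z.sign s) (G₁ ℤ.^ 2 ℤ.* IG) i81 Σᵣ
            where
            +p≡2 : + p ≡ + 2
            +p≡2 = ≡.trans +p≡ (≡.cong₂ (λ j s → + 2 ℤ.+ (+ j ℤ.+ + j ℤ.+ + s) ℤ.+ + j) (ℕ.m+n≡0⇒m≡0 j m≡0) (ℕ.m+n≡0⇒n≡0 j m≡0))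

        -- The theorem divides by the sixth power as a whole, the evaluation uses sixth powers of
        -- inverses; inverses modulo `p⁵` are unique.
        k!⁻⁶≡ : ∀ k → k < p → k!⁻⁶ k ≡₅ inv! k ℤ.^ 6
        k!⁻⁶≡ k k<p = Modular.inverse-unique {a = (+ (k !)) ℤ.^ 6} {u = k!⁻⁶ k} {v = inv! k ℤ.^ 6} (inverse-k!⁶ k k<p)
          (Q.trans (Q.solve 2 (λ x y → x Q.:^ 6 Q.:* y Q.:^ 6 Q.:= (x Q.:* y) Q.:^ 6) Q.refl (+ (k !)) (inv! k))
            (Modular.mod-^ {a = + (k !) ℤ.* inv! k} {b = 1ℤ} 6 (k!*inv! k k<p)))

        linear : ∀ k → + 6 ℤ.* + k ℤ.+ r ≡₅ + 3 ℤ.* (a ℤ.+ + (k ℕ.+ k))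
        linear k = Q.trans (Q.+-congˡ {+ 6 ℤ.* + k} (Q.trans (Q.sym (Q.*-identityʳ r)) (Q.*-congˡ {r} (Q.sym 3τ≡1))))
          (Q.solve 3 (λ k r τ → Q.con (+ 6) Q.:* k Q.:+ r Q.:* (Q.con (+ 3) Q.:* τ) Q.:= Q.con (+ 3) Q.:* (r Q.:* τ Q.:+ (k Q.:+ k))) Q.refl (+ k) r τ)

        summand : ℕ → ℤ
        summand k = (+ 6 ℤ.* + k ℤ.+ r) ℤ.* Z.poch a k ℤ.^ 6 ℤ.* k!⁻⁶ k

        summand≡ : ∀ k → k < p → summand k ≡₅ + 3 ℤ.* E.summandℤ k
        summand≡ k k<p = Q.trans
          (Modular.mod-* (Modular.mod-* (linear k) (Q.refl {Z.poch a k ℤ.^ 6})) (k!⁻⁶≡ k k<p))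
          (Q.reflexive (regroup (+ 3) (a ℤ.+ + (k ℕ.+ k)) (Z.poch a k ℤ.^ 6) (inv! k ℤ.^ 6)))
          where
          regroup : ∀ t x y z → t ℤ.* x ℤ.* y ℤ.* z ≡ t ℤ.* (x ℤ.* y ℤ.* z)
          regroup = ℤ-Solver.solve-∀

        N⁵ : ℤ
        N⁵ = (+ (n !)) ℤ.^ 5

        p⁴ : ∀ {x y} → x ≡₁ y → (+ p) ℤ.^ 4 ℤ.* x ≡₅ (+ p) ℤ.^ 4 ℤ.* y
        p⁴ {x} {y} (mod (divides q e)) = mod (divides q (begin
          (+ p) ℤ.^ 4 ℤ.* x ℤ.- (+ p) ℤ.^ 4 ℤ.* y      ≡⟨ factor ((+ p) ℤ.^ 4) x y ⟩
          (+ p) ℤ.^ 4 ℤ.* (x ℤ.- y)                    ≡⟨ ≡.cong ((+ p) ℤ.^ 4 ℤ.*_) e ⟩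
          (+ p) ℤ.^ 4 ℤ.* (q ℤ.* + p)                  ≡⟨ commute ((+ p) ℤ.^ 4) q (+ p) ⟩
          q ℤ.* (+ p) ℤ.^ 5                            ≡⟨ ≡.cong (q ℤ.*_) (pos-^ p 5) ⟨
          q ℤ.* M                                      ∎))
          where
          open ≡.≡-Reasoning
          factor : ∀ P x y → P ℤ.* x ℤ.- P ℤ.* y ≡ P ℤ.* (x ℤ.- y)
          factor = ℤ-Solver.solve-∀
          commute : ∀ P q p → P ℤ.* (q ℤ.* p) ≡ q ℤ.* (p ℤ.* P)
          commute = ℤ-Solver.solve-∀

        cancel-N⁵ : ∀ {x y} → N⁵ ℤ.* x ≡₅ N⁵ ℤ.* y → x ≡₅ y
        cancel-N⁵ {x} {y} e = trans (sym (undo x)) (trans (*-congˡ {inv! n ℤ.^ 5} e) (undo y))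
          where
          open Q hiding (_+_; _*_; -_; _-_; 0#; 1#; _^_; _≈_)
          undo : ∀ x → inv! n ℤ.^ 5 ℤ.* (N⁵ ℤ.* x) ≡₅ x
          undo x = trans (solve 3 (λ i n x → i :^ 5 :* (n :^ 5 :* x) := (n :* i) :^ 5 :* x) refl (inv! n) (+ (n !)) x)
            (trans (*-congʳ {x} (Modular.mod-^ 5 (k!*inv! n n<p))) (*-identityˡ x))

      -- After multiplication by `(n!)⁵`, a unit because `n < p`, both sides are multiples of `p⁴`
      -- modulo `p⁵`, so that only `matching` modulo `p` is required.
      congruence : Z.rangeSum p (λ k → (+ 6 ℤ.* + k ℤ.+ r) ℤ.* Z.poch a k ℤ.^ 6 ℤ.* k!⁻⁶ k) ≡₅
        Z.sign s ℤ.* + 80 ℤ.* r ℤ.* (+ p) ℤ.^ 4 ℤ.* i81 ℤ.* (G₁ ℤ.^ 2 ℤ.* IG) ℤ.*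
          Z.rangeSum (suc s) (λ k → Z.poch (r ℤ.- 1ℤ) k ℤ.* Z.poch a k ℤ.^ 3 ℤ.* D k)
      congruence = cancel-N⁵ (begin
        N⁵ ℤ.* Z.rangeSum p summand                                            ≈⟨ *-congˡ {N⁵} (trans (rangeSum-cong p summand≡) (rangeSum-*ˡ p (+ 3) E.summandℤ)) ⟩
        N⁵ ℤ.* (+ 3 ℤ.* Z.rangeSum p E.summandℤ)                               ≡⟨ swap N⁵ (+ 3) (Z.rangeSum p E.summandℤ) ⟩
        + 3 ℤ.* (N⁵ ℤ.* Z.rangeSum p E.summandℤ)                               ≈⟨ *-congˡ {+ 3} evaluation ⟩
        + 3 ℤ.* ((+ p) ℤ.^ 4 ℤ.* E.sumℤ)                                       ≡⟨ swap (+ 3) ((+ p) ℤ.^ 4) E.sumℤ ⟩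
        (+ p) ℤ.^ 4 ℤ.* (+ 3 ℤ.* E.sumℤ)                                       ≈⟨ p⁴ {+ 3 ℤ.* E.sumℤ} {N⁵ ℤ.* bracket} matching ⟩
        (+ p) ℤ.^ 4 ℤ.* (N⁵ ℤ.* bracket)                                       ≡⟨ regroup ((+ p) ℤ.^ 4) N⁵ (Z.sign s ℤ.* + 80 ℤ.* r) i81 (G₁ ℤ.^ 2 ℤ.* IG) Σᵣ ⟩
        N⁵ ℤ.* (Z.sign s ℤ.* + 80 ℤ.* r ℤ.* (+ p) ℤ.^ 4 ℤ.* i81 ℤ.* (G₁ ℤ.^ 2 ℤ.* IG) ℤ.* Σᵣ) ∎)
        where
        open Q hiding (_+_; _*_; -_; _-_; 0#; 1#; _^_; _≈_)
        swap : ∀ x y z → x ℤ.* (y ℤ.* z) ≡ y ℤ.* (x ℤ.* z)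
        swap = ℤ-Solver.solve-∀
        regroup : ∀ P N y i g Σ → P ℤ.* (N ℤ.* (y ℤ.* i ℤ.* g ℤ.* Σ)) ≡ N ℤ.* (y ℤ.* P ℤ.* i ℤ.* g ℤ.* Σ)
        regroup = ℤ-Solver.solve-∀

-- Natural parameters for `r` and `p`, and the theorem in `ℤₚ`.

-- The witnesses are `s = 1 - r` and `j = t/3` with `t = p - 2 - s`. The lower bound on `p` makes
-- `t` a natural number, and `p + r = 3 + t` transfers divisibility by `3`.
parameters : ∀ r p → r ℤ.≤ 1ℤ → (ℤ.+ 3) ∣ (ℤ.+ p ℤ.- (ℤ.- r)) → ℤ.+ p ℤ.≥ ℤ.+ 3 ℤ.- r →
  ∃ λ j → ∃ λ s → r ≡ 1ℤ ℤ.- ℤ.+ s × p ≡ suc (suc (j ℕ.+ j ℕ.+ s)) ℕ.+ j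
parameters r p r≤1 3∣p+r p≥3-r = j , s , r≡ , p≡
  where
  s = ℤ.∣ 1ℤ ℤ.- r ∣
  +s≡ : ℤ.+ s ≡ 1ℤ ℤ.- r
  +s≡ = ℤ.0≤i⇒+∣i∣≡i (ℤ.i≤j⇒0≤j-i r≤1)
  r≡ : r ≡ 1ℤ ℤ.- ℤ.+ s
  r≡ = ≡.trans (twice r) (≡.cong (λ x → 1ℤ ℤ.- x) (≡.sym +s≡))
    where
    twice : ∀ r → r ≡ 1ℤ ℤ.- (1ℤ ℤ.- r)
    twice = ℤ-Solver.solve-∀
  2+s≤p : 2 ℕ.+ s ℕ.≤ p
  2+s≤p = ℤ.drop‿+≤+ (≡.subst (ℤ._≤ ℤ.+ p) (≡.sym (≡.trans (≡.cong (ℤ._+_ (ℤ.+ 2)) +s≡) (collect r))) p≥3-r)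
    where
    collect : ∀ r → ℤ.+ 2 ℤ.+ (1ℤ ℤ.- r) ≡ ℤ.+ 3 ℤ.- r
    collect = ℤ-Solver.solve-∀
  t = proj₁ (ℕ.m≤n⇒∃[o]m+o≡n 2+s≤p)
  p≡2+s+t : 2 ℕ.+ s ℕ.+ t ≡ p
  p≡2+s+t = proj₂ (ℕ.m≤n⇒∃[o]m+o≡n 2+s≤p)
  p+r≡3+t : ℤ.+ p ℤ.- (ℤ.- r) ≡ ℤ.+ (3 ℕ.+ t)
  p+r≡3+t = ≡.trans (≡.cong₂ (λ x y → x ℤ.- (ℤ.- y)) (≡.cong ℤ.+_ (≡.sym p≡2+s+t)) r≡) (collect (ℤ.+ s) (ℤ.+ t))
    where
    collect : ∀ s t → (ℤ.+ 2 ℤ.+ s ℤ.+ t) ℤ.- (ℤ.- (1ℤ ℤ.- s)) ≡ ℤ.+ 3 ℤ.+ t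
    collect = ℤ-Solver.solve-∀
  3∣t : 3 ℕ.∣ t
  3∣t = ℕ.∣m+n∣m⇒∣n (≡.subst (3 ℕ.∣_) (≡.cong ℤ.∣_∣ p+r≡3+t) 3∣p+r) ℕ.∣-refl
  j = ℕ.quotient 3∣t
  p≡ : p ≡ suc (suc (j ℕ.+ j ℕ.+ s)) ℕ.+ j
  p≡ = ≡.trans (≡.sym p≡2+s+t) (≡.trans (≡.cong (2 ℕ.+ s ℕ.+_) (ℕ._∣_.equality 3∣t)) (arrange s j))
    where
    arrange : ∀ s j → 2 ℕ.+ s ℕ.+ j ℕ.* 3 ≡ suc (suc (j ℕ.+ j ℕ.+ s)) ℕ.+ j
    arrange = ℕ-Solver.solve-∀

-- For `p = 3` the congruence condition would make `3` divide `r`.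
p∤three : ∀ r p → Prime p → Coprime r (ℤ.+ 3) → (ℤ.+ 3) ∣ (ℤ.+ p ℤ.- (ℤ.- r)) → ¬ (ℤ.+ p) ∣.∣ (ℤ.+ 3)
p∤three r p p-prime coprime 3∣p+r p∣3 with prime⇒irreducible (from-yes (prime? 3)) (∣.∣⇒∣ᵤ p∣3)
... | inj₁ ≡.refl = ¬prime[1] p-prime
... | inj₂ ≡.refl with coprime (∣.∣⇒∣ᵤ (≡.subst ((ℤ.+ 3) ∣.∣_) (cancel r) (∣.∣m∣n⇒∣m+n {ℤ.+ 3} {ℤ.+ 3 ℤ.- (ℤ.- r)} {ℤ.- (ℤ.+ 3)} (∣.∣ᵤ⇒∣ {ℤ.+ 3} {ℤ.+ 3 ℤ.- (ℤ.- r)} 3∣p+r) (∣.divides (ℤ.- 1ℤ) ≡.refl))) , ℕ.∣-refl)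
  where
  cancel : ∀ r → (ℤ.+ 3 ℤ.- (ℤ.- r)) ℤ.+ (ℤ.- (ℤ.+ 3)) ≡ r
  cancel = ℤ-Solver.solve-∀
...   | ()

-- From `s = 3` on the absolute value is `s - 2`, of the same parity as `s`.
sign-∣2-s∣ : ∀ s → Z.sign ℤ.∣ 1ℤ ℤ.- ℤ.+ s ℤ.+ 1ℤ ∣ ≡ Z.sign s
sign-∣2-s∣ zero                = ≡.refl
sign-∣2-s∣ (suc zero)          = ≡.refl
sign-∣2-s∣ (suc (suc zero))    = ≡.refl
sign-∣2-s∣ (suc (suc (suc s))) = ≡.sym (ℤ.neg-involutive (Z.sign (suc s)))

sign-∣r+1∣ : ∀ {r} s → r ≡ 1ℤ ℤ.- ℤ.+ s → Z.sign ℤ.∣ r ℤ.+ 1ℤ ∣ ≡ Z.sign s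
sign-∣r+1∣ s ≡.refl = sign-∣2-s∣ s

∣1-r∣ : ∀ {r} s → r ≡ 1ℤ ℤ.- ℤ.+ s → ℤ.∣ 1ℤ ℤ.- r ∣ ≡ s
∣1-r∣ s ≡.refl = ≡.cong ℤ.∣_∣ (twice (ℤ.+ s))
  where
  twice : ∀ s → 1ℤ ℤ.- (1ℤ ℤ.- s) ≡ s
  twice = ℤ-Solver.solve-∀

-- Not inlined in theorem2: in a definition, unlike in a type signature, the names
-- copied by the local open are unfolded, and comparing copies with originals is
-- infeasible (it descends into the coherence proofs of ℤₚ).
Supercongruence : (r : ℤ) (p : ℕ) → Prime p → Set
Supercongruence r p p-prime =
    let open Padic p p-prime
        r/3  = fromℤ r / fromℕ 3
        2r/3 = (fromℕ 2 * fromℤ r) / fromℕ 3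
    in
    (∑[ k < p ] ((fromℕ 6 * fromℕ k + fromℤ r) * pochhammer r/3 k ^ 6 / fromℕ (k !) ^ 6))
      ≡ ((- 1#) ^ ℤ.∣ r ℤ.+ 1ℤ ∣ * fromℕ 80 * fromℤ r * fromℕ p ^ 4 / fromℕ 81)
        * (Γₚ (1# + r/3) ^ 2 / (Γₚ (1# + 2r/3) ^ 3 * Γₚ (1# - r/3) ^ 4))
        * (∑[ k < suc ℤ.∣ 1ℤ ℤ.- r ∣ ]
            (pochhammer (fromℤ r - 1#) k * pochhammer r/3 k ^ 3
              / (pochhammer 1# k * pochhammer 2r/3 k ^ 3)))
      [modp^ 5 ]

-- The level-five residues of both sides are the integer expressions of `congruence`, up to the
-- unfolding of sums, rising factorials and signs. The side conditions say that everything divided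
-- by is a unit, for `81` because it is a power of `3`. The Gamma quotient gets its inverse only for
-- `0 < m`.
supercongruence : ∀ j s r p (p-prime : Prime p) → r ≡ 1ℤ ℤ.- ℤ.+ s → p ≡ suc (suc (j ℕ.+ j ℕ.+ s)) ℕ.+ j → ¬ (ℤ.+ p) ∣.∣ (ℤ.+ 3) →
  Supercongruence r p p-prime
supercongruence j s r p p-prime r≡ p≡ p∤3 =
    let open Padic p p-prime
        r/3         = fromℤ r / fromℕ 3
        2r/3        = (fromℕ 2 * fromℤ r) / fromℕ 3
        summand     = λ k → (fromℕ 6 * fromℕ k + fromℤ r) * pochhammer r/3 k ^ 6 / fromℕ (k !) ^ 6
        gamma₁      = Γₚ (1# + r/3)
        gamma₂      = Γₚ (1# + 2r/3)
        gamma₃      = Γₚ (1# - r/3)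
        prefactor   = ((- 1#) ^ ℤ.∣ r ℤ.+ 1ℤ ∣ * fromℕ 80 * fromℤ r * fromℕ p ^ 4 / fromℕ 81)
                        * (gamma₁ ^ 2 / (gamma₂ ^ 3 * gamma₃ ^ 4))
        denominator = λ k → pochhammer 1# k * pochhammer 2r/3 k ^ 3
        right-term  = λ k → pochhammer (fromℤ r - 1#) k * pochhammer r/3 k ^ 3 / denominator k
        count       = suc ℤ.∣ 1ℤ ℤ.- r ∣
        n           = suc (j ℕ.+ j ℕ.+ s)
        inverse     = Lifting.inverse p-prime
        τ           = residue (fromℕ 3 ⁻¹) 5
        a           = r ℤ.* τ
        2a          = ℤ.+ 2 ℤ.* r ℤ.* τ
        3τ≡1        = inverse (fromℕ 3) (ℤ.+ 3) ≡.refl p∤3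
        G₁          = residue gamma₁ 5
        G₂          = residue gamma₂ 5
        G₃          = residue gamma₃ 5
        IG          = residue ((gamma₂ ^ 3 * gamma₃ ^ 4) ⁻¹) 5
        i81         = residue (fromℕ 81 ⁻¹) 5
        inv!        = λ k → residue (fromℕ (k !) ⁻¹) 5
        k!⁻⁶        = λ k → residue ((fromℕ (k !) ^ 6) ⁻¹) 5
        D           = λ k → residue (denominator k ⁻¹) 5
        G₁≡         = Lifting.Γₚ-at p-prime (1# + r/3) (suc (suc j)) (IntegerCongruence.1+a j s n p ≡.refl p≡ p-prime r r≡ τ 3τ≡1)
        G₂≡         = Lifting.Γₚ-at p-prime (1# + 2r/3) (suc (suc (suc (j ℕ.+ j)))) (IntegerCongruence.1+2a j s n p ≡.refl p≡ p-prime r r≡ τ 3τ≡1)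
        G₃≡         = Lifting.Γₚ-at p-prime (1# - r/3) (suc n) (IntegerCongruence.1-a≡1+n j s n p ≡.refl p≡ p-prime r r≡ τ 3τ≡1)
        agree       = IntegerCongruence.congruence j s n p ≡.refl p≡ p-prime r r≡ τ 3τ≡1 {G₁} {G₂} {G₃} G₁≡ G₂≡ G₃≡ {i81} {IG} {inv!} {k!⁻⁶} {D}
                        (λ k k<p → inverse (fromℕ (k !)) (ℤ.+ (k !)) ≡.refl (GammaModulo.p∤! p-prime k<p))
                        (λ k k<p → inverse (fromℕ (k !) ^ 6) ((ℤ.+ (k !)) ℤ.^ 6) ≡.refl
                          (GammaModulo.p∤^ p-prime {ℤ.+ (k !)} 6 (GammaModulo.p∤! p-prime k<p)))
                        (λ k k≤s → IntegerCongruence.reduce j s n p ≡.refl p≡ p-prime r r≡ τ 3τ≡1 (inverse (denominator k) (Z.poch 1ℤ k ℤ.* Z.poch 2a k ℤ.^ 3)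
                          (≡.cong₂ (λ x y → x ℤ.* y ℤ.^ 3) (Lifting.residue-pochhammer p-prime 1# k 5) (Lifting.residue-pochhammer p-prime 2r/3 k 5))
                          (IntegerCongruence.p∤denominator j s n p ≡.refl p≡ p-prime r r≡ τ 3τ≡1 k k≤s)))
                        (λ 0<m → IntegerCongruence.reduce j s n p ≡.refl p≡ p-prime r r≡ τ 3τ≡1 (inverse (gamma₂ ^ 3 * gamma₃ ^ 4) (G₂ ℤ.^ 3 ℤ.* G₃ ℤ.^ 4) ≡.refl (IntegerCongruence.p∤gamma j s n p ≡.refl p≡ p-prime r r≡ τ 3τ≡1 G₁≡ G₂≡ G₃≡ 0<m)))
                        (IntegerCongruence.reduce j s n p ≡.refl p≡ p-prime r r≡ τ 3τ≡1 (inverse (fromℕ 81) (ℤ.+ 81) ≡.refl (GammaModulo.p∤^ p-prime {ℤ.+ 3} 4 p∤3)))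
        left        = ≡.trans (Lifting.residue-∑ p-prime p summand 5) (Lifting.rangeSum-≡ p-prime p (λ k → residue (summand k) 5)
                        (λ k → (ℤ.+ 6 ℤ.* ℤ.+ k ℤ.+ r) ℤ.* Z.poch a k ℤ.^ 6 ℤ.* k!⁻⁶ k)
                        (λ k → ≡.cong (λ x → (ℤ.+ 6 ℤ.* ℤ.+ k ℤ.+ r) ℤ.* x ℤ.^ 6 ℤ.* k!⁻⁶ k) (Lifting.residue-pochhammer p-prime r/3 k 5)))
        factor      = ≡.cong (λ x → x ℤ.* ℤ.+ 80 ℤ.* r ℤ.* (ℤ.+ p) ℤ.^ 4 ℤ.* i81 ℤ.* (G₁ ℤ.^ 2 ℤ.* IG))
                        (≡.trans (Lifting.residue-sign p-prime ℤ.∣ r ℤ.+ 1ℤ ∣ 5) (sign-∣r+1∣ s r≡))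
        termℤ       = λ k → Z.poch (r ℤ.- 1ℤ) k ℤ.* Z.poch a k ℤ.^ 3 ℤ.* D k
        right       = ≡.trans (≡.trans (Lifting.residue-∑ p-prime count right-term 5) (Lifting.rangeSum-≡ p-prime count (λ k → residue (right-term k) 5) termℤ
                        (λ k → ≡.cong₂ (λ x y → x ℤ.* y ℤ.^ 3 ℤ.* D k) (Lifting.residue-pochhammer p-prime (fromℤ r - 1#) k 5) (Lifting.residue-pochhammer p-prime r/3 k 5))))
                        (≡.cong (λ l → Z.rangeSum (suc l) termℤ) (∣1-r∣ s r≡))
    in Lifting.conclude p-prime (∑ p summand) (prefactor * ∑ count right-term) left (≡.cong₂ ℤ._*_ factor right) agree

theorem2 :
    (r : ℤ) → r ℤ.≤ 1ℤ → Coprime r (ℤ.+ 3) →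
    (p : ℕ) (p-prime : Prime p) →
    (ℤ.+ 3) ∣ (ℤ.+ p ℤ.- (ℤ.- r)) → ℤ.+ p ℤ.≥ ℤ.+ 3 ℤ.- r →
    Supercongruence r p p-prime
theorem2 r r≤1 coprime p p-prime 3∣p+r p≥3-r =
  let (j , s , r≡ , p≡) = parameters r p r≤1 3∣p+r p≥3-r
  in supercongruence j s r p p-prime r≡ p≡ (p∤three r p p-prime coprime 3∣p+r)
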